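{- Let $n\ge 8$ with $n=p$ or $n=p+1$ for a prime $p$, and let $\widetilde\Delta_n$ be the connected component of $\widetilde P_0(S_n)$ containing $[(1\,2)]$. Then: (i) $\widetilde P_0(S_n)$ consists of $\widetilde\Delta_n$, which contains $[\psi]$ for every $\psi\in S_n\setminus\{\mathrm{id}\}$ that is not a $p$-cycle, together with $(n-2)!$ (if $n=p$) or $n(n-3)!$ (if $n=p+1$) further components, each an isolated vertex; (ii) $P_0(S_n)$ consists of the component induced on $\{\psi\in S_n\setminus\{\mathrm{id}\}:[\psi]\in V(\widetilde\Delta_n)\}$, which contains every non-identity permutation other than the $p$-cycles, together with $(n-2)!$ (resp. $n(n-3)!$) further components, each consisting of $p-1$ $p$-cycles forming a complete graph; (iii) $P_0(\mathcal T(S_n))$ consists of the component whose vertex set is $\{T_\psi:[\psi]\in V(\widetilde\Delta_n)\}$, which contains $T_\psi$ for every non-identity $\psi$ that is not a $p$-cycle, together with the isolated vertex $[p]$ (if $n=p$) or $[1,p]$ (if $n=p+1$); (iv) $\mathcal O_0(S_n)$ consists of the component with vertex set $\{o(\psi):[\psi]\in V(\widetilde\Delta_n)\}$, which contains the order of every non-identity permutation of order other than $p$, together with the isolated vertex $p$. Moreover, in each of (i)-(iv) the large (main) component is not a complete graph.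
   Context: $P_0(G)$: vertex set $G\setminus\{1\}$, distinct $x,y$ adjacent iff one is a positive power of the other. $\widetilde P_0(G)$: vertex set $\{[x]:x\ne 1\}$ with $[x]=\{y:\langle y\rangle=\langle x\rangle\}$, distinct $[x],[y]$ adjacent iff some representatives are one a positive power of the other. $\mathcal O_0(G)$: vertices the element orders $\ne 1$, distinct $m,m'$ adjacent iff one divides the other. For $\psi\in S_n$, the type $T_\psi$ is the partition of $n$ given by orbit lengths of $\langle\psi\rangle$ on $\{1,\dots,n\}$; a $p$-cycle has type $[1^{n-p},p]$. For a partition $T=[m_1^{t_1},\dots,m_k^{t_k}]$, $T^a=[(m_i/\gcd(a,m_i))^{t_i\gcd(a,m_i)}]_i$. $P_0(\mathcal T(S_n))$: vertices the partitions of $n$ other than $[1^n]$, distinct $T,T'$ adjacent iff one is a power of the other. -}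

module Defs where

open import Algebra.Bundles using (Group)
import Algebra.Definitions.RawMonoid as RawMonoidDefs
import Algebra.Properties.Monoid.Mult as MonoidMult
open import Data.Fin using (Fin; zero; suc; toℕ; fromℕ<)
open import Data.Fin.Permutation as Perm using (Permutation′; _⟨$⟩ʳ_; _∘ₚ_; flip; transpose)
open import Data.Fin.Properties using (any?; pigeonhole; toℕ<n; toℕ-fromℕ<) renaming (_≟_ to _≟ᶠ_)
open import Data.Integer using (ℤ; +_; -[1+_])
open import Data.List using (List; []; _∷_; _++_; length; map; filter; replicate; concatMap; deduplicate; allFin)
open import Data.List.Membership.Propositional using (_∈_; lose)
open import Data.List.Membership.Propositional.Properties using (∈-allFin; ∈-filter⁺; ∈-map⁺)
open import Data.List.Properties using (length-tabulate; filter-some)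
open import Data.List.Relation.Binary.Permutation.Propositional as ↭ using (_↭_; ↭-refl; ↭-sym; ↭-trans)
open import Data.List.Relation.Binary.Permutation.Propositional.Properties using (All-resp-↭; ++⁺ˡ; shifts)
open import Data.List.Relation.Unary.All as All using (All; []; _∷_)
import Data.List.Relation.Unary.All.Properties as All
open import Data.List.Relation.Unary.Any using (here; there)
open import Data.Nat using (ℕ; zero; suc; _+_; _*_; _∸_; _/_; _%_; _≤_; _<_; s≤s; NonZero; ≢-nonZero; ≢-nonZero⁻¹; >-nonZero)
open import Data.Nat.DivMod using (m≡m%n+[m/n]*n; m%n<n; m*[n/m]≡n)
open import Data.Nat.Divisibility using (_∣_)
open import Data.Nat.GCD using (gcd; gcd[m,n]∣n; gcd[m,n]≢0; n/gcd[m,n]≢0)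
open import Data.Nat.ListAction using (sum)
open import Data.Nat.ListAction.Properties using (sum-++)
open import Data.Nat.Properties using (+-commutativeSemigroup; +-comm; *-suc; *-identityʳ; m<n⇒0<n∸m; m∸n≤m; <⇒≤; ≤-refl; ≤-trans; ≤-pred; m∸n+n≡m; <-≤-trans)
open import Algebra.Properties.CommutativeSemigroup +-commutativeSemigroup using (x∙yz≈y∙xz)
open import Data.Product using (Σ-syntax; ∃; ∃-syntax; _×_; _,_; proj₁; proj₂)
open import Data.Sum using (_⊎_; inj₁; inj₂; swap) renaming (map to ⊎-map)
open import Function using (_∘_; id)
open import Function.Bundles using (Bijection)
open import Level using (0ℓ)
open import Relation.Binary using (Rel; Setoid; IsEquivalence; Symmetric; Irreflexive; _Respects₂_; Decidable)
open import Relation.Binary.Construct.Closure.ReflexiveTransitive using (Star)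
open import Relation.Binary.Construct.Union using (_∪_)
open import Relation.Binary.PropositionalEquality using (_≡_; _≢_; refl; sym; trans; cong; cong₂; subst; module ≡-Reasoning)
import Relation.Binary.PropositionalEquality as ≡
open import Relation.Nullary using (¬_; yes; no; contradiction)
open import Relation.Nullary.Decidable using (map′; ¬?)
open import Relation.Unary using (Pred; _≐_; _⊥_)
open import Relation.Unary.Properties using (≐-refl; ≐-sym; ≐-trans)

record Graph : Set₁ where
  infix 4 _≈_ _~_
  field
    Vertex        : Set
    _≈_           : Rel Vertex 0ℓ
    isEquivalence : IsEquivalence _≈_
    _~_           : Rel Vertex 0ℓ
    ~-sym         : Symmetric _~_
    ~-irrefl      : Irreflexive _≈_ _~_
    ~-resp-≈      : _~_ Respects₂ _≈_

  vertexSetoid : Setoid 0ℓ 0ℓ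
  vertexSetoid = record { isEquivalence = isEquivalence }

  -- Paths may pass between equal representatives of the same vertex.
  Connected : Rel Vertex 0ℓ
  Connected = Star (_≈_ ∪ _~_)

  IsComponent : Pred Vertex 0ℓ → Set
  IsComponent C = ∃[ u ] C ≐ Connected u

  Isolated : Pred Vertex 0ℓ
  Isolated u = ∀ v → ¬ u ~ v

  IsComplete : Set
  IsComplete = ∀ u v → ¬ u ≈ v → u ~ v

  HasSize : ℕ → Set
  HasSize m = Bijection (≡.setoid (Fin m)) vertexSetoid

open Graph using (Vertex)

induced : (Γ : Graph) → Pred (Vertex Γ) 0ℓ → Graph
induced Γ C = record
  { Vertex        = ∃ C
  ; _≈_           = λ u v → proj₁ u ≈ proj₁ v
  ; isEquivalence = record { refl = E.refl ; sym = E.sym ; trans = E.trans }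
  ; _~_           = λ u v → proj₁ u ~ proj₁ v
  ; ~-sym         = ~-sym
  ; ~-irrefl      = ~-irrefl
  ; ~-resp-≈      = proj₁ ~-resp-≈ , proj₂ ~-resp-≈
  }
  where
  open Graph Γ hiding (Vertex)
  module E = IsEquivalence isEquivalence

-- Components are inhabited, so disjointness makes them distinct and N is
-- the exact number of components other than C.
record ConsistsOf (Γ : Graph) (C : Pred (Vertex Γ) 0ℓ)
                  (N : ℕ) (Q : Pred (Vertex Γ) 0ℓ → Set) : Set₁ where
  open Graph Γ using (IsComponent)
  field
    main-isComponent    : IsComponent C
    further             : Fin N → Pred (Vertex Γ) 0ℓ
    further-isComponent : ∀ i → IsComponent (further i)
    further-satisfies   : ∀ i → Q (further i)
    main⊥further        : ∀ i → C ⊥ further i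
    further⊥further     : ∀ i j → i ≢ j → further i ⊥ further j
    cover               : ∀ v → C v ⊎ ∃[ i ] further i v

module _ (G : Group 0ℓ 0ℓ) where
  open Group G using (Carrier; _≈_; ε; _⁻¹; rawMonoid; monoid)
  open RawMonoidDefs rawMonoid using () renaming (_×_ to _times_)

  pow : Carrier → ℕ → Carrier
  pow x k = k times x

  powℤ : Carrier → ℤ → Carrier
  powℤ x (+ k)    = pow x k
  powℤ x -[1+ k ] = pow x (suc k) ⁻¹

  ⟨_⟩ : Carrier → Pred Carrier 0ℓ
  ⟨ x ⟩ z = ∃[ k ] z ≈ powℤ x k

  IsPositivePowerOf : Rel Carrier 0ℓ
  IsPositivePowerOf x y = ∃[ k ] NonZero k × x ≈ pow y k

  IsOrder : Carrier → ℕ → Set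
  IsOrder x m = NonZero m × pow x m ≈ ε ×
                (∀ k → NonZero k → pow x k ≈ ε → m ≤ k)

  _∈[_] : Rel Carrier 0ℓ
  y ∈[ x ] = ⟨ y ⟩ ≐ ⟨ x ⟩

  P₀ : Graph
  P₀ = record
    { Vertex        = Σ[ x ∈ Carrier ] ¬ x ≈ ε
    ; _≈_           = λ x y → proj₁ x ≈ proj₁ y
    ; isEquivalence = record
      { refl = Group.refl G ; sym = Group.sym G ; trans = Group.trans G }
    ; _~_           = λ x y → ¬ proj₁ x ≈ proj₁ y ×
                        (IsPositivePowerOf (proj₁ x) (proj₁ y) ⊎
                         IsPositivePowerOf (proj₁ y) (proj₁ x))
    ; ~-sym         = λ (x≉y , p) → x≉y ∘ Group.sym G , swap p
    ; ~-irrefl      = λ x≈y x~y → proj₁ x~y x≈y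
    ; ~-resp-≈      =
        (λ y≈z (x≉y , p) →
          (λ x≈z → x≉y (Group.trans G x≈z (Group.sym G y≈z))) ,
          ⊎-map (respʳ y≈z) (respˡ y≈z) p) ,
        (λ y≈z (y≉x , p) →
          (λ z≈x → y≉x (Group.trans G y≈z z≈x)) ,
          ⊎-map (respˡ y≈z) (respʳ y≈z) p)
    }
    where
    respˡ : ∀ {x y z} → x ≈ y → IsPositivePowerOf x z → IsPositivePowerOf y z
    respˡ x≈y (k , k≢0 , e) = k , k≢0 , Group.trans G (Group.sym G x≈y) e

    respʳ : ∀ {x y z} → x ≈ y → IsPositivePowerOf z x → IsPositivePowerOf z y
    respʳ x≈y (k , k≢0 , e) =
      k , k≢0 , Group.trans G e (MonoidMult.×-congʳ monoid k x≈y)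

  -- A vertex [x] is given by a representative x; classes are compared
  -- by [x] = [y] iff ⟨x⟩ = ⟨y⟩.
  P̃₀ : Graph
  P̃₀ = record
    { Vertex        = Σ[ x ∈ Carrier ] ¬ x ≈ ε
    ; _≈_           = λ x y → ⟨ proj₁ x ⟩ ≐ ⟨ proj₁ y ⟩
    ; isEquivalence = record { refl = ≐-refl ; sym = ≐-sym ; trans = ≐-trans }
    ; _~_           = λ x y → ¬ (⟨ proj₁ x ⟩ ≐ ⟨ proj₁ y ⟩) ×
                        (∃[ x′ ] ∃[ y′ ] x′ ∈[ proj₁ x ] × y′ ∈[ proj₁ y ] ×
                         (IsPositivePowerOf x′ y′ ⊎ IsPositivePowerOf y′ x′))
    ; ~-sym         = λ (x≉y , x′ , y′ , x′∈ , y′∈ , p) →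
                        x≉y ∘ ≐-sym , y′ , x′ , y′∈ , x′∈ , swap p
    ; ~-irrefl      = λ x≈y x~y → proj₁ x~y x≈y
    ; ~-resp-≈      =
        (λ y≈z (x≉y , x′ , y′ , x′∈ , y′∈ , p) →
          (λ x≈z → x≉y (≐-trans x≈z (≐-sym y≈z))) ,
          x′ , y′ , x′∈ , ≐-trans y′∈ y≈z , p) ,
        (λ y≈z (y≉x , y′ , x′ , y′∈ , x′∈ , p) →
          (λ z≈x → y≉x (≐-trans y≈z z≈x)) ,
          y′ , x′ , ≐-trans y′∈ y≈z , x′∈ , p)
    }

  [_] : Vertex P₀ → Vertex P̃₀
  [ x ] = x

  O₀ : Graph
  O₀ = record
    { Vertex        = Σ[ m ∈ ℕ ] m ≢ 1 × ∃[ x ] IsOrder x m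
    ; _≈_           = λ m m′ → proj₁ m ≡ proj₁ m′
    ; isEquivalence = record { refl = refl ; sym = ≡.sym ; trans = ≡.trans }
    ; _~_           = λ m m′ → proj₁ m ≢ proj₁ m′ ×
                        (proj₁ m ∣ proj₁ m′ ⊎ proj₁ m′ ∣ proj₁ m)
    ; ~-sym         = λ (m≢m′ , d) → m≢m′ ∘ ≡.sym , swap d
    ; ~-irrefl      = λ m≡m′ m~m′ → proj₁ m~m′ m≡m′
    ; ~-resp-≈      = (λ { refl m~m′ → m~m′ }) , (λ { refl m~m′ → m~m′ })
    }

Sym : ℕ → Group 0ℓ 0ℓ
Sym n = record
  { Carrier = Permutation′ n
  ; _≈_     = Perm._≈_
  ; _∙_     = _∘ₚ_
  ; ε       = Perm.id
  ; _⁻¹     = flip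
  ; isGroup = record
    { isMonoid = record
      { isSemigroup = record
        { isMagma = record
          { isEquivalence = record
            { refl  = λ _ → refl
            ; sym   = λ e i → sym (e i)
            ; trans = λ e f i → trans (e i) (f i)
            }
          ; ∙-cong = λ {_} {σ} {_} {τ} e f i →
              trans (f _) (cong (τ ⟨$⟩ʳ_) (e i))
          }
        ; assoc = λ _ _ _ _ → refl
        }
      ; identity = (λ _ _ → refl) , (λ _ _ → refl)
      }
    ; inverse = (λ π _ → Perm.inverseʳ π) , (λ π _ → Perm.inverseˡ π)
    ; ⁻¹-cong = λ {σ} {τ} e i → begin
        flip σ ⟨$⟩ʳ i                          ≡⟨ Perm.inverseˡ τ ⟨
        flip τ ⟨$⟩ʳ (τ ⟨$⟩ʳ (flip σ ⟨$⟩ʳ i))   ≡⟨ cong (flip τ ⟨$⟩ʳ_) (e _) ⟨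
        flip τ ⟨$⟩ʳ (σ ⟨$⟩ʳ (flip σ ⟨$⟩ʳ i))   ≡⟨ cong (flip τ ⟨$⟩ʳ_) (Perm.inverseʳ σ) ⟩
        flip τ ⟨$⟩ʳ i                          ∎
    }
  }
  where open ≡-Reasoning

-- The transposition (1 2); the points 1, …, n are 0, …, n - 1 here.
[12] : ∀ {n} → 2 ≤ n → Vertex (P₀ (Sym n))
[12] (s≤s (s≤s _)) = transpose zero (suc zero) , λ e → contradiction (e zero) λ ()

-- Partitions are compared up to reordering of the parts by _≈ᵖ_.
record Partition (n : ℕ) : Set where
  field
    parts    : List ℕ
    positive : All NonZero parts
    sum≡n    : sum parts ≡ n

open Partition public

infix 4 _≈ᵖ_
_≈ᵖ_ : ∀ {n} → Rel (Partition n) 0ℓ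
S ≈ᵖ T = parts S ↭ parts T

sum-replicate : ∀ k m → sum (replicate k m) ≡ k * m
sum-replicate zero    m = refl
sum-replicate (suc k) m = cong (_+_ m) (sum-replicate k m)

[1^_] : ∀ n → Partition n
[1^ n ] = record
  { parts    = replicate n 1
  ; positive = All.replicate⁺ n _
  ; sum≡n    = trans (sum-replicate n 1) (*-identityʳ n)
  }

gcd-nonZero : ∀ a m .{{_ : NonZero a}} → NonZero (gcd a m)
gcd-nonZero a m = ≢-nonZero (gcd[m,n]≢0 a m (inj₁ (≢-nonZero⁻¹ a)))

-- Each of the t copies of m in [mᵗ, …] contributes gcd a m copies of
-- m / gcd a m to the power with exponent a.
powerOfPart : (a : ℕ) .{{_ : NonZero a}} → ℕ → List ℕ
powerOfPart a m = replicate (gcd a m) ((m / gcd a m) {{gcd-nonZero a m}})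

_^ᵖ_ : ∀ {n} → Partition n → (a : ℕ) .{{_ : NonZero a}} → Partition n
_^ᵖ_ {n} T a = record
  { parts    = concatMap (powerOfPart a) (parts T)
  ; positive = All.concat⁺ (All.map⁺ (All.map powerPositive (positive T)))
  ; sum≡n    = trans (sum-power (parts T)) (sum≡n T)
  }
  where
  powerPositive : ∀ {m} → NonZero m → All NonZero (powerOfPart a m)
  powerPositive {m} m≢0 = All.replicate⁺ (gcd a m)
    (≢-nonZero (n/gcd[m,n]≢0 a m {{m≢0}} {{gcd-nonZero a m}}))

  sum-power : ∀ ms → sum (concatMap (powerOfPart a) ms) ≡ sum ms
  sum-power []       = refl
  sum-power (m ∷ ms) = trans
    (sum-++ (powerOfPart a m) (concatMap (powerOfPart a) ms))
    (cong₂ _+_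
      (trans (sum-replicate (gcd a m) _)
             (m*[n/m]≡n {{gcd-nonZero a m}} (gcd[m,n]∣n a m)))
      (sum-power ms))

IsPowerOfᵖ : ∀ {n} → Rel (Partition n) 0ℓ
IsPowerOfᵖ S T = ∃[ a ] Σ[ a≢0 ∈ NonZero a ] S ≈ᵖ (T ^ᵖ a) {{a≢0}}

concatMap-↭ : ∀ (f : ℕ → List ℕ) {xs ys} → xs ↭ ys → concatMap f xs ↭ concatMap f ys
concatMap-↭ f (↭.refl)               = ↭-refl
concatMap-↭ f (↭.prep x p)           = ++⁺ˡ (f x) (concatMap-↭ f p)
concatMap-↭ f (↭.swap {xs} {ys} x y p) =
  ↭-trans (++⁺ˡ (f x) (++⁺ˡ (f y) (concatMap-↭ f p)))
          (shifts (f x) (f y))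
concatMap-↭ f (↭.trans p q)          = ↭-trans (concatMap-↭ f p) (concatMap-↭ f q)

P₀𝒯 : ℕ → Graph
P₀𝒯 n = record
  { Vertex        = Σ[ T ∈ Partition n ] ¬ T ≈ᵖ [1^ n ]
  ; _≈_           = λ S T → proj₁ S ≈ᵖ proj₁ T
  ; isEquivalence = record { refl = ↭-refl ; sym = ↭-sym ; trans = ↭-trans }
  ; _~_           = λ S T → ¬ proj₁ S ≈ᵖ proj₁ T ×
                      (IsPowerOfᵖ (proj₁ S) (proj₁ T) ⊎
                       IsPowerOfᵖ (proj₁ T) (proj₁ S))
  ; ~-sym         = λ (S≉T , p) → S≉T ∘ ↭-sym , swap p
  ; ~-irrefl      = λ S≈T S~T → proj₁ S~T S≈T
  ; ~-resp-≈      =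
      (λ { {S} {T} {U} T≈U (S≉T , p) →
        (λ S≈U → S≉T (↭-trans S≈U (↭-sym T≈U))) ,
        ⊎-map (respʳ (proj₁ S) (proj₁ T) (proj₁ U) T≈U)
              (respˡ (proj₁ T) (proj₁ U) (proj₁ S) T≈U) p }) ,
      (λ { {S} {T} {U} T≈U (T≉S , p) →
        (λ U≈S → T≉S (↭-trans T≈U U≈S)) ,
        ⊎-map (respˡ (proj₁ T) (proj₁ U) (proj₁ S) T≈U)
              (respʳ (proj₁ S) (proj₁ T) (proj₁ U) T≈U) p })
  }
  where
  respˡ : (S T U : Partition n) → S ≈ᵖ T → IsPowerOfᵖ S U → IsPowerOfᵖ T U
  respˡ S T U S≈T (a , a≢0 , e) = a , a≢0 , ↭-trans (↭-sym S≈T) e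

  respʳ : (U S T : Partition n) → S ≈ᵖ T → IsPowerOfᵖ U S → IsPowerOfᵖ U T
  respʳ U S T S≈T (a , a≢0 , e) =
    a , a≢0 , ↭-trans e (concatMap-↭ (powerOfPart a {{a≢0}}) S≈T)

module _ {n : ℕ} (ψ : Permutation′ n) where

  SameOrbit : Rel (Fin n) 0ℓ
  SameOrbit i j = ∃[ k ] powℤ (Sym n) ψ k ⟨$⟩ʳ i ≡ j

  -- Every point has a period at most n, so natural exponents below n
  -- already sweep out the orbit.
  private
    infixl 5 _▹_
    _▹_ : Fin n → ℕ → Fin n
    i ▹ k = pow (Sym n) ψ k ⟨$⟩ʳ i

    ▹-+ : ∀ i a b → i ▹ (a + b) ≡ i ▹ a ▹ b
    ▹-+ i a b = MonoidMult.×-homo-+ (Group.monoid (Sym n)) ψ a b i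

    ▹-injective : ∀ k {i j} → i ▹ k ≡ j ▹ k → i ≡ j
    ▹-injective k {i} {j} e = begin
      i                                            ≡⟨ Perm.inverseˡ (pow (Sym n) ψ k) ⟨
      pow (Sym n) ψ k Perm.⟨$⟩ˡ (i ▹ k)            ≡⟨ cong (pow (Sym n) ψ k Perm.⟨$⟩ˡ_) e ⟩
      pow (Sym n) ψ k Perm.⟨$⟩ˡ (j ▹ k)            ≡⟨ Perm.inverseˡ (pow (Sym n) ψ k) ⟩
      j                                            ∎
      where open ≡-Reasoning

    period : ∀ i → ∃[ d ] suc d ≤ n × i ▹ suc d ≡ i
    period i with pigeonhole {n} {suc n} (s≤s ≤-refl) (λ a → i ▹ toℕ a)
    ... | a , b , a<b , e with toℕ b ∸ toℕ a in eq | m<n⇒0<n∸m a<b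
    ... | suc d | _ = d , d<n , ▹-injective (toℕ a) (begin
        i ▹ suc d ▹ toℕ a             ≡⟨ ▹-+ i (suc d) (toℕ a) ⟨
        i ▹ (suc d + toℕ a)           ≡⟨ cong (λ c → i ▹ (c + toℕ a)) eq ⟨
        i ▹ (toℕ b ∸ toℕ a + toℕ a)   ≡⟨ cong (i ▹_) (m∸n+n≡m (<⇒≤ a<b)) ⟩
        i ▹ toℕ b                     ≡⟨ e ⟨
        i ▹ toℕ a                     ∎)
      where
      open ≡-Reasoning
      d<n : suc d ≤ n
      d<n = subst (_≤ n) eq (≤-trans (m∸n≤m (toℕ b) (toℕ a)) (≤-pred (toℕ<n b)))

    ▹-period : ∀ i d c → i ▹ d ≡ i → i ▹ (c * d) ≡ i
    ▹-period i d zero    e = refl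
    ▹-period i d (suc c) e =
      trans (▹-+ i d (c * d)) (trans (cong (_▹ (c * d)) e) (▹-period i d c e))

    Forward : Rel (Fin n) 0ℓ
    Forward i j = ∃[ k ] i ▹ k ≡ j

    forward-sym : Symmetric Forward
    forward-sym {i} (k , refl) with period i
    ... | d , _ , e = k * d , (begin
        i ▹ k ▹ (k * d)    ≡⟨ ▹-+ i k (k * d) ⟨
        i ▹ (k + k * d)    ≡⟨ cong (i ▹_) (*-suc k d) ⟨
        i ▹ (k * suc d)    ≡⟨ ▹-period i (suc d) k e ⟩
        i                  ∎)
      where open ≡-Reasoning

    forward-bounded : ∀ {i j} → Forward i j → ∃[ k ] i ▹ toℕ {n} k ≡ j
    forward-bounded {i} (k , refl) with period i
    ... | d , d<n , e = fromℕ< k′<n , (begin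
        i ▹ toℕ (fromℕ< k′<n)                            ≡⟨ cong (i ▹_) (toℕ-fromℕ< k′<n) ⟩
        i ▹ (k % suc d)                                  ≡⟨ cong (_▹ (k % suc d)) (▹-period i (suc d) (k / suc d) e) ⟨
        i ▹ (k / suc d * suc d) ▹ (k % suc d)            ≡⟨ ▹-+ i (k / suc d * suc d) (k % suc d) ⟨
        i ▹ (k / suc d * suc d + k % suc d)              ≡⟨ cong (i ▹_) (+-comm _ (k % suc d)) ⟩
        i ▹ (k % suc d + k / suc d * suc d)              ≡⟨ cong (i ▹_) (m≡m%n+[m/n]*n k (suc d)) ⟨
        i ▹ k                                            ∎)
      where
      open ≡-Reasoning
      k′<n : k % suc d < n
      k′<n = <-≤-trans (m%n<n k (suc d)) d<n

    forward⇒sameOrbit : ∀ {i j} → Forward i j → SameOrbit i j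
    forward⇒sameOrbit (k , e) = + k , e

    sameOrbit⇒forward : ∀ {i j} → SameOrbit i j → Forward i j
    sameOrbit⇒forward (+ k , e)        = k , e
    sameOrbit⇒forward (-[1+ k ] , refl) =
      forward-sym (suc k , Perm.inverseʳ (pow (Sym n) ψ (suc k)))

  sameOrbit? : Decidable SameOrbit
  sameOrbit? i j = map′ (λ (k , e) → + toℕ k , e)
                        (forward-bounded ∘ sameOrbit⇒forward)
                        (any? λ k → (i ▹ toℕ {n} k) ≟ᶠ j)

  sameOrbit-isEquivalence : IsEquivalence SameOrbit
  sameOrbit-isEquivalence = record
    { refl  = + 0 , refl
    ; sym   = forward⇒sameOrbit ∘ forward-sym ∘ sameOrbit⇒forward
    ; trans = λ p q → forward⇒sameOrbit
                (forward-trans (sameOrbit⇒forward p) (sameOrbit⇒forward q))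
    }
    where
    forward-trans : ∀ {i j k} → Forward i j → Forward j k → Forward i k
    forward-trans {i} (a , refl) (b , refl) = a + b , ▹-+ i a b

module _ {A : Set} {R : Rel A 0ℓ} (isEq : IsEquivalence R) (R? : Decidable R) where

  open IsEquivalence isEq using () renaming (refl to R-refl; sym to R-sym; trans to R-trans)

  private
    hits : A → List A → ℕ
    hits y xs = length (filter (λ x → R? x y) xs)

    hits-filter-yes : ∀ {x y} → R x y → ∀ zs → hits y (filter (¬? ∘ R? x) zs) ≡ 0
    hits-filter-yes r [] = refl
    hits-filter-yes {x} {y} r (z ∷ zs) with R? x z
    ... | yes _  = hits-filter-yes r zs
    ... | no ¬xz with R? z y
    ...   | yes zy = contradiction (R-trans r (R-sym zy)) ¬xz
    ...   | no  _  = hits-filter-yes r zs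

    hits-filter-no : ∀ {x y} → ¬ R x y → ∀ zs → hits y (filter (¬? ∘ R? x) zs) ≡ hits y zs
    hits-filter-no ¬r [] = refl
    hits-filter-no {x} {y} ¬r (z ∷ zs) with R? x z
    hits-filter-no {x} {y} ¬r (z ∷ zs) | yes xz with R? z y
    ... | yes zy = contradiction (R-trans xz zy) ¬r
    ... | no  _  = hits-filter-no ¬r zs
    hits-filter-no {x} {y} ¬r (z ∷ zs) | no _ with R? z y
    ... | yes _  = cong suc (hits-filter-no ¬r zs)
    ... | no  _  = hits-filter-no ¬r zs

    hits-deduplicate : ∀ {y} xs → y ∈ xs → hits y (deduplicate R? xs) ≡ 1
    hits-deduplicate {y} (x ∷ xs) y∈ with R? x y
    ... | yes r = cong suc (hits-filter-yes r (deduplicate R? xs))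
    ... | no ¬r with y∈
    ...   | here refl = contradiction R-refl ¬r
    ...   | there y∈′ = trans (hits-filter-no ¬r (deduplicate R? xs))
                              (hits-deduplicate xs y∈′)

    classSizes : List A → List A → List ℕ
    classSizes ys = map (λ x → length (filter (R? x) ys))

    sum-classSizes-∷ : ∀ y ys xs → sum (classSizes (y ∷ ys) xs) ≡
                       hits y xs + sum (classSizes ys xs)
    sum-classSizes-∷ y ys [] = refl
    sum-classSizes-∷ y ys (x ∷ xs) with R? x y
    ... | yes _ = cong suc (trans
      (cong (_+_ c) (sum-classSizes-∷ y ys xs)) (x∙yz≈y∙xz c (hits y xs) _))
      where c = length (filter (R? x) ys)
    ... | no  _ = trans
      (cong (_+_ c) (sum-classSizes-∷ y ys xs)) (x∙yz≈y∙xz c (hits y xs) _)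
      where c = length (filter (R? x) ys)

    sum-classSizes-[] : ∀ xs → sum (classSizes [] xs) ≡ 0
    sum-classSizes-[] []       = refl
    sum-classSizes-[] (_ ∷ xs) = sum-classSizes-[] xs

  sum-classSizes : ∀ xs ys → All (_∈ xs) ys →
    sum (map (λ x → length (filter (R? x) ys)) (deduplicate R? xs)) ≡ length ys
  sum-classSizes xs []       []         = sum-classSizes-[] (deduplicate R? xs)
  sum-classSizes xs (y ∷ ys) (y∈ ∷ ys∈) = trans
    (sum-classSizes-∷ y ys (deduplicate R? xs))
    (cong₂ _+_ (hits-deduplicate xs y∈) (sum-classSizes xs ys ys∈))

  representative : ∀ {y} xs → y ∈ xs → ∃[ x ] x ∈ deduplicate R? xs × R x y
  representative (x ∷ xs) (here refl) = x , here refl , R-refl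
  representative (x ∷ xs) (there y∈) with representative xs y∈
  ... | z , z∈ , zy with R? x z
  ...   | yes xz = x , here refl , R-trans xz zy
  ...   | no ¬xz = z , there (∈-filter⁺ (¬? ∘ R? x) z∈ ¬xz) , zy

module _ {n : ℕ} (ψ : Permutation′ n) where

  orbit : Fin n → List (Fin n)
  orbit i = filter (sameOrbit? ψ i) (allFin n)

  orbitRepresentatives : List (Fin n)
  orbitRepresentatives = deduplicate (sameOrbit? ψ) (allFin n)

  type : Partition n
  type = record
    { parts    = map (length ∘ orbit) orbitRepresentatives
    ; positive = All.map⁺ (All.universal orbit-nonEmpty orbitRepresentatives)
    ; sum≡n    = trans
        (sum-classSizes (sameOrbit-isEquivalence ψ) (sameOrbit? ψ)
          (allFin n) (allFin n) (All.tabulate id))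
        (length-tabulate id)
    }
    where
    orbit-nonEmpty : ∀ i → NonZero (length (orbit i))
    orbit-nonEmpty i = >-nonZero (filter-some (sameOrbit? ψ i)
      (lose (∈-allFin i) (IsEquivalence.refl (sameOrbit-isEquivalence ψ))))

  type≈1ⁿ⇒≈id : type ≈ᵖ [1^ n ] → ψ Perm.≈ Perm.id
  type≈1ⁿ⇒≈id e i with representative (sameOrbit-isEquivalence ψ) (sameOrbit? ψ)
                         (allFin n) (∈-allFin i)
  ... | r , r∈ , ri = unique (orbit r) one
          (∈-filter⁺ (sameOrbit? ψ r) (∈-allFin _) (E.trans ri (+ 1 , refl)))
          (∈-filter⁺ (sameOrbit? ψ r) (∈-allFin i) ri)
    where
    module E = IsEquivalence (sameOrbit-isEquivalence ψ)

    one : length (orbit r) ≡ 1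
    one = All.lookup {P = _≡ 1} (All-resp-↭ (↭-sym e) (All.replicate⁺ n refl))
                     (∈-map⁺ (length ∘ orbit) r∈)

    unique : ∀ {x y : Fin n} xs → length xs ≡ 1 → x ∈ xs → y ∈ xs → x ≡ y
    unique (_ ∷ []) refl (here refl) (here refl) = refl

typeVertex : ∀ {n} → Vertex (P₀ (Sym n)) → Vertex (P₀𝒯 n)
typeVertex (ψ , ψ≉id) = type ψ , ψ≉id ∘ type≈1ⁿ⇒≈id ψ

-- For p > n the truncated n ∸ p is harmless: the right-hand side then
-- sums to p ≢ n, so no permutation qualifies.
IsCycle : ∀ {n} → ℕ → Pred (Permutation′ n) 0ℓ
IsCycle {n} p ψ = parts (type ψ) ↭ replicate (n ∸ p) 1 ++ p ∷ []

{-# OPTIONS --safe #-}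

-- A permutation ψ that is not a p-cycle is joined to a transposition as follows. Commuting
-- elements of odd order and of order 2 are both powers of their product; so an element of odd
-- order with two fixed points is joined to the transposition of these, and any two transpositions
-- are joined through a 3-cycle disjoint from both. An involution commutes with an element of
-- order 3 with two fixed points: a 3-cycle on its fixed points, or a product of two 3-cycles
-- that permutes three of its 2-cycles. If ψ has even order, it has an involution as a power. If
-- ψ has odd order and ℓ is the length of a nontrivial orbit, then either some nontrivial power of
-- ψ fixes two points, or all nontrivial orbits have length ℓ. In the latter case, if there are
-- two of them, ψ commutes with the involution interchanging them; if there is only one and at
-- most one fixed point, then ℓ is n or n - 1 and odd, so ℓ = p.
--
-- Conversely, a root of a p-cycle has an orbit of length p and at most one further point, so it
-- generates the same subgroup: p-cycles are isolated in the quotient power graph. Their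
-- components are the subgroups of order p, (p - 2)! of them on p points. Orbit sizes are
-- compatible with powers, which transports paths and isolation to types and orders.

module Submission where

open import Defs
open import Algebra.Bundles using (Group)
import Algebra.Properties.Monoid.Mult as MonoidMult
open import Data.Empty using (⊥; ⊥-elim)
open import Data.Fin using (Fin; zero; suc; toℕ; fromℕ; fromℕ<; inject₁; punchIn; punchOut; _↑ˡ_; _↑ʳ_; combine; remQuot)
open import Data.Fin.Permutation as Perm using (Permutation′; _⟨$⟩ʳ_; _⟨$⟩ˡ_; _∘ₚ_; flip; transpose; permutation; insert; remove; lift₀)
open import Data.Fin.Properties using (toℕ-inject₁; toℕ-fromℕ; suc-injective; ↑ˡ-injective; ↑ʳ-injective; punchIn-injective; punchIn-punchOut; remQuot-combine; combine-remQuot; any?; all?; pigeonhole; injective⇒≤; toℕ<n; toℕ-fromℕ<; toℕ-injective; +↔⊎; splitAt-↑ˡ; splitAt-↑ʳ) renaming (_≟_ to _≟ᶠ_)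
open import Data.Integer using (+_; -[1+_])
open import Data.List using (List; []; _∷_; _++_; length; map; filter; replicate; concatMap; deduplicate; allFin; tabulate; lookup)
open import Data.List.Membership.Propositional using (_∈_; _∉_)
open import Data.List.Membership.DecPropositional using (_∈?_)
open import Data.List.Membership.Propositional.Properties using (∈-allFin; ∈-filter⁺; ∈-filter⁻; ∈-map⁺; ∈-map⁻; ∈-++⁺ˡ; ∈-++⁺ʳ; ∈-++⁻; ∈-∃++; ∈-lookup)
open import Data.List.Membership.Propositional.Properties.WithK using (unique∧set⇒bag)
open import Data.List.Properties using (tabulate-cong; concatMap-cong; concatMap-map; map-concatMap; concatMap-++; map-replicate; filter-reject; length-tabulate; length-map; map-cong; map-∘; map-++; map-tabulate)
open import Data.List.Relation.Binary.BagAndSetEquality using (∼bag⇒↭)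
open import Data.List.Relation.Binary.Permutation.Propositional as ↭ using (_↭_; ↭-refl; ↭-sym; ↭-trans)
open import Data.List.Relation.Binary.Permutation.Propositional.Properties using (All-resp-↭; ∈-resp-↭; ↭-length; ++⁺ˡ; shift; drop-∷; map⁺; ∷↭∷ʳ; ¬x∷xs↭[])
open import Data.List.Relation.Unary.All as All using (All; []; _∷_)
import Data.List.Relation.Unary.All.Properties as All
open import Data.List.Relation.Unary.AllPairs using ([]; _∷_)
open import Data.List.Relation.Unary.Any using (here; there; index)
open import Data.List.Relation.Unary.Any.Properties using (lookup-index)
open import Data.List.Relation.Unary.Unique.Propositional using (Unique)
import Data.List.Relation.Unary.Unique.Propositional.Properties as Unique
import Data.Fin.Relation.Unary.Top as Top
open import Data.Sum.Function.Propositional using (_⊎-↔_)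
open import Function.Construct.Composition using (_↔-∘_)
open import Function.Construct.Symmetry using (↔-sym)
open import Data.Nat using (ℕ; zero; suc; pred; _+_; _*_; _∸_; _/_; _%_; _≤_; _<_; z≤n; s≤s; NonZero; ≢-nonZero; ≢-nonZero⁻¹; >-nonZero⁻¹; _!; _≤?_) renaming (_≟_ to _≟ⁿ_)
open import Data.Nat.Coprimality using (coprime-/gcd; coprime-divisor; coprime-Bézout) renaming (sym to coprime-sym)
open import Data.Nat.DivMod using (m≡m%n+[m/n]*n; m%n<n; m*[n/m]≡n; m/n*n≡m)
open import Data.Nat.Divisibility using (1∣_; ∣m+n∣m⇒∣n; _∣_; divides; ∣-refl; ∣-trans; ∣-antisym; ∣⇒≤; n∣m*n; m∣m*n; m%n≡0⇒n∣m; m≤n⇒m!∣n!; ∣1⇒≡1; *-cancelʳ-∣)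
open import Data.Nat.GCD using (module Bézout; gcd; gcd[m,n]∣m; gcd[m,n]∣n; n/gcd[m,n]≢0)
open import Data.Nat.ListAction using (sum)
open import Data.Nat.ListAction.Properties using (sum-↭)
open import Data.Nat.Primality using (Prime; prime⇒nonZero; prime⇒irreducible)
open import Data.Nat.Properties hiding (suc-injective)
open import Data.Product using (Σ-syntax; ∃-syntax; _×_; _,_; proj₁; proj₂)
open import Data.Sum using (_⊎_; inj₁; inj₂; [_,_]′) renaming (swap to ⊎-swap)
open import Function using (_∘_; id; mk⇔)
open import Level using (0ℓ)
open import Relation.Binary using (Rel; IsEquivalence; Decidable; Symmetric)
open import Relation.Binary.Construct.Closure.ReflexiveTransitive using (Star; _◅_; _◅◅_) renaming (ε to nil)
import Relation.Binary.Construct.Closure.ReflexiveTransitive as Star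
open import Relation.Binary.PropositionalEquality using (_≡_; _≢_; refl; sym; trans; cong; cong₂; subst; module ≡-Reasoning)
open import Relation.Nullary using (¬_; Dec; yes; no; contradiction)
open import Relation.Nullary.Decidable using (map′; ¬?; _×-dec_; decidable-stable)
open import Relation.Unary using (Pred; _≐_; _⊆_)
open Graph using (Vertex; Connected; Isolated; IsComplete; HasSize; IsComponent)

-- All four graphs are split by one decidable test, whether ψᵖ is the identity. Passing this test
-- for ψ ≠ 1 is a statement about exponents, and the exponents that kill a permutation depend only
-- on its type. This is what carries isolation over to partitions, although a power relation between
-- two types relates the permutations chosen to represent them only up to type.
--
-- The bound n ≥ 8 comes from the involutions with at most two fixed points. The product of two
-- 3-cycles that commutes with such an involution occupies six points, and two more are needed as
-- its fixed points before it can be joined to a transposition. Accordingly p is at least 7.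
--
-- Since `n !` is an exponent of the whole group, negative, zero and positive powers give the same
-- relation `_≼_`, and this relation is decidable. Adjacency and equality of vertices in the
-- quotient graph are expressed through it.

private
  variable
    n : ℕ

-- Powers and cyclic subgroups

infixl 8 _^_
_^_ : Permutation′ n → ℕ → Permutation′ n
_^_ {n} = pow (Sym n)

^-+ : ∀ (ψ : Permutation′ n) a b i → ψ ^ (a + b) ⟨$⟩ʳ i ≡ ψ ^ b ⟨$⟩ʳ (ψ ^ a ⟨$⟩ʳ i)
^-+ {n} = MonoidMult.×-homo-+ (Group.monoid (Sym n))

^-* : ∀ (ψ : Permutation′ n) a b → ψ ^ a ^ b Perm.≈ ψ ^ (b * a)
^-* {n} ψ a b = MonoidMult.×-assocˡ (Group.monoid (Sym n)) ψ b a

^-cong : ∀ (σ τ : Permutation′ n) k → σ Perm.≈ τ → σ ^ k Perm.≈ τ ^ k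
^-cong {n} σ τ k = MonoidMult.×-congʳ (Group.monoid (Sym n)) k {σ} {τ}

⟨$⟩ʳ-injective : ∀ (ψ : Permutation′ n) {i j} → ψ ⟨$⟩ʳ i ≡ ψ ⟨$⟩ʳ j → i ≡ j
⟨$⟩ʳ-injective ψ e = trans (sym (Perm.inverseˡ ψ)) (trans (cong (ψ ⟨$⟩ˡ_) e) (Perm.inverseˡ ψ))

fixed-^ : ∀ (ψ : Permutation′ n) k {i} → ψ ⟨$⟩ʳ i ≡ i → ψ ^ k ⟨$⟩ʳ i ≡ i
fixed-^ ψ zero    e = refl
fixed-^ ψ (suc k) e = trans (cong (ψ ^ k ⟨$⟩ʳ_) e) (fixed-^ ψ k e)

Commute : Rel (Permutation′ n) 0ℓ
Commute σ τ = ∀ i → σ ⟨$⟩ʳ (τ ⟨$⟩ʳ i) ≡ τ ⟨$⟩ʳ (σ ⟨$⟩ʳ i)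

commute-^ : ∀ (σ τ : Permutation′ n) → Commute σ τ → ∀ k → Commute (σ ^ k) τ
commute-^ σ τ c zero    i = refl
commute-^ σ τ c (suc k) i = trans (cong (σ ^ k ⟨$⟩ʳ_) (c i)) (commute-^ σ τ c k (σ ⟨$⟩ʳ i))

∘ₚ-^ : ∀ (σ τ : Permutation′ n) → Commute σ τ → ∀ k i →
       (σ ∘ₚ τ) ^ k ⟨$⟩ʳ i ≡ τ ^ k ⟨$⟩ʳ (σ ^ k ⟨$⟩ʳ i)
∘ₚ-^ σ τ c zero    i = refl
∘ₚ-^ σ τ c (suc k) i = trans (∘ₚ-^ σ τ c k (τ ⟨$⟩ʳ (σ ⟨$⟩ʳ i)))
  (cong (τ ^ k ⟨$⟩ʳ_) (commute-^ σ τ c k (σ ⟨$⟩ʳ i)))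

commute-self : ∀ (ψ : Permutation′ n) k → Commute (ψ ^ k) ψ
commute-self ψ = commute-^ ψ ψ (λ _ → refl)

-- Stated at a single point, so that it serves for periods of points and, applied at every point,
-- for exponents of permutations.
^-∣-id : ∀ (ψ : Permutation′ n) {m k} {i} → ψ ^ m ⟨$⟩ʳ i ≡ i → m ∣ k → ψ ^ k ⟨$⟩ʳ i ≡ i
^-∣-id ψ {m} {i = i} e (divides q refl) = trans (sym (^-* ψ m q i)) (fixed-^ (ψ ^ m) q e)

least : ∀ {P : Pred ℕ 0ℓ} → (∀ k → Dec (P k)) → ∀ {m} → P m →
        ∃[ d ] P d × d ≤ m × (∀ {k} → P k → d ≤ k)
least P? {zero}  p = 0 , p , z≤n , λ _ → z≤n
least {P} P? {suc m} p with P? 0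
... | yes p₀ = 0 , p₀ , z≤n , λ _ → z≤n
... | no ¬p₀ with least (P? ∘ suc) {m} p
...   | d , q , d≤m , min = suc d , q , s≤s d≤m , min′
  where
  min′ : ∀ {k} → P k → suc d ≤ k
  min′ {zero}  p₀ = contradiction p₀ ¬p₀
  min′ {suc k} pₖ = s≤s (min pₖ)

%-fixed : ∀ (ψ : Permutation′ n) d .{{_ : NonZero d}} k {i} → ψ ^ d ⟨$⟩ʳ i ≡ i →
          ψ ^ k ⟨$⟩ʳ i ≡ ψ ^ (k % d) ⟨$⟩ʳ i
%-fixed ψ d k {i} e = begin
  ψ ^ k ⟨$⟩ʳ i                                    ≡⟨ cong (λ c → ψ ^ c ⟨$⟩ʳ i) (trans (m≡m%n+[m/n]*n k d) (+-comm (k % d) _)) ⟩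
  ψ ^ (k / d * d + k % d) ⟨$⟩ʳ i                  ≡⟨ ^-+ ψ (k / d * d) (k % d) i ⟩
  ψ ^ (k % d) ⟨$⟩ʳ (ψ ^ (k / d * d) ⟨$⟩ʳ i)       ≡⟨ cong (ψ ^ (k % d) ⟨$⟩ʳ_) (^-∣-id ψ {d} e (n∣m*n (k / d))) ⟩
  ψ ^ (k % d) ⟨$⟩ʳ i                              ∎
  where open ≡-Reasoning

-- Minimality is given by divisibility, the form in which orbit lengths are compared with exponents
-- later on; it determines `d`.
record Period (ψ : Permutation′ n) (i : Fin n) (d : ℕ) : Set where
  field
    {{period≢0}} : NonZero d
    returns      : ψ ^ d ⟨$⟩ʳ i ≡ i
    minimal      : ∀ {k} → ψ ^ k ⟨$⟩ʳ i ≡ i → d ∣ k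

-- The remainder of a returning exponent modulo `suc d` also returns; being smaller than the least
-- positive return, it is 0.
leastReturn⇒period : ∀ {ψ : Permutation′ n} {i d} → ψ ^ suc d ⟨$⟩ʳ i ≡ i →
  (∀ {k} → ψ ^ suc k ⟨$⟩ʳ i ≡ i → d ≤ k) → Period ψ i (suc d)
leastReturn⇒period {ψ = ψ} {i} {d} e min = record
  { returns = e
  ; minimal = λ {k} eₖ → m%n≡0⇒n∣m k (suc d) (zero-% k (k % suc d) refl (trans (sym (%-fixed ψ (suc d) k e)) eₖ))
  }
  where
  zero-% : ∀ k r → k % suc d ≡ r → ψ ^ r ⟨$⟩ʳ i ≡ i → r ≡ 0
  zero-% k zero    eq _ = refl
  zero-% k (suc r) eq f = contradiction (≤-trans (s≤s (s≤s (min f))) (≤-reflexive (cong suc (sym eq)))) (<⇒≱ (s≤s (m%n<n k (suc d))))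

returns-cancel : ∀ (ψ : Permutation′ n) a b {i} → a ≤ b → ψ ^ a ⟨$⟩ʳ i ≡ ψ ^ b ⟨$⟩ʳ i → ψ ^ (b ∸ a) ⟨$⟩ʳ i ≡ i
returns-cancel ψ a b {i} a≤b e = ⟨$⟩ʳ-injective (ψ ^ a) (begin
  ψ ^ a ⟨$⟩ʳ (ψ ^ (b ∸ a) ⟨$⟩ʳ i)  ≡⟨ ^-+ ψ (b ∸ a) a i ⟨
  ψ ^ (b ∸ a + a) ⟨$⟩ʳ i           ≡⟨ cong (λ c → ψ ^ c ⟨$⟩ʳ i) (m∸n+n≡m a≤b) ⟩
  ψ ^ b ⟨$⟩ʳ i                     ≡⟨ e ⟨
  ψ ^ a ⟨$⟩ʳ i                     ∎)
  where open ≡-Reasoning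

returns-within : ∀ (ψ : Permutation′ n) i → ∃[ d ] suc d ≤ n × ψ ^ suc d ⟨$⟩ʳ i ≡ i
returns-within {n} ψ i with pigeonhole {n} {suc n} (s≤s ≤-refl) (λ a → ψ ^ toℕ a ⟨$⟩ʳ i)
... | a , b , a<b , e with toℕ b ∸ toℕ a in eq | m<n⇒0<n∸m a<b | returns-cancel ψ (toℕ a) (toℕ b) (<⇒≤ a<b) e
... | suc d | _ | e′ = d , subst (_≤ n) eq (≤-trans (m∸n≤m (toℕ b) (toℕ a)) (≤-pred (toℕ<n b))) , e′

periodOf : ∀ (ψ : Permutation′ n) i → ∃[ d ] d ≤ n × Period ψ i d
periodOf ψ i with returns-within ψ i
... | m , m<n , e with least (λ k → (ψ ^ suc k ⟨$⟩ʳ i) ≟ᶠ i) {m} e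
...   | d , eₔ , d≤m , min = suc d , ≤-trans (s≤s d≤m) m<n , leastReturn⇒period eₔ min

d∣d! : ∀ d .{{_ : NonZero d}} → d ∣ d !
d∣d! (suc d) = m∣m*n (d !)

-- Every orbit length is at most `n` and hence divides `n !`. This common exponent turns inverses
-- into powers and bounds the search in `_≼?_`.
^-factorial : ∀ (ψ : Permutation′ n) → ψ ^ (n !) Perm.≈ Perm.id
^-factorial ψ i with periodOf ψ i
... | d , d≤n , p = ^-∣-id ψ {d} (Period.returns p) (∣-trans (d∣d! d) (m≤n⇒m!∣n! d≤n))

-- The exponent 0 is allowed, since `n !` can be added to any exponent. Being a record, the type
-- lets `σ` and `τ` be inferred from a proof, which the unfolded pointwise equality would not.
infix 4 _≼_
record _≼_ (σ τ : Permutation′ n) : Set where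
  constructor _,_
  field
    exponent : ℕ
    isPower  : σ Perm.≈ τ ^ exponent

≼⇒positivePower : ∀ {σ τ : Permutation′ n} → σ ≼ τ → IsPositivePowerOf (Sym n) σ τ
≼⇒positivePower {n} {τ = τ} (k , e) = k + n ! ,
  ≢-nonZero (λ k+n!≡0 → ≢-nonZero⁻¹ (n !) {{n !≢0}} (m+n≡0⇒n≡0 k k+n!≡0)) ,
  λ i → trans (e i) (sym (trans (^-+ τ k (n !) i) (^-factorial τ _)))

positivePower⇒≼ : ∀ {σ τ : Permutation′ n} → IsPositivePowerOf (Sym n) σ τ → σ ≼ τ
positivePower⇒≼ (k , _ , e) = k , e

≼-refl : ∀ {σ : Permutation′ n} → σ ≼ σ
≼-refl = 1 , λ _ → refl

≼-trans : ∀ {ρ σ τ : Permutation′ n} → ρ ≼ σ → σ ≼ τ → ρ ≼ τ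
≼-trans {σ = σ} {τ} (a , e) (b , f) =
  a * b , λ i → trans (e i) (trans (^-cong σ (τ ^ b) a f i) (^-* τ b a i))

power≼ : ∀ (ψ : Permutation′ n) k → ψ ^ k ≼ ψ
power≼ ψ k = k , λ _ → refl

powℤ≼ : ∀ (ψ : Permutation′ n) k → powℤ (Sym n) ψ k ≼ ψ
powℤ≼ ψ (+ k)      = power≼ ψ k
-- Modulo `n !` the exponent `suc k * (n ! - 1)` is the negative of `suc k`.
powℤ≼ {n} ψ -[1+ k ] = suc k * e , λ i → ⟨$⟩ʳ-injective (ψ ^ suc k) (trans (Perm.inverseʳ (ψ ^ suc k)) (sym (begin
  ψ ^ suc k ⟨$⟩ʳ (ψ ^ (suc k * e) ⟨$⟩ʳ i) ≡⟨ ^-+ ψ (suc k * e) (suc k) i ⟨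
  ψ ^ (suc k * e + suc k) ⟨$⟩ʳ i          ≡⟨ cong (λ c → ψ ^ c ⟨$⟩ʳ i) exponent-eq ⟩
  ψ ^ (suc k * n !) ⟨$⟩ʳ i                ≡⟨ ^-∣-id ψ {n !} (^-factorial ψ i) (n∣m*n (suc k)) ⟩
  i                                       ∎)))
  where
  open ≡-Reasoning
  e = pred (n !)
  exponent-eq : suc k * e + suc k ≡ suc k * n !
  exponent-eq = trans (+-comm _ (suc k)) (trans (sym (*-suc (suc k) e)) (cong (suc k *_) (suc-pred (n !) {{n !≢0}})))

∈⟨⟩⇒≼ : ∀ {σ τ : Permutation′ n} → ⟨_⟩ (Sym n) τ σ → σ ≼ τ
∈⟨⟩⇒≼ {n} {σ} {τ} (k , e) = ≼-trans {σ = powℤ (Sym n) τ k} (1 , e) (powℤ≼ τ k)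

≼⇒∈⟨⟩ : ∀ {σ τ : Permutation′ n} → σ ≼ τ → ⟨_⟩ (Sym n) τ σ
≼⇒∈⟨⟩ (k , e) = + k , e

infix 4 _∼_
_∼_ : Rel (Permutation′ n) 0ℓ
_∼_ {n} σ τ = ⟨_⟩ (Sym n) σ ≐ ⟨_⟩ (Sym n) τ

∼⇒≼ : ∀ (σ τ : Permutation′ n) → σ ∼ τ → σ ≼ τ
∼⇒≼ σ τ (s , _) = ∈⟨⟩⇒≼ (s {σ} (≼⇒∈⟨⟩ ≼-refl))

∼-sym : ∀ (σ τ : Permutation′ n) → σ ∼ τ → τ ∼ σ
∼-sym σ τ (p , q) = (λ {ρ} → q {ρ}) , (λ {ρ} → p {ρ})

∼-trans : ∀ (ρ σ τ : Permutation′ n) → ρ ∼ σ → σ ∼ τ → ρ ∼ τ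
∼-trans ρ σ τ (p , q) (r , s) = (λ {υ} → r {υ} ∘ p {υ}) , (λ {υ} → q {υ} ∘ s {υ})

≼⇒⊆ : ∀ {σ τ : Permutation′ n} → σ ≼ τ → ⟨_⟩ (Sym n) σ ⊆ ⟨_⟩ (Sym n) τ
≼⇒⊆ σ≼τ {ρ} ρ∈ = ≼⇒∈⟨⟩ (≼-trans (∈⟨⟩⇒≼ {σ = ρ} ρ∈) σ≼τ)

≼∧≽⇒∼ : ∀ {σ τ : Permutation′ n} → σ ≼ τ → τ ≼ σ → σ ∼ τ
≼∧≽⇒∼ p q = (λ {ρ} → ≼⇒⊆ p {ρ}) , (λ {ρ} → ≼⇒⊆ q {ρ})

_≈?_ : Decidable (Perm._≈_ {n} {n})
σ ≈? τ = all? λ i → (σ ⟨$⟩ʳ i) ≟ᶠ (τ ⟨$⟩ʳ i)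

_≼?_ : Decidable (_≼_ {n})
_≼?_ {n} σ τ = map′
  (λ (k , e) → toℕ k , e)
  (λ (k , e) → fromℕ< (m%n<n k (n !)) , λ i → trans (e i)
    (trans (%-fixed τ (n !) k (^-factorial τ i)) (cong (λ c → τ ^ c ⟨$⟩ʳ i) (sym (toℕ-fromℕ< (m%n<n k (n !)))))))
  (any? λ (k : Fin (n !)) → σ ≈? (τ ^ toℕ k))
  where instance _ = n !≢0

-- Only the specification `IsOrder` is used, so the search up to `n !` is kept from unfolding during
-- type checking.
abstract
  order : ∀ (ψ : Permutation′ n) → ∃[ m ] IsOrder (Sym n) ψ m
  order {n} ψ with n ! in eq | n !≢0 | ^-factorial ψ
  ... | suc m | _ | e with least (λ k → (ψ ^ suc k) ≈? Perm.id) {m} e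
  ...   | d , eₔ , _ , min = suc d , _ , eₔ , λ { (suc k) _ eₖ → s≤s (min eₖ) }

order-minimal : ∀ (ψ : Permutation′ n) {m k} → IsOrder (Sym n) ψ m → ψ ^ k Perm.≈ Perm.id → m ∣ k
order-minimal ψ {m} {k} (m≢0 , e , min) eₖ = m%n≡0⇒n∣m k m (zero-% (k % m) refl)
  where
  instance _ = m≢0
  zero-% : ∀ r → k % m ≡ r → k % m ≡ 0
  zero-% zero    eq = eq
  zero-% (suc r) eq = contradiction
    (min (k % m) (subst NonZero (sym eq) _) λ i → trans (sym (%-fixed ψ m k (e i))) (eₖ i))
    (<⇒≱ (m%n<n k m))

-- Paths to a transposition

connected-sym : ∀ (Γ : Graph) → Symmetric (Connected Γ)
connected-sym Γ = Star.reverse λ { (inj₁ e) → inj₁ (IsEquivalence.sym isEquivalence e) ; (inj₂ a) → inj₂ (~-sym a) }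
  where open Graph Γ

-- Inductions on a path are instances with a suitable `P`: equality with an isolated vertex,
-- connectedness of the images under a map of graphs, membership in the main component.
connected-closed : ∀ (Γ : Graph) {P : Pred (Vertex Γ) 0ℓ} → (∀ {u v} → Graph._≈_ Γ u v → P u → P v) →
  (∀ {u v} → Graph._~_ Γ u v → P u → P v) → ∀ {u v} → Connected Γ u v → P u → P v
connected-closed Γ resp step nil            Pu = Pu
connected-closed Γ resp step (inj₁ e ◅ w⇝v) Pu = connected-closed Γ resp step w⇝v (resp e Pu)
connected-closed Γ resp step (inj₂ a ◅ w⇝v) Pu = connected-closed Γ resp step w⇝v (step a Pu)

isolated-connected : ∀ (Γ : Graph) {u v} → Isolated Γ u → Connected Γ u v → Graph._≈_ Γ u v
isolated-connected Γ isolated u⇝v = connected-closed Γ (λ v≈w u≈v → E.trans u≈v v≈w)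
  (λ {v} {w} v~w u≈v → contradiction (proj₂ ~-resp-≈ (E.sym u≈v) v~w) (isolated w)) u⇝v E.refl
  where
  open Graph Γ
  module E = IsEquivalence isEquivalence

isolated-isComponent : ∀ (Γ : Graph) {u} → Isolated Γ u → IsComponent Γ (Graph._≈_ Γ u)
isolated-isComponent Γ {u} isolated = u , (λ e → inj₁ e ◅ nil) , isolated-connected Γ isolated

infix 4 _⇝_
_⇝_ : Rel (Vertex (P₀ (Sym n))) 0ℓ
_⇝_ {n} = Connected (P̃₀ (Sym n))

-- Comparable permutations may represent the same vertex or adjacent ones; deciding the converse
-- power relation tells which kind of step to take.
≼⇒⇝ : ∀ {u v : Vertex (P₀ (Sym n))} → proj₁ u ≼ proj₁ v → u ⇝ v
≼⇒⇝ {u = σ , _} {τ , _} σ≼τ with τ ≼? σ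
... | yes τ≼σ = inj₁ (≼∧≽⇒∼ σ≼τ τ≼σ) ◅ nil
... | no  τ⋠σ = inj₂ ((λ σ∼τ → τ⋠σ (∈⟨⟩⇒≼ (proj₂ σ∼τ {τ} (≼⇒∈⟨⟩ ≼-refl)))) ,
                      σ , τ , (id , id) , (id , id) , inj₁ (≼⇒positivePower σ≼τ)) ◅ nil

-- A representative of a vertex and the given generator are powers of each other, so comparability
-- does not depend on the representatives.
~⇒comparable : ∀ {u v : Vertex (P₀ (Sym n))} → Graph._~_ (P̃₀ (Sym n)) u v → proj₁ u ≼ proj₁ v ⊎ proj₁ v ≼ proj₁ u
~⇒comparable {u = u , _} {v , _} (_ , x , y , x∼u , y∼v , inj₁ x≼y) =
  inj₁ (≼-trans (∼⇒≼ u x (∼-sym x u x∼u)) (≼-trans (positivePower⇒≼ x≼y) (∼⇒≼ y v y∼v)))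
~⇒comparable {u = u , _} {v , _} (_ , x , y , x∼u , y∼v , inj₂ y≼x) =
  inj₂ (≼-trans (∼⇒≼ v y (∼-sym y v y∼v)) (≼-trans (positivePower⇒≼ y≼x) (∼⇒≼ x u x∼u)))

⇝-sym : ∀ {u v : Vertex (P₀ (Sym n))} → u ⇝ v → v ⇝ u
⇝-sym {n} = connected-sym (P̃₀ (Sym n))

OddPower : Permutation′ n → Set
OddPower ψ = ∃[ h ] ψ ^ suc (h * 2) Perm.≈ Perm.id

-- With a an odd exponent of σ, both are powers of στ: (στ)ᵃ⁺¹ = σ and (στ)ᵃ = τ.
odd-∙-involution⇒⇝ : ∀ (u v : Vertex (P₀ (Sym n))) → Commute (proj₁ u) (proj₁ v) →
                     OddPower (proj₁ u) → proj₁ v ^ 2 Perm.≈ Perm.id → u ⇝ v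
odd-∙-involution⇒⇝ (σ , σ≉id) (τ , τ≉id) c (h , σ^odd) τ² =
  ≼⇒⇝ {v = στ} (suc (suc (h * 2)) , λ i → sym (begin
    (σ ∘ₚ τ) ^ suc (suc (h * 2)) ⟨$⟩ʳ i                ≡⟨ ∘ₚ-^ σ τ c (suc (suc (h * 2))) i ⟩
    τ ^ suc (suc (h * 2)) ⟨$⟩ʳ (σ ^ suc (suc (h * 2)) ⟨$⟩ʳ i) ≡⟨ ^-∣-id τ {2} (τ² _) (divides (suc h) refl) ⟩
    σ ^ suc (h * 2) ⟨$⟩ʳ (σ ⟨$⟩ʳ i)                    ≡⟨ σ^odd _ ⟩
    σ ⟨$⟩ʳ i                                           ∎))
  ◅◅ ⇝-sym (≼⇒⇝ {v = στ} τ≼στ)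
  where
  open ≡-Reasoning
  τ≼στ : τ ≼ σ ∘ₚ τ
  τ≼στ = suc (h * 2) , λ i → sym (begin
    (σ ∘ₚ τ) ^ suc (h * 2) ⟨$⟩ʳ i                 ≡⟨ ∘ₚ-^ σ τ c (suc (h * 2)) i ⟩
    τ ^ suc (h * 2) ⟨$⟩ʳ (σ ^ suc (h * 2) ⟨$⟩ʳ i)  ≡⟨ cong (τ ^ suc (h * 2) ⟨$⟩ʳ_) (σ^odd i) ⟩
    τ ^ (h * 2) ⟨$⟩ʳ (τ ⟨$⟩ʳ i)                   ≡⟨ ^-∣-id τ {2} (τ² _) (divides h refl) ⟩
    τ ⟨$⟩ʳ i                                      ∎)
  στ : Vertex (P₀ (Sym _))
  στ = σ ∘ₚ τ , λ e → τ≉id λ i → trans (_≼_.isPower τ≼στ i) (trans (^-cong (σ ∘ₚ τ) Perm.id (suc (h * 2)) e i) (fixed-^ Perm.id (suc (h * 2)) refl))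

-- The list may have repetitions, so points can be avoided without knowing that they are distinct.
fresh : ∀ (L : List (Fin n)) → length L < n → ∃[ u ] u ∉ L
fresh {n} L L<n with any? (λ u → ¬? (_∈?_ _≟ᶠ_ u L))
... | yes u∉ = u∉
... | no ¬u∉ = contradiction (injective⇒≤ {f = λ u → index (all∈ u)} λ {u} {v} e →
          trans (lookup-index (all∈ u)) (trans (cong (lookup L) e) (sym (lookup-index (all∈ v))))) (<⇒≱ L<n)
  where
  all∈ : ∀ u → u ∈ L
  all∈ u = decidable-stable (_∈?_ _≟ᶠ_ u L) (λ u∉ → ¬u∉ (u , u∉))

SupportedOn : Permutation′ n → List (Fin n) → Set
SupportedOn σ L = ∀ {u} → u ∉ L → σ ⟨$⟩ʳ u ≡ u

-- A permutation maps its support to itself, so it suffices that each point is fixed by σ or τ.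
disjoint⇒commute : ∀ (σ τ : Permutation′ n) → (∀ u → σ ⟨$⟩ʳ u ≡ u ⊎ τ ⟨$⟩ʳ u ≡ u) → Commute σ τ
disjoint⇒commute σ τ d u with d u | d (τ ⟨$⟩ʳ u) | d (σ ⟨$⟩ʳ u)
... | inj₁ e | inj₁ f | _ = trans f (cong (τ ⟨$⟩ʳ_) (sym e))
... | inj₁ e | inj₂ f | _ = trans (cong (σ ⟨$⟩ʳ_) τu≡u) (trans e (trans (sym τu≡u) (cong (τ ⟨$⟩ʳ_) (sym e))))
  where τu≡u = ⟨$⟩ʳ-injective τ f
... | inj₂ e | _ | inj₂ f = trans (cong (σ ⟨$⟩ʳ_) e) (sym f)
... | inj₂ e | _ | inj₁ f = trans (cong (σ ⟨$⟩ʳ_) e) (trans σu≡u (trans (sym e) (cong (τ ⟨$⟩ʳ_) (sym σu≡u))))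
  where σu≡u = ⟨$⟩ʳ-injective σ f

supported⇒commute : ∀ (σ τ : Permutation′ n) L → SupportedOn σ L → All (λ u → τ ⟨$⟩ʳ u ≡ u) L → Commute σ τ
supported⇒commute σ τ L supp fix = disjoint⇒commute σ τ λ u → helper u (_∈?_ _≟ᶠ_ u L)
  where
  helper : ∀ u → Dec (u ∈ L) → σ ⟨$⟩ʳ u ≡ u ⊎ τ ⟨$⟩ʳ u ≡ u
  helper u (yes u∈) = inj₂ (All.lookup fix u∈)
  helper u (no u∉)  = inj₁ (supp u∉)

-- Transpositions and 3-cycles

module _ (a b : Fin n) where

  transpose-ˡ : transpose a b ⟨$⟩ʳ a ≡ b
  transpose-ˡ with a ≟ᶠ a
  ... | yes _ = refl
  ... | no ¬e = contradiction refl ¬e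

  transpose-ʳ : transpose a b ⟨$⟩ʳ b ≡ a
  transpose-ʳ with b ≟ᶠ a
  ... | yes e = e
  ... | no _ with b ≟ᶠ b
  ...   | yes _ = refl
  ...   | no ¬e = contradiction refl ¬e

  transpose-other : ∀ {u} → u ≢ a → u ≢ b → transpose a b ⟨$⟩ʳ u ≡ u
  transpose-other {u} u≢a u≢b with u ≟ᶠ a
  ... | yes e = contradiction e u≢a
  ... | no _ with u ≟ᶠ b
  ...   | yes e = contradiction e u≢b
  ...   | no _ = refl

  transpose-supported : SupportedOn (transpose a b) (a ∷ b ∷ [])
  transpose-supported u∉ = transpose-other (u∉ ∘ here) (u∉ ∘ there ∘ here)

  transpose-involutive : transpose a b ^ 2 Perm.≈ Perm.id
  transpose-involutive u with u ≟ᶠ a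
  ... | yes refl = transpose-ʳ
  ... | no u≢a with u ≟ᶠ b
  ...   | yes refl = transpose-ˡ
  ...   | no u≢b = transpose-other u≢a u≢b

transposition : ∀ {a b : Fin n} → a ≢ b → Vertex (P₀ (Sym n))
transposition {a = a} {b} a≢b = transpose a b , λ e → a≢b (trans (sym (e a)) (transpose-ˡ a b))

transpose-conjugate : ∀ (σ : Permutation′ n) a b u →
  σ ⟨$⟩ʳ (transpose a b ⟨$⟩ʳ u) ≡ transpose (σ ⟨$⟩ʳ a) (σ ⟨$⟩ʳ b) ⟨$⟩ʳ (σ ⟨$⟩ʳ u)
transpose-conjugate σ a b u with u ≟ᶠ a
... | yes refl = sym (transpose-ˡ (σ ⟨$⟩ʳ a) (σ ⟨$⟩ʳ b))
... | no u≢a with u ≟ᶠ b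
...   | yes refl = sym (transpose-ʳ (σ ⟨$⟩ʳ a) (σ ⟨$⟩ʳ b))
...   | no u≢b = sym (transpose-other (σ ⟨$⟩ʳ a) (σ ⟨$⟩ʳ b) (u≢a ∘ ⟨$⟩ʳ-injective σ) (u≢b ∘ ⟨$⟩ʳ-injective σ))

-- As `∘ₚ` applies its left factor first, three distinct points are moved as `a` to `c`, `c` to `b`,
-- `b` to `a`.
cycle₃ : Fin n → Fin n → Fin n → Permutation′ n
cycle₃ a b c = transpose a b ∘ₚ transpose b c

cycle₃-conjugate : ∀ (σ : Permutation′ n) a b c u →
  σ ⟨$⟩ʳ (cycle₃ a b c ⟨$⟩ʳ u) ≡ cycle₃ (σ ⟨$⟩ʳ a) (σ ⟨$⟩ʳ b) (σ ⟨$⟩ʳ c) ⟨$⟩ʳ (σ ⟨$⟩ʳ u)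
cycle₃-conjugate σ a b c u = trans (transpose-conjugate σ b c (transpose a b ⟨$⟩ʳ u))
  (cong (transpose (σ ⟨$⟩ʳ b) (σ ⟨$⟩ʳ c) ⟨$⟩ʳ_) (transpose-conjugate σ a b u))

module _ {a b c : Fin n} (b≢a : b ≢ a) (c≢a : c ≢ a) (c≢b : c ≢ b) where

  private
    s = cycle₃ a b c

  cycle₃-a : s ⟨$⟩ʳ a ≡ c
  cycle₃-a = trans (cong (transpose b c ⟨$⟩ʳ_) (transpose-ˡ a b)) (transpose-ˡ b c)

  cycle₃-b : s ⟨$⟩ʳ b ≡ a
  cycle₃-b = trans (cong (transpose b c ⟨$⟩ʳ_) (transpose-ʳ a b)) (transpose-other b c (b≢a ∘ sym) (c≢a ∘ sym))

  cycle₃-c : s ⟨$⟩ʳ c ≡ b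
  cycle₃-c = trans (cong (transpose b c ⟨$⟩ʳ_) (transpose-other a b c≢a c≢b)) (transpose-ʳ b c)

  cycle₃-supported : SupportedOn s (a ∷ b ∷ c ∷ [])
  cycle₃-supported {u} u∉ = trans (cong (transpose b c ⟨$⟩ʳ_) (transpose-other a b (u∉ ∘ here) (u∉ ∘ there ∘ here)))
    (transpose-other b c (u∉ ∘ there ∘ here) (u∉ ∘ there ∘ there ∘ here))

  cycle₃-cubed : s ^ 3 Perm.≈ Perm.id
  cycle₃-cubed u with _∈?_ _≟ᶠ_ u (a ∷ b ∷ c ∷ [])
  ... | yes (here refl)                 = trans (cong (s ^ 2 ⟨$⟩ʳ_) cycle₃-a) (trans (cong (s ⟨$⟩ʳ_) cycle₃-c) cycle₃-b)
  ... | yes (there (here refl))         = trans (cong (s ^ 2 ⟨$⟩ʳ_) cycle₃-b) (trans (cong (s ⟨$⟩ʳ_) cycle₃-a) cycle₃-c)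
  ... | yes (there (there (here refl))) = trans (cong (s ^ 2 ⟨$⟩ʳ_) cycle₃-c) (trans (cong (s ⟨$⟩ʳ_) cycle₃-b) cycle₃-a)
  ... | no u∉                           = fixed-^ s 3 (cycle₃-supported u∉)

  cycle₃-vertex : Vertex (P₀ (Sym n))
  cycle₃-vertex = s , λ e → c≢a (trans (sym cycle₃-a) (e a))

transposition-⇝-cycle₃ : ∀ {a b e f g : Fin n} (a≢b : a ≢ b) (f≢e : f ≢ e) (g≢e : g ≢ e) (g≢f : g ≢ f) →
  e ∉ a ∷ b ∷ [] → f ∉ a ∷ b ∷ [] → g ∉ a ∷ b ∷ [] → cycle₃-vertex f≢e g≢e g≢f ⇝ transposition a≢b
transposition-⇝-cycle₃ {a = a} {b} {e} {f} {g} a≢b f≢e g≢e g≢f e∉ f∉ g∉ = odd-∙-involution⇒⇝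
  (cycle₃-vertex f≢e g≢e g≢f) (transposition a≢b)
  (supported⇒commute (cycle₃ e f g) (transpose a b) (e ∷ f ∷ g ∷ []) (cycle₃-supported f≢e g≢e g≢f)
    (transpose-supported a b e∉ ∷ transpose-supported a b f∉ ∷ transpose-supported a b g∉ ∷ []))
  (1 , cycle₃-cubed f≢e g≢e g≢f) (transpose-involutive a b)

-- Seven points suffice: at most four are moved by the two transpositions, which may overlap, and
-- three others carry the 3-cycle.
transpositions-⇝ : 7 ≤ n → ∀ {a b c d : Fin n} (a≢b : a ≢ b) (c≢d : c ≢ d) → transposition a≢b ⇝ transposition c≢d
transpositions-⇝ 7≤n {a} {b} {c} {d} a≢b c≢d
  with fresh (a ∷ b ∷ c ∷ d ∷ []) (≤-trans (m≤m+n 5 2) 7≤n)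
... | e , e∉ with fresh (e ∷ a ∷ b ∷ c ∷ d ∷ []) (≤-trans (m≤m+n 6 1) 7≤n)
... | f , f∉ with fresh (f ∷ e ∷ a ∷ b ∷ c ∷ d ∷ []) 7≤n
... | g , g∉ =
  ⇝-sym (transposition-⇝-cycle₃ a≢b (f∉ ∘ here) (g∉ ∘ there ∘ here) (g∉ ∘ here) (e∉ ∘ ab) (f∉ ∘ there ∘ ab) (g∉ ∘ there ∘ there ∘ ab))
  ◅◅ transposition-⇝-cycle₃ c≢d (f∉ ∘ here) (g∉ ∘ there ∘ here) (g∉ ∘ here) (e∉ ∘ cd) (f∉ ∘ there ∘ cd) (g∉ ∘ there ∘ there ∘ cd)
  where
  ab : ∀ {u} → u ∈ a ∷ b ∷ [] → u ∈ a ∷ b ∷ c ∷ d ∷ []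
  ab = ∈-++⁺ˡ
  cd : ∀ {u} → u ∈ c ∷ d ∷ [] → u ∈ a ∷ b ∷ c ∷ d ∷ []
  cd = there ∘ there

∉-∷ : ∀ {u v : Fin n} {L} → u ≢ v → u ∉ L → u ∉ v ∷ L
∉-∷ u≢v u∉L (here e)  = u≢v e
∉-∷ u≢v u∉L (there i) = u∉L i

-- The transposition is left open because each case of the argument produces its own; only at the
-- end are they all joined to (1 2).
⇝Transposition : Vertex (P₀ (Sym n)) → Set
⇝Transposition {n} u = Σ[ a ∈ Fin n ] Σ[ b ∈ Fin n ] Σ[ a≢b ∈ a ≢ b ] u ⇝ transposition a≢b

⇝-⇝Transposition : ∀ {u v : Vertex (P₀ (Sym n))} → u ⇝ v → ⇝Transposition v → ⇝Transposition u
⇝-⇝Transposition u⇝v (a , b , a≢b , p) = a , b , a≢b , u⇝v ◅◅ p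

odd∧twoFixed⇒⇝ : ∀ (u : Vertex (P₀ (Sym n))) → OddPower (proj₁ u) → ∀ {a b} → a ≢ b →
  proj₁ u ⟨$⟩ʳ a ≡ a → proj₁ u ⟨$⟩ʳ b ≡ b → ⇝Transposition u
odd∧twoFixed⇒⇝ u odd {a} {b} a≢b ua ub = a , b , a≢b , odd-∙-involution⇒⇝ u (transposition a≢b)
  (λ i → sym (supported⇒commute (transpose a b) (proj₁ u) (a ∷ b ∷ []) (transpose-supported a b) (ua ∷ ub ∷ []) i))
  odd (transpose-involutive a b)

-- Involutions

module Involution (8≤n : 8 ≤ n) (x : Vertex (P₀ (Sym n))) (x² : proj₁ x ^ 2 Perm.≈ Perm.id) where

  private
    φ = proj₁ x
    infixl 9 _′
    _′ : Fin n → Fin n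
    u ′ = φ ⟨$⟩ʳ u

    ≢′-sym : ∀ {u v} → v ≢ u ′ → u ≢ v ′
    ≢′-sym {u} {v} v≢u′ e = v≢u′ (trans (sym (x² v)) (cong _′ (sym e)))

  threeFixed : ∀ {a b c} → b ≢ a → c ≢ a → c ≢ b → a ′ ≡ a → b ′ ≡ b → c ′ ≡ c → ⇝Transposition x
  threeFixed {a} {b} {c} b≢a c≢a c≢b fa fb fc
    with fresh (a ∷ b ∷ c ∷ []) (≤-trans (m≤m+n 4 4) 8≤n)
  ... | e , e∉ with fresh (e ∷ a ∷ b ∷ c ∷ []) (≤-trans (m≤m+n 5 3) 8≤n)
  ... | f , f∉ = ⇝-⇝Transposition (⇝-sym (odd-∙-involution⇒⇝ s x
      (supported⇒commute (cycle₃ a b c) φ (a ∷ b ∷ c ∷ []) (cycle₃-supported b≢a c≢a c≢b) (fa ∷ fb ∷ fc ∷ []))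
      odd x²))
    (odd∧twoFixed⇒⇝ s odd (f∉ ∘ here ∘ sym) (cycle₃-supported b≢a c≢a c≢b e∉) (cycle₃-supported b≢a c≢a c≢b (f∉ ∘ there)))
    where
    s : Vertex (P₀ (Sym n))
    s = cycle₃-vertex b≢a c≢a c≢b
    odd : OddPower (cycle₃ a b c)
    odd = 1 , cycle₃-cubed b≢a c≢a c≢b

  -- (a b c)(a′ b′ c′) commutes with x, has order 3 and, as n ≥ 8, fixes two points.
  threeSwapped : ∀ {a b c} → a ′ ≢ a → b ′ ≢ b → c ′ ≢ c →
    b ∉ a ∷ a ′ ∷ [] → c ∉ b ∷ b ′ ∷ a ∷ a ′ ∷ [] → ⇝Transposition x
  threeSwapped {a} {b} {c} ma mb mc b∉ c∉
    with fresh (a ∷ b ∷ c ∷ a ′ ∷ b ′ ∷ c ′ ∷ []) (≤-trans (m≤m+n 7 1) 8≤n)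
  ... | e , e∉ with fresh (e ∷ a ∷ b ∷ c ∷ a ′ ∷ b ′ ∷ c ′ ∷ []) 8≤n
  ... | f , f∉ = ⇝-⇝Transposition (⇝-sym (odd-∙-involution⇒⇝ t x t-x odd x²))
      (odd∧twoFixed⇒⇝ t odd (f∉ ∘ here ∘ sym) (t-supported e∉) (t-supported (f∉ ∘ there)))
    where
    injective : ∀ {u v} → u ≢ v → u ′ ≢ v ′
    injective u≢v = u≢v ∘ ⟨$⟩ʳ-injective φ
    b≢a : b ≢ a
    b≢a = b∉ ∘ here
    c≢a : c ≢ a
    c≢a = c∉ ∘ there ∘ there ∘ here
    c≢b : c ≢ b
    c≢b = c∉ ∘ here
    σ = cycle₃ a b c
    τ = cycle₃ (a ′) (b ′) (c ′)
    σ-supported : SupportedOn σ (a ∷ b ∷ c ∷ [])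
    σ-supported = cycle₃-supported b≢a c≢a c≢b
    τ-supported : SupportedOn τ (a ′ ∷ b ′ ∷ c ′ ∷ [])
    τ-supported = cycle₃-supported (injective b≢a) (injective c≢a) (injective c≢b)
    disjoint : ∀ {u} → u ∈ a ∷ b ∷ c ∷ [] → u ∉ a ′ ∷ b ′ ∷ c ′ ∷ []
    disjoint (here refl) = ∉-∷ (ma ∘ sym) (∉-∷ (≢′-sym (b∉ ∘ there ∘ here)) (∉-∷ (≢′-sym (c∉ ∘ there ∘ there ∘ there ∘ here)) λ ()))
    disjoint (there (here refl)) = ∉-∷ (b∉ ∘ there ∘ here) (∉-∷ (mb ∘ sym) (∉-∷ (≢′-sym (c∉ ∘ there ∘ here)) λ ()))
    disjoint (there (there (here refl))) = ∉-∷ (c∉ ∘ there ∘ there ∘ there ∘ here) (∉-∷ (c∉ ∘ there ∘ here) (∉-∷ (mc ∘ sym) λ ()))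
    σ-τ : Commute σ τ
    σ-τ = supported⇒commute σ τ _ σ-supported (All.tabulate λ u∈ → τ-supported (disjoint u∈))
    t : Vertex (P₀ (Sym n))
    t = σ ∘ₚ τ , λ e → c≢a (trans (sym (trans (cong (τ ⟨$⟩ʳ_) (cycle₃-a b≢a c≢a c≢b)) (τ-supported (disjoint (there (there (here refl))))))) (e a))
    odd : OddPower (σ ∘ₚ τ)
    odd = 1 , λ i → trans (∘ₚ-^ σ τ σ-τ 3 i)
      (trans (cycle₃-cubed (injective b≢a) (injective c≢a) (injective c≢b) (σ ^ 3 ⟨$⟩ʳ i)) (cycle₃-cubed b≢a c≢a c≢b i))
    t-supported : SupportedOn (σ ∘ₚ τ) (a ∷ b ∷ c ∷ a ′ ∷ b ′ ∷ c ′ ∷ [])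
    t-supported u∉ = trans (cong (τ ⟨$⟩ʳ_) (σ-supported (u∉ ∘ ∈-++⁺ˡ))) (τ-supported (u∉ ∘ there ∘ there ∘ there))
    t-x : Commute (σ ∘ₚ τ) φ
    t-x i = sym (begin
      φ ⟨$⟩ʳ (τ ⟨$⟩ʳ (σ ⟨$⟩ʳ i))
        ≡⟨ cycle₃-conjugate φ (a ′) (b ′) (c ′) (σ ⟨$⟩ʳ i) ⟩
      cycle₃ (a ′ ′) (b ′ ′) (c ′ ′) ⟨$⟩ʳ (φ ⟨$⟩ʳ (σ ⟨$⟩ʳ i))
        ≡⟨ cong₃ (λ p q r → cycle₃ p q r ⟨$⟩ʳ (φ ⟨$⟩ʳ (σ ⟨$⟩ʳ i))) (x² a) (x² b) (x² c) ⟩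
      σ ⟨$⟩ʳ (φ ⟨$⟩ʳ (σ ⟨$⟩ʳ i))
        ≡⟨ cong (σ ⟨$⟩ʳ_) (cycle₃-conjugate φ a b c i) ⟩
      σ ⟨$⟩ʳ (τ ⟨$⟩ʳ (φ ⟨$⟩ʳ i))
        ≡⟨ σ-τ (φ ⟨$⟩ʳ i) ⟩
      τ ⟨$⟩ʳ (σ ⟨$⟩ʳ (φ ⟨$⟩ʳ i)) ∎)
      where
      open ≡-Reasoning
      cong₃ : ∀ (g : Fin n → Fin n → Fin n → Fin n) {p q r p₁ q₁ r₁} → p ≡ p₁ → q ≡ q₁ → r ≡ r₁ → g p q r ≡ g p₁ q₁ r₁
      cong₃ g refl refl refl = refl

  -- The three 2-cycles are chosen greedily, each outside `L`, which contains all fixed points, and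
  -- outside the 2-cycles already chosen. The longest list to be avoided has 4 + 2 entries.
  fewFixed : ∀ L → length L ≤ 2 → (∀ {u} → u ∉ L → u ′ ≢ u) → ⇝Transposition x
  fewFixed L L≤2 moved
    with fresh L (≤-trans (s≤s L≤2) (≤-trans (m≤m+n 3 5) 8≤n))
  ... | a , a∉ with fresh (a ∷ a ′ ∷ L) (≤-trans (s≤s (s≤s (s≤s L≤2))) (≤-trans (m≤m+n 5 3) 8≤n))
  ... | b , b∉ with fresh (b ∷ b ′ ∷ a ∷ a ′ ∷ L) (≤-trans (s≤s (s≤s (s≤s (s≤s (s≤s L≤2))))) (≤-trans (m≤m+n 7 1) 8≤n))
  ... | c , c∉ = threeSwapped (moved a∉) (moved (b∉ ∘ there ∘ there)) (moved (c∉ ∘ there ∘ there ∘ there ∘ there))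
                   (b∉ ∘ ∈-++⁺ˡ) (c∉ ∘ ∈-++⁺ˡ)

  private
    fixed? : ∀ L → Dec (∃[ u ] u ∉ L × u ′ ≡ u)
    fixed? L = any? λ u → ¬? (_∈?_ _≟ᶠ_ u L) ×-dec ((u ′) ≟ᶠ u)

  -- Fixed points are collected one at a time: either a third one turns up, or the search stops with
  -- a list that contains all of them.
  involution⇒⇝ : ⇝Transposition x
  involution⇒⇝ with fixed? []
  ... | no ¬f = fewFixed [] z≤n λ u∉ e → ¬f (_ , u∉ , e)
  ... | yes (a , _ , fa) with fixed? (a ∷ [])
  ...   | no ¬f = fewFixed (a ∷ []) (s≤s z≤n) λ u∉ e → ¬f (_ , u∉ , e)
  ...   | yes (b , b∉ , fb) with fixed? (b ∷ a ∷ [])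
  ...     | no ¬f = fewFixed (b ∷ a ∷ []) ≤-refl λ u∉ e → ¬f (_ , u∉ , e)
  ...     | yes (c , c∉ , fc) = threeFixed (b∉ ∘ here) (c∉ ∘ there ∘ here) (c∉ ∘ here) fa fb fc

-- The involution interchanging two orbits of equal length

sameOrbit⇒^ : ∀ (ψ : Permutation′ n) {i j} → SameOrbit ψ i j → ∃[ k ] ψ ^ k ⟨$⟩ʳ i ≡ j
sameOrbit⇒^ ψ {i} (k , e) with powℤ≼ ψ k
... | m , f = m , trans (sym (f i)) e

^⇒sameOrbit : ∀ (ψ : Permutation′ n) k {i j} → ψ ^ k ⟨$⟩ʳ i ≡ j → SameOrbit ψ i j
^⇒sameOrbit ψ k e = + k , e

module _ (ψ : Permutation′ n) {i j : Fin n} {d : ℕ} (pᵢ : Period ψ i d) (pⱼ : Period ψ j d)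
         (i≁j : ¬ SameOrbit ψ i j) where

  private
    module E = IsEquivalence (sameOrbit-isEquivalence ψ)

    -- Two exponents agree at `i` exactly when the common period `d` divides their difference, and
    -- the same condition governs `j`.
    transfer≤ : ∀ {i j} → Period ψ i d → Period ψ j d → ∀ a b → a ≤ b →
                ψ ^ a ⟨$⟩ʳ i ≡ ψ ^ b ⟨$⟩ʳ i → ψ ^ a ⟨$⟩ʳ j ≡ ψ ^ b ⟨$⟩ʳ j
    transfer≤ {i} {j} p q a b a≤b e = sym (begin
      ψ ^ b ⟨$⟩ʳ j                     ≡⟨ cong (λ c → ψ ^ c ⟨$⟩ʳ j) (m∸n+n≡m a≤b) ⟨
      ψ ^ (b ∸ a + a) ⟨$⟩ʳ j           ≡⟨ ^-+ ψ (b ∸ a) a j ⟩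
      ψ ^ a ⟨$⟩ʳ (ψ ^ (b ∸ a) ⟨$⟩ʳ j)  ≡⟨ cong (ψ ^ a ⟨$⟩ʳ_) (^-∣-id ψ {d} {b ∸ a} (Period.returns q) (Period.minimal p {b ∸ a} (returns-cancel ψ a b a≤b e))) ⟩
      ψ ^ a ⟨$⟩ʳ j                     ∎)
      where open ≡-Reasoning

    transfer : ∀ {i j} → Period ψ i d → Period ψ j d → ∀ a b →
               ψ ^ a ⟨$⟩ʳ i ≡ ψ ^ b ⟨$⟩ʳ i → ψ ^ a ⟨$⟩ʳ j ≡ ψ ^ b ⟨$⟩ʳ j
    transfer p q a b e with ≤-total a b
    ... | inj₁ a≤b = transfer≤ p q a b a≤b e
    ... | inj₂ b≤a = sym (transfer≤ p q b a b≤a (sym e))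

    -- Exchanges ψᵏ i and ψᵏ j. The exponent is whichever one the orbit decision supplies;
    -- `transfer` shows that the image depends only on the point.
    swapped : Fin n → Fin n
    swapped u with sameOrbit? ψ i u
    ... | yes s = ψ ^ proj₁ (sameOrbit⇒^ ψ s) ⟨$⟩ʳ j
    ... | no _ with sameOrbit? ψ j u
    ...   | yes s = ψ ^ proj₁ (sameOrbit⇒^ ψ s) ⟨$⟩ʳ i
    ...   | no _  = u

    swapped-i : ∀ k → swapped (ψ ^ k ⟨$⟩ʳ i) ≡ ψ ^ k ⟨$⟩ʳ j
    swapped-i k with sameOrbit? ψ i (ψ ^ k ⟨$⟩ʳ i)
    ... | yes s = transfer pᵢ pⱼ (proj₁ (sameOrbit⇒^ ψ s)) k (proj₂ (sameOrbit⇒^ ψ s))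
    ... | no ¬s = contradiction (^⇒sameOrbit ψ k refl) ¬s

    swapped-j : ∀ k → swapped (ψ ^ k ⟨$⟩ʳ j) ≡ ψ ^ k ⟨$⟩ʳ i
    swapped-j k with sameOrbit? ψ i (ψ ^ k ⟨$⟩ʳ j)
    ... | yes s = contradiction (E.trans s (E.sym (^⇒sameOrbit ψ k refl))) i≁j
    ... | no _ with sameOrbit? ψ j (ψ ^ k ⟨$⟩ʳ j)
    ...   | yes s = transfer pⱼ pᵢ (proj₁ (sameOrbit⇒^ ψ s)) k (proj₂ (sameOrbit⇒^ ψ s))
    ...   | no ¬s = contradiction (^⇒sameOrbit ψ k refl) ¬s

    swapped-other : ∀ {u} → ¬ SameOrbit ψ i u → ¬ SameOrbit ψ j u → swapped u ≡ u
    swapped-other {u} i≁u j≁u with sameOrbit? ψ i u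
    ... | yes s = contradiction s i≁u
    ... | no _ with sameOrbit? ψ j u
    ...   | yes s = contradiction s j≁u
    ...   | no _  = refl

    data Place : Fin n → Set where
      in-i  : ∀ k → Place (ψ ^ k ⟨$⟩ʳ i)
      in-j  : ∀ k → Place (ψ ^ k ⟨$⟩ʳ j)
      other : ∀ {u} → ¬ SameOrbit ψ i u → ¬ SameOrbit ψ j u → Place u

    place : ∀ u → Place u
    place u with sameOrbit? ψ i u
    ... | yes s = subst Place (proj₂ (sameOrbit⇒^ ψ s)) (in-i (proj₁ (sameOrbit⇒^ ψ s)))
    ... | no i≁u with sameOrbit? ψ j u
    ...   | yes s = subst Place (proj₂ (sameOrbit⇒^ ψ s)) (in-j (proj₁ (sameOrbit⇒^ ψ s)))
    ...   | no j≁u = other i≁u j≁u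

    swapped-involutive : ∀ u → swapped (swapped u) ≡ u
    swapped-involutive u with place u
    ... | in-i k = trans (cong swapped (swapped-i k)) (swapped-j k)
    ... | in-j k = trans (cong swapped (swapped-j k)) (swapped-i k)
    ... | other i≁u j≁u = trans (cong swapped (swapped-other i≁u j≁u)) (swapped-other i≁u j≁u)

    swapped-commute : ∀ u → swapped (ψ ⟨$⟩ʳ u) ≡ ψ ⟨$⟩ʳ swapped u
    swapped-commute u with place u
    ... | in-i k = trans (cong swapped (sym (commute-self ψ k i))) (trans (swapped-i (suc k))
                     (trans (commute-self ψ k j) (cong (ψ ⟨$⟩ʳ_) (sym (swapped-i k)))))
    ... | in-j k = trans (cong swapped (sym (commute-self ψ k j))) (trans (swapped-j (suc k))
                     (trans (commute-self ψ k i) (cong (ψ ⟨$⟩ʳ_) (sym (swapped-j k)))))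
    ... | other i≁u j≁u = trans (swapped-other (i≁u ∘ λ s → E.trans s (E.sym (+ 1 , refl))) (j≁u ∘ λ s → E.trans s (E.sym (+ 1 , refl))))
                            (cong (ψ ⟨$⟩ʳ_) (sym (swapped-other i≁u j≁u)))

  orbitSwap : ∃[ τ ] Commute ψ τ × τ ^ 2 Perm.≈ Perm.id × ¬ τ Perm.≈ Perm.id
  orbitSwap = permutation swapped swapped swapped-involutive swapped-involutive ,
    (λ u → sym (swapped-commute u)) , swapped-involutive ,
    λ e → i≁j (^⇒sameOrbit ψ 0 (trans (sym (e i)) (swapped-i 0)))

orbitList : Permutation′ n → Fin n → ℕ → List (Fin n)
orbitList ψ i d = map (λ k → ψ ^ toℕ k ⟨$⟩ʳ i) (allFin d)

length-orbitList : ∀ (ψ : Permutation′ n) i d → length (orbitList ψ i d) ≡ d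
length-orbitList ψ i d = trans (length-map _ (allFin d)) (length-tabulate {n = d} id)

∈-orbitList : ∀ {ψ : Permutation′ n} {i j d} → Period ψ i d → SameOrbit ψ i j → j ∈ orbitList ψ i d
∈-orbitList {ψ = ψ} {i} {d = d} p s with sameOrbit⇒^ ψ s
... | k , refl = subst (_∈ orbitList ψ i d)
    (trans (cong (λ c → ψ ^ c ⟨$⟩ʳ i) (toℕ-fromℕ< (m%n<n k d))) (sym (%-fixed ψ d k (Period.returns p))))
    (∈-map⁺ (λ k → ψ ^ toℕ k ⟨$⟩ʳ i) (∈-allFin (fromℕ< (m%n<n k d))))

halve : ∀ m → (∃[ h ] m ≡ h * 2) ⊎ (∃[ h ] m ≡ suc (h * 2))
halve zero = inj₁ (0 , refl)
halve (suc m) with halve m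
... | inj₁ (h , e) = inj₂ (h , cong suc e)
... | inj₂ (h , e) = inj₁ (suc h , cong suc e)

2∤odd : ∀ h → ¬ 2 ∣ suc (h * 2)
2∤odd h d with ∣1⇒≡1 (∣m+n∣m⇒∣n (subst (2 ∣_) (+-comm 1 (h * 2)) d) (divides h refl))
... | ()

2∣m⊎2∣1+m : ∀ m → 2 ∣ m ⊎ 2 ∣ suc m
2∣m⊎2∣1+m m with halve m
... | inj₁ (h , e) = inj₁ (divides h e)
... | inj₂ (h , e) = inj₂ (divides (suc h) (cong suc e))

moved : ∀ (u : Vertex (P₀ (Sym n))) → ∃[ i ] proj₁ u ⟨$⟩ʳ i ≢ i
moved (ψ , ψ≉id) with any? (λ i → ¬? ((ψ ⟨$⟩ʳ i) ≟ᶠ i))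
... | yes m = m
... | no ¬m = contradiction (λ i → decidable-stable ((ψ ⟨$⟩ʳ i) ≟ᶠ i) (λ ne → ¬m (i , ne))) ψ≉id

transposition⇝[12] : ∀ (2≤n : 2 ≤ n) → 7 ≤ n → {a b : Fin n} (a≢b : a ≢ b) → transposition a≢b ⇝ [12] 2≤n
-- Matching on the bound makes `[12]` reduce to `transpose zero (suc zero)`.
transposition⇝[12] {suc (suc n)} (s≤s (s≤s _)) 7≤n a≢b =
  transpositions-⇝ 7≤n a≢b 0≢1 ◅◅ ≼⇒⇝ {u = transposition 0≢1} {v = _ , _} ≼-refl
  where
  0≢1 : _≢_ {A = Fin (suc (suc n))} zero (suc zero)
  0≢1 ()

-- Reaching a transposition when n is p or p + 1

open Involution using (involution⇒⇝)

module LargePrime {p : ℕ} (pr : Prime p) (7≤p : 7 ≤ p) where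

  instance
    p-nonZero : NonZero p
    p-nonZero = prime⇒nonZero pr

  p≢1 : p ≢ 1
  p≢1 refl = contradiction 7≤p λ { (s≤s ()) }

  ∣p⇒1⊎p : ∀ {d} → d ∣ p → d ≡ 1 ⊎ d ≡ p
  ∣p⇒1⊎p = prime⇒irreducible pr

  2∤p : ¬ 2 ∣ p
  2∤p 2∣p with ∣p⇒1⊎p 2∣p
  ... | inj₂ refl = contradiction 7≤p λ { (s≤s (s≤s ())) }

module NearPrime {n p : ℕ} (8≤n : 8 ≤ n) (pr : Prime p) (7≤p : 7 ≤ p) (n≡ : n ≡ p ⊎ n ≡ suc p) where

  open LargePrime pr 7≤p

  odd⇒⇝ : ∀ (u : Vertex (P₀ (Sym n))) → OddPower (proj₁ u) → ¬ proj₁ u ^ p Perm.≈ Perm.id → ⇝Transposition u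
  odd⇒⇝ u@(ψ , ψ≉id) odd@(h , ψ^odd) ψ^p≉id with moved u
  ... | i , ψi≢i with periodOf ψ i
  ... | ℓ , ℓ≤n , pᵢ = byPower ((ψ ^ ℓ) ≈? Perm.id)
    where
    -- If ψᵏ fixes j, then it also fixes ψ j.
    properPower : ∀ k {j} → ψ ⟨$⟩ʳ j ≢ j → ψ ^ k ⟨$⟩ʳ j ≡ j → ¬ ψ ^ k Perm.≈ Perm.id → ⇝Transposition u
    properPower k {j} ψj≢j e ψ^k≉id = ⇝-⇝Transposition {v = v} (⇝-sym (≼⇒⇝ {u = v} (power≼ ψ k)))
      (odd∧twoFixed⇒⇝ v (h , λ i → trans (^-* ψ k (suc (h * 2)) i) (^-∣-id ψ {suc (h * 2)} (ψ^odd i) (m∣m*n k)))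
        (ψj≢j ∘ sym) e (trans (commute-self ψ k j) (cong (ψ ⟨$⟩ʳ_) e)))
      where
      v : Vertex (P₀ (Sym n))
      v = ψ ^ k , ψ^k≉id

    ℓ-odd : ¬ 2 ∣ ℓ
    ℓ-odd 2∣ℓ = 2∤odd h (∣-trans 2∣ℓ (Period.minimal pᵢ {suc (h * 2)} (ψ^odd i)))

    singleOrbit : ψ ^ ℓ Perm.≈ Perm.id → (∀ {j} → ¬ SameOrbit ψ i j → ψ ⟨$⟩ʳ j ≡ j) →
                  (∀ {a b} → b ≢ a → ψ ⟨$⟩ʳ a ≡ a → ψ ⟨$⟩ʳ b ≡ b → ⊥) → ⊥
    singleOrbit ψ^ℓ≈id fixed noTwo = lengths n≡ (m≤n⇒m<n∨m≡n ℓ≤n)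
      where
      L = orbitList ψ i ℓ
      fixed∉ : ∀ {j} → j ∉ L → ψ ⟨$⟩ʳ j ≡ j
      fixed∉ j∉ = fixed (j∉ ∘ ∈-orbitList pᵢ)
      -- Two points outside the orbit of `i` would form a pair of fixed points.
      n≤1+ℓ : n ≤ suc ℓ
      n≤1+ℓ with n ≤? suc ℓ
      ... | yes le = le
      ... | no nle with fresh L (subst (_< n) (sym (length-orbitList ψ i ℓ)) (<-trans (n<1+n ℓ) (≰⇒> nle)))
      ...   | a , a∉ with fresh (a ∷ L) (subst (λ c → suc c < n) (sym (length-orbitList ψ i ℓ)) (≰⇒> nle))
      ...     | b , b∉ = contradiction (fixed∉ (b∉ ∘ there)) (noTwo (b∉ ∘ here) (fixed∉ a∉))
      -- Here ℓ is n or n - 1. If it is not p, then ℓ and p are consecutive numbers, and one of them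
      -- is even although both are odd.
      lengths : n ≡ p ⊎ n ≡ suc p → ℓ < n ⊎ ℓ ≡ n → ⊥
      lengths (inj₁ refl) (inj₂ refl) = ψ^p≉id ψ^ℓ≈id
      lengths (inj₁ refl) (inj₁ ℓ<n)  = [ ℓ-odd , 2∤p ∘ subst (2 ∣_) (≤-antisym ℓ<n n≤1+ℓ) ]′ (2∣m⊎2∣1+m ℓ)
      lengths (inj₂ refl) (inj₂ refl) = [ 2∤p , ℓ-odd ]′ (2∣m⊎2∣1+m p)
      lengths (inj₂ refl) (inj₁ ℓ<n)  = ψ^p≉id (subst (λ c → ψ ^ c Perm.≈ Perm.id) (≤-antisym (≤-pred ℓ<n) (≤-pred n≤1+ℓ)) ψ^ℓ≈id)

    otherOrbit : ψ ^ ℓ Perm.≈ Perm.id → ∀ {j d} → ¬ SameOrbit ψ i j → ψ ⟨$⟩ʳ j ≢ j → Period ψ j d →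
                 Dec (ψ ^ d Perm.≈ Perm.id) → ⇝Transposition u
    otherOrbit ψ^ℓ≈id {d = d} i≁j ψj≢j pⱼ (no ψ^d≉id) = properPower d ψj≢j (Period.returns pⱼ) ψ^d≉id
    otherOrbit ψ^ℓ≈id {j} {d} i≁j ψj≢j pⱼ (yes ψ^d≈id) = throughSwap (orbitSwap ψ pᵢ pⱼ′ i≁j)
      where
      pⱼ′ : Period ψ j ℓ
      -- Both ψ^ℓ and ψ^d are the identity, so each of the two periods divides the other.
      pⱼ′ = subst (Period ψ j) (∣-antisym (Period.minimal pⱼ {ℓ} (ψ^ℓ≈id j)) (Period.minimal pᵢ {d} (ψ^d≈id i))) pⱼ
      throughSwap : ∃[ τ ] Commute ψ τ × τ ^ 2 Perm.≈ Perm.id × ¬ τ Perm.≈ Perm.id → ⇝Transposition u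
      throughSwap (τ , c , τ² , τ≉id) = ⇝-⇝Transposition {u = u} {t} (odd-∙-involution⇒⇝ u t c odd τ²) (involution⇒⇝ 8≤n t τ²)
        where
        t : Vertex (P₀ (Sym n))
        t = τ , τ≉id

    FixedPair : Set
    FixedPair = ∃[ a ] ψ ⟨$⟩ʳ a ≡ a × ∃[ b ] b ≢ a × ψ ⟨$⟩ʳ b ≡ b

    fixedPair? : Dec FixedPair
    fixedPair? = any? λ a → ((ψ ⟨$⟩ʳ a) ≟ᶠ a) ×-dec any? λ b → ¬? (b ≟ᶠ a) ×-dec ((ψ ⟨$⟩ʳ b) ≟ᶠ b)

    OtherOrbit : Set
    OtherOrbit = ∃[ j ] ¬ SameOrbit ψ i j × ψ ⟨$⟩ʳ j ≢ j

    otherOrbit? : Dec OtherOrbit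
    otherOrbit? = any? λ j → ¬? (sameOrbit? ψ i j) ×-dec ¬? ((ψ ⟨$⟩ʳ j) ≟ᶠ j)

    byOrbits : ψ ^ ℓ Perm.≈ Perm.id → Dec OtherOrbit → Dec FixedPair → ⇝Transposition u
    byOrbits ψ^ℓ≈id (yes (j , i≁j , ψj≢j)) _ =
      otherOrbit ψ^ℓ≈id i≁j ψj≢j (proj₂ (proj₂ (periodOf ψ j))) ((ψ ^ proj₁ (periodOf ψ j)) ≈? Perm.id)
    byOrbits ψ^ℓ≈id (no _) (yes (a , ψa , b , b≢a , ψb)) = odd∧twoFixed⇒⇝ u odd (b≢a ∘ sym) ψa ψb
    byOrbits ψ^ℓ≈id (no ¬j) (no ¬ab) = ⊥-elim (singleOrbit ψ^ℓ≈id
      (λ {j} i≁j → decidable-stable ((ψ ⟨$⟩ʳ j) ≟ᶠ j) (λ ψj≢j → ¬j (j , i≁j , ψj≢j)))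
      (λ b≢a ψa ψb → ¬ab (_ , ψa , _ , b≢a , ψb)))

    byPower : Dec (ψ ^ ℓ Perm.≈ Perm.id) → ⇝Transposition u
    byPower (no ψ^ℓ≉id)  = properPower ℓ ψi≢i (Period.returns pᵢ) ψ^ℓ≉id
    byPower (yes ψ^ℓ≈id) = byOrbits ψ^ℓ≈id otherOrbit? fixedPair?

  ⇝transposition : ∀ (u : Vertex (P₀ (Sym n))) → ¬ proj₁ u ^ p Perm.≈ Perm.id → ⇝Transposition u
  ⇝transposition u@(ψ , ψ≉id) ψ^p≉id = byParity (order ψ)
    where
    evenOrder : ∀ h → ψ ^ (suc h * 2) Perm.≈ Perm.id → ¬ ψ ^ suc h Perm.≈ Perm.id → ⇝Transposition u
    evenOrder h ψ^2h≈id ψ^h≉id = ⇝-⇝Transposition {v = v} (⇝-sym (≼⇒⇝ {u = v} (power≼ ψ (suc h))))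
      (involution⇒⇝ 8≤n v (λ i → trans (^-* ψ (suc h) 2 i) (trans (cong (λ c → ψ ^ c ⟨$⟩ʳ i) (*-comm 2 (suc h))) (ψ^2h≈id i))))
      where
      v : Vertex (P₀ (Sym n))
      v = ψ ^ suc h , ψ^h≉id

    byParity : ∃[ m ] IsOrder (Sym n) ψ m → ⇝Transposition u
    byParity (m , m≢0 , ψ^m , min) with halve m
    ... | inj₂ (h , refl)     = odd⇒⇝ u (h , ψ^m) ψ^p≉id
    ... | inj₁ (suc h , refl) = evenOrder h ψ^m λ e → contradiction (min (suc h) _ e) (<⇒≱ (s≤s (s≤s (m≤m*n h 2))))

  ⇝[12] : ∀ (2≤n : 2 ≤ n) (u : Vertex (P₀ (Sym n))) → ¬ proj₁ u ^ p Perm.≈ Perm.id → [12] 2≤n ⇝ u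
  ⇝[12] 2≤n u ψ^p≉id = connect (⇝transposition u ψ^p≉id)
    where
    connect : ⇝Transposition u → [12] 2≤n ⇝ u
    connect (a , b , a≢b , u⇝t) = ⇝-sym {u = u} {[12] 2≤n} (u⇝t ◅◅ transposition⇝[12] 2≤n (≤-trans (n≤1+n 7) 8≤n) a≢b)

-- Orbit sizes and types

orbitSize : Permutation′ n → Fin n → ℕ
orbitSize ψ = length ∘ orbit ψ

∈-orbitList⁻ : ∀ (ψ : Permutation′ n) i d {j} → j ∈ orbitList ψ i d → SameOrbit ψ i j
∈-orbitList⁻ ψ i d j∈ with ∈-map⁻ (λ k → ψ ^ toℕ k ⟨$⟩ʳ i) j∈
... | k , _ , refl = ^⇒sameOrbit ψ (toℕ k) refl

orbit-injective : ∀ {ψ : Permutation′ n} {i d} → Period ψ i d → ∀ {k l : Fin d} →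
  ψ ^ toℕ k ⟨$⟩ʳ i ≡ ψ ^ toℕ l ⟨$⟩ʳ i → k ≡ l
orbit-injective {ψ = ψ} {i} {d} p {k} {l} e =
  toℕ-injective ([ (λ k≤l → injective≤ {k} {l} k≤l e) , (λ l≤k → sym (injective≤ {l} {k} l≤k (sym e))) ]′ (≤-total (toℕ k) (toℕ l)))
  where
  injective≤ : ∀ {k l : Fin d} → toℕ k ≤ toℕ l → ψ ^ toℕ k ⟨$⟩ʳ i ≡ ψ ^ toℕ l ⟨$⟩ʳ i → toℕ k ≡ toℕ l
  injective≤ {k} {l} k≤l e with toℕ l ∸ toℕ k in eq | Period.minimal p {toℕ l ∸ toℕ k} (returns-cancel ψ (toℕ k) (toℕ l) k≤l e)
  ... | zero  | _   = ≤-antisym k≤l (m∸n≡0⇒m≤n eq)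
  ... | suc c | d∣c = contradiction (∣⇒≤ d∣c) (<⇒≱ (≤-trans (s≤s (≤-trans (≤-reflexive (sym eq)) (m∸n≤m (toℕ l) (toℕ k)))) (toℕ<n l)))

orbitList-unique : ∀ {ψ : Permutation′ n} {i d} → Period ψ i d → Unique (orbitList ψ i d)
orbitList-unique {d = d} p = Unique.map⁺ (orbit-injective p) (Unique.allFin⁺ d)

-- The bridge from the orbits counted in `type` to exponents: `orbit` and `orbitList` are free of
-- repetitions and have the same elements.
orbitSize≡period : ∀ {ψ : Permutation′ n} {i d} → Period ψ i d → orbitSize ψ i ≡ d
orbitSize≡period {n} {ψ} {i} {d} p = trans (↭-length orbit↭) (length-orbitList ψ i d)
  where
  orbit↭ : orbit ψ i ↭ orbitList ψ i d
  orbit↭ = ∼bag⇒↭ (unique∧set⇒bag (Unique.filter⁺ (sameOrbit? ψ i) (Unique.allFin⁺ n)) (orbitList-unique p)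
    (mk⇔ (∈-orbitList p ∘ proj₂ ∘ ∈-filter⁻ (sameOrbit? ψ i) {xs = allFin n})
         (∈-filter⁺ (sameOrbit? ψ i) (∈-allFin _) ∘ ∈-orbitList⁻ ψ i d)))

period-orbitSize : ∀ (ψ : Permutation′ n) i → Period ψ i (orbitSize ψ i)
period-orbitSize ψ i = subst (Period ψ i) (sym (orbitSize≡period p)) p
  where p = proj₂ (proj₂ (periodOf ψ i))

period-sameOrbit : ∀ {ψ : Permutation′ n} {i j d} → SameOrbit ψ i j → Period ψ i d → Period ψ j d
period-sameOrbit {ψ = ψ} {i} {d = d} s p with sameOrbit⇒^ ψ s
... | k , refl = record
  { returns = trans (swap k d) (cong (ψ ^ k ⟨$⟩ʳ_) (Period.returns p))
  ; minimal = λ {m} e → Period.minimal p {m} (⟨$⟩ʳ-injective (ψ ^ k) (trans (sym (swap k m)) e))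
  }
  where
  swap : ∀ a b → ψ ^ b ⟨$⟩ʳ (ψ ^ a ⟨$⟩ʳ i) ≡ ψ ^ a ⟨$⟩ʳ (ψ ^ b ⟨$⟩ʳ i)
  swap a b = trans (sym (^-+ ψ a b i)) (trans (cong (λ c → ψ ^ c ⟨$⟩ʳ i) (+-comm a b)) (^-+ ψ b a i))

-- With g = gcd a d, divisibility of k a by d amounts to divisibility of k (a / g) by d / g, and d /
-- g is coprime to a / g.
period-^ : ∀ {ψ : Permutation′ n} {i d} a .{{_ : NonZero a}} → Period ψ i d →
           Period (ψ ^ a) i ((d / gcd a d) {{gcd-nonZero a d}})
period-^ {ψ = ψ} {i} {d} a p = record
  { period≢0 = ≢-nonZero (n/gcd[m,n]≢0 a d)
  ; returns  = trans (^-* ψ a q i) (^-∣-id ψ {d} (Period.returns p)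
      (divides (a / g) (begin
        q * a                ≡⟨ cong (q *_) (m*[n/m]≡n (gcd[m,n]∣m a d)) ⟨
        q * (g * (a / g))    ≡⟨ *-assoc q g (a / g) ⟨
        q * g * (a / g)      ≡⟨ cong (_* (a / g)) (m/n*n≡m (gcd[m,n]∣n a d)) ⟩
        d * (a / g)          ≡⟨ *-comm d (a / g) ⟩
        a / g * d            ∎)))
  ; minimal  = λ {k} e → coprime-divisor (coprime-sym (coprime-/gcd a d))
      (*-cancelʳ-∣ g (subst (_∣ a / g * k * g) (sym (m/n*n≡m (gcd[m,n]∣n a d)))
        (subst (d ∣_) (k*a≡ k) (Period.minimal p {k * a} (trans (sym (^-* ψ a k i)) e)))))
  }
  where
  open ≡-Reasoning
  g = gcd a d
  instance _ = gcd-nonZero a d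
  q = d / g
  k*a≡ : ∀ k → k * a ≡ a / g * k * g
  k*a≡ k = begin
    k * a              ≡⟨ cong (k *_) (m/n*n≡m (gcd[m,n]∣m a d)) ⟨
    k * (a / g * g)    ≡⟨ *-assoc k (a / g) g ⟨
    k * (a / g) * g    ≡⟨ cong (_* g) (*-comm k (a / g)) ⟩
    a / g * k * g      ∎

-- On the type of ψ this gives the multiset of the orbit sizes of all points, so that
-- statements about types reduce to statements about the period of each point.
expand : List ℕ → List ℕ
expand = concatMap λ m → replicate m m

module _ {A : Set} {R : Rel A 0ℓ} (isEq : IsEquivalence R) (R? : Decidable R) where

  private
    module E = IsEquivalence isEq

    classes : List A → List A → List A
    classes zs = concatMap λ x → filter (R? x) zs

    -- After the class of `x` is removed from `zs`, a representative inside that class contributes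
    -- nothing, and one outside it loses nothing.
    classes-outside : ∀ x zs ys → classes zs (filter (¬? ∘ R? x) ys) ≡ classes (filter (¬? ∘ R? x) zs) ys
    classes-outside x zs [] = refl
    classes-outside x zs (y ∷ ys) with R? x y
    ... | yes xy = trans (classes-outside x zs ys) (cong (_++ classes (filter (¬? ∘ R? x) zs) ys) (sym (inside zs)))
      where
      inside : ∀ zs → filter (R? y) (filter (¬? ∘ R? x) zs) ≡ []
      inside [] = refl
      inside (z ∷ zs) with R? x z
      ... | yes _  = inside zs
      ... | no ¬xz = trans (filter-reject (R? y) {xs = filter (¬? ∘ R? x) zs} (λ yz → ¬xz (E.trans xy yz))) (inside zs)
    ... | no ¬xy = cong₂ _++_ (sym (outside zs)) (classes-outside x zs ys)
      where
      outside : ∀ zs → filter (R? y) (filter (¬? ∘ R? x) zs) ≡ filter (R? y) zs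
      outside [] = refl
      outside (z ∷ zs) with R? x z
      ... | yes xz = trans (outside zs) (sym (filter-reject (R? y) {xs = zs} (λ yz → ¬xy (E.trans xz (E.sym yz)))))
      ... | no _ with R? y z
      ...   | yes _ = cong (z ∷_) (outside zs)
      ...   | no _  = outside zs

    filter-split : ∀ x zs → filter (R? x) zs ++ filter (¬? ∘ R? x) zs ↭ zs
    filter-split x [] = ↭-refl
    filter-split x (z ∷ zs) with R? x z
    ... | yes _ = ↭.prep z (filter-split x zs)
    ... | no _  = ↭-trans (shift z (filter (R? x) zs) _) (↭.prep z (filter-split x zs))

  -- The partitioned list `zs` is kept apart from the list `xs` of candidates, because the induction
  -- discards from `zs` the whole class of the first candidate.
  classes-↭ : ∀ xs zs → (∀ {z} → z ∈ zs → ∃[ x ] x ∈ xs × R x z) → classes zs (deduplicate R? xs) ↭ zs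
  classes-↭ [] [] cover = ↭-refl
  classes-↭ [] (z ∷ zs) cover with cover (here refl)
  ... | _ , () , _
  classes-↭ (x ∷ xs) zs cover = ↭-trans
    (++⁺ˡ (filter (R? x) zs) (↭-trans (↭.↭-reflexive (classes-outside x zs (deduplicate R? xs)))
      (classes-↭ xs (filter (¬? ∘ R? x) zs) cover′)))
    (filter-split x zs)
    where
    cover′ : ∀ {z} → z ∈ filter (¬? ∘ R? x) zs → ∃[ x ] x ∈ xs × R x z
    cover′ z∈ with ∈-filter⁻ (¬? ∘ R? x) {xs = zs} z∈
    ... | z∈zs , ¬xz with cover z∈zs
    ...   | y , here refl , yz = contradiction yz ¬xz
    ...   | y , there y∈ , yz  = y , y∈ , yz

map≡replicate : ∀ {A B : Set} (f : A → B) {c} xs → (∀ {x} → x ∈ xs → f x ≡ c) → map f xs ≡ replicate (length xs) c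
map≡replicate f [] h = refl
map≡replicate f (x ∷ xs) h = cong₂ _∷_ (h (here refl)) (map≡replicate f xs (h ∘ there))

expand-type : ∀ (ψ : Permutation′ n) → expand (parts (type ψ)) ↭ map (orbitSize ψ) (allFin n)
expand-type {n} ψ = ↭-trans (↭.↭-reflexive (begin
    expand (map (orbitSize ψ) reps)                                      ≡⟨ concatMap-map (λ m → replicate m m) (orbitSize ψ) reps ⟩
    concatMap (λ r → replicate (orbitSize ψ r) (orbitSize ψ r)) reps     ≡⟨ concatMap-cong constant reps ⟨
    concatMap (map (orbitSize ψ) ∘ orbit ψ) reps                         ≡⟨ map-concatMap (orbitSize ψ) (orbit ψ) reps ⟨
    map (orbitSize ψ) (concatMap (orbit ψ) reps)                         ∎))
  (map⁺ (orbitSize ψ) (classes-↭ isEq (sameOrbit? ψ) (allFin n) (allFin n) λ {z} z∈ → z , z∈ , IsEquivalence.refl isEq))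
  where
  open ≡-Reasoning
  reps = orbitRepresentatives ψ
  isEq = sameOrbit-isEquivalence ψ
  constant : ∀ r → map (orbitSize ψ) (orbit ψ r) ≡ replicate (orbitSize ψ r) (orbitSize ψ r)
  constant r = map≡replicate (orbitSize ψ) (orbit ψ r) λ j∈ →
    orbitSize≡period (period-sameOrbit (proj₂ (∈-filter⁻ (sameOrbit? ψ r) {xs = allFin n} j∈)) (period-orbitSize ψ r))

∈-expand⁻ : ∀ {m} L → m ∈ expand L → m ∈ L
∈-expand⁻ {m} (k ∷ L) m∈ with ∈-++⁻ (replicate k k) m∈
... | inj₁ m∈k = here (∈-replicate⁻ k m∈k)
  where
  ∈-replicate⁻ : ∀ c → m ∈ replicate c k → m ≡ k
  ∈-replicate⁻ (suc c) (here e)   = e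
  ∈-replicate⁻ (suc c) (there m∈) = ∈-replicate⁻ c m∈
... | inj₂ m∈L = there (∈-expand⁻ L m∈L)

∈-expand⁺ : ∀ {m L} → NonZero m → m ∈ L → m ∈ expand L
∈-expand⁺ {suc m} _   (here refl) = here refl
∈-expand⁺ {L = k ∷ L} m≢0 (there m∈) = ∈-++⁺ʳ (replicate k k) (∈-expand⁺ m≢0 m∈)

++-cancelˡ-↭ : ∀ {A : Set} (xs : List A) {ys zs} → xs ++ ys ↭ xs ++ zs → ys ↭ zs
++-cancelˡ-↭ []       p = p
++-cancelˡ-↭ (x ∷ xs) p = ++-cancelˡ-↭ xs (drop-∷ p)

-- The first part m of `L` occurs in `expand M` and hence in `M`; m copies of it cancel from both
-- expansions. Positivity ensures that m is visible in the expansion at all.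
expand-injective : ∀ L M → All NonZero L → All NonZero M → expand L ↭ expand M → L ↭ M
expand-injective [] [] _ _ _ = ↭-refl
expand-injective [] (m ∷ M) _ (m≢0 ∷ _) p with ∈-resp-↭ (↭-sym p) (∈-expand⁺ {L = m ∷ M} m≢0 (here refl))
... | ()
expand-injective (m ∷ L) M (m≢0 ∷ L≢0) M≢0 p
  with ∈-∃++ (∈-expand⁻ M (∈-resp-↭ p (∈-expand⁺ {L = m ∷ L} m≢0 (here refl))))
... | M₁ , M₂ , refl = ↭-trans (↭.prep m (expand-injective L (M₁ ++ M₂) L≢0 (All.tail M′≢0)
        (++-cancelˡ-↭ (replicate m m) (↭-trans p (concatMap-↭ (λ k → replicate k k) (shift m M₁ M₂))))))
      (↭-sym (shift m M₁ M₂))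
  where
  M′≢0 : All NonZero (m ∷ M₁ ++ M₂)
  M′≢0 = All-resp-↭ (shift m M₁ M₂) M≢0

type≈ : ∀ (ψ : Permutation′ n) (T : Partition n) → map (orbitSize ψ) (allFin n) ↭ expand (parts T) → type ψ ≈ᵖ T
type≈ ψ T p = expand-injective (parts (type ψ)) (parts T) (positive (type ψ)) (positive T) (↭-trans (expand-type ψ) p)

module _ (a : ℕ) .{{a≢0 : NonZero a}} where

  private
    part : ℕ → ℕ
    part m = (m / gcd a m) {{gcd-nonZero a m}}

    replicate-+ : ∀ {A : Set} k l {x : A} → replicate k x ++ replicate l x ≡ replicate (k + l) x
    replicate-+ zero    l = refl
    replicate-+ (suc k) l = cong (_ ∷_) (replicate-+ k l)

    expand-replicate : ∀ k m → expand (replicate k m) ≡ replicate (k * m) m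
    expand-replicate zero    m = refl
    expand-replicate (suc k) m = trans (cong (replicate m m ++_) (expand-replicate k m)) (replicate-+ m (k * m))

  -- The gcd a m parts of size m / gcd a m again cover m points, so after expansion a power acts
  -- entry by entry, exactly as `period-^` acts on orbit sizes.
  expand-power : ∀ L → expand (concatMap (powerOfPart a) L) ≡ map part (expand L)
  expand-power [] = refl
  expand-power (m ∷ L) = begin
    expand (powerOfPart a m ++ concatMap (powerOfPart a) L)         ≡⟨ concatMap-++ (λ k → replicate k k) (powerOfPart a m) _ ⟩
    expand (powerOfPart a m) ++ expand (concatMap (powerOfPart a) L) ≡⟨ cong₂ _++_ (expand-replicate (gcd a m) (part m)) (expand-power L) ⟩
    replicate (gcd a m * part m) (part m) ++ map part (expand L)    ≡⟨ cong (λ c → replicate c (part m) ++ map part (expand L)) (m*[n/m]≡n (gcd[m,n]∣n a m)) ⟩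
    replicate m (part m) ++ map part (expand L)                     ≡⟨ cong (_++ map part (expand L)) (map-replicate part m m) ⟨
    map part (replicate m m) ++ map part (expand L)                 ≡⟨ map-++ part (replicate m m) (expand L) ⟨
    map part (replicate m m ++ expand L)                            ∎
    where
    open ≡-Reasoning
    instance _ = gcd-nonZero a m

  type-^ : ∀ (ψ : Permutation′ n) → type (ψ ^ a) ≈ᵖ type ψ ^ᵖ a
  type-^ {n} ψ = type≈ (ψ ^ a) (type ψ ^ᵖ a) (↭-trans
    (↭.↭-reflexive (trans (map-cong (λ i → orbitSize≡period (period-^ a (period-orbitSize ψ i))) (allFin n)) (map-∘ (allFin n))))
    (↭-trans (map⁺ part (↭-sym (expand-type ψ))) (↭.↭-reflexive (sym (expand-power (parts (type ψ)))))))

-- Elements of order p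

unique⇒length≤ : ∀ {n} {L : List (Fin n)} → Unique L → length L ≤ n
unique⇒length≤ {L = L} u = injective⇒≤ (lookup-injective u)
  where
  lookup-injective : ∀ {A : Set} {L : List A} → Unique L → ∀ {i j} → lookup L i ≡ lookup L j → i ≡ j
  lookup-injective (_ ∷ u)  {zero}  {zero}  e = refl
  lookup-injective (x∉ ∷ u) {zero}  {suc j} e = contradiction e (All.lookup x∉ (∈-lookup j))
  lookup-injective (x∉ ∷ u) {suc i} {zero}  e = contradiction (sym e) (All.lookup x∉ (∈-lookup i))
  lookup-injective (_ ∷ u)  {suc i} {suc j} e = cong suc (lookup-injective u e)

-- For n < 2p these are exactly the p-cycles.
IsPCycle : ∀ {n} → ℕ → Permutation′ n → Set
IsPCycle p ψ = ¬ ψ Perm.≈ Perm.id × ψ ^ p Perm.≈ Perm.id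

module PCycles {n p : ℕ} (pr : Prime p) (7≤p : 7 ≤ p) (n≤1+p : n ≤ suc p) where

  open LargePrime pr 7≤p

  period-p : ∀ {ψ : Permutation′ n} {i d} → ψ ^ p Perm.≈ Perm.id → ψ ⟨$⟩ʳ i ≢ i → Period ψ i d → d ≡ p
  period-p {i = i} ψ^p≈id ψi≢i q with ∣p⇒1⊎p (Period.minimal q {p} (ψ^p≈id i))
  ... | inj₁ refl = contradiction (Period.returns q) ψi≢i
  ... | inj₂ d≡p  = d≡p

  -- Otherwise `v`, its image and the `p` points of the orbit would be p + 2 distinct points.
  period-p⇒fixed : ∀ {ψ : Permutation′ n} {i} → Period ψ i p → ∀ {v} → ¬ SameOrbit ψ i v → ψ ⟨$⟩ʳ v ≡ v
  period-p⇒fixed {ψ} {i} q {v} i≁v = decidable-stable ((ψ ⟨$⟩ʳ v) ≟ᶠ v) λ ψv≢v →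
    contradiction (unique⇒length≤ (unique ψv≢v)) (<⇒≱ (≤-trans (s≤s n≤1+p)
      (≤-reflexive (cong (λ m → suc (suc m)) (sym (length-orbitList ψ i p))))))
    where
    module E = IsEquivalence (sameOrbit-isEquivalence ψ)
    outside : ∀ {u} → ¬ SameOrbit ψ i u → ∀ {w} → w ∈ orbitList ψ i p → u ≢ w
    outside i≁u w∈ refl = i≁u (∈-orbitList⁻ ψ i p w∈)
    unique : ψ ⟨$⟩ʳ v ≢ v → Unique (v ∷ (ψ ⟨$⟩ʳ v) ∷ orbitList ψ i p)
    unique ψv≢v = ((ψv≢v ∘ sym) ∷ All.tabulate (outside i≁v)) ∷
      All.tabulate (outside (λ s → i≁v (E.trans s (E.sym (+ 1 , refl))))) ∷ orbitList-unique q

  -- The y-orbit of a point moved by c has length divisible by p, hence equal to p, and there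
  -- is no room for a further nontrivial orbit of y.
  root-of-pCycle : ∀ {c y : Permutation′ n} → c ≼ y → IsPCycle p c → IsPCycle p y
  root-of-pCycle {c} {y} (k , c≡) (c≉id , c^p) with moved (c , c≉id)
  ... | i , ci≢i = y≉id , y^p
    where
    y≉id : ¬ y Perm.≈ Perm.id
    y≉id e = ci≢i (trans (c≡ i) (fixed-^ y k (e i)))
    d = proj₁ (periodOf y i)
    pd : Period y i d
    pd = proj₂ (proj₂ (periodOf y i))
    c^d : c ^ d ⟨$⟩ʳ i ≡ i
    c^d = trans (^-cong c (y ^ k) d c≡ i) (trans (^-* y k d i) (^-∣-id y {d} (Period.returns pd) (m∣m*n k)))
    p∣d : p ∣ d
    p∣d = Period.minimal (subst (Period c i) (period-p c^p ci≢i (period-orbitSize c i)) (period-orbitSize c i)) {d} c^d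
    d≡p : ∀ {e} .{{_ : NonZero e}} → p ∣ e → e ≤ suc p → e ≡ p
    d≡p (divides 1 refl) le = *-identityˡ p
    d≡p (divides (suc (suc q)) refl) le = contradiction (≤-trans (≤-trans (+-monoʳ-≤ p (≤-trans (m≤m+n 2 5) (≤-trans 7≤p (m≤m+n p (q * p))))) le) ≤-refl)
      (<⇒≱ (≤-reflexive (+-comm 2 p)))
    pp : Period y i p
    pp = subst (Period y i) (d≡p {{Period.period≢0 pd}} p∣d (≤-trans (proj₁ (proj₂ (periodOf y i))) n≤1+p)) pd
    y^p : y ^ p Perm.≈ Perm.id
    y^p v with sameOrbit? y i v
    ... | yes s = Period.returns (period-sameOrbit s pp)
    ... | no ¬s = fixed-^ y p (period-p⇒fixed pp ¬s)

  -- As `c` is not the identity, `p` does not divide the exponent `k`, and a Bézout inverse of `k`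
  -- modulo `p` recovers `y` from `c`.
  power-of-pCycle : ∀ {c y : Permutation′ n} → c ≼ y → ¬ c Perm.≈ Perm.id → y ^ p Perm.≈ Perm.id → y ≼ c
  power-of-pCycle {c} {y} (k , c≡) c≉id y^p = byBézout (coprime-Bézout coprime)
    where
    open ≡-Reasoning
    coprime : ∀ {d} → d ∣ k × d ∣ p → d ≡ 1
    coprime (d∣k , d∣p) with ∣p⇒1⊎p d∣p
    ... | inj₁ d≡1  = d≡1
    ... | inj₂ refl = contradiction (λ i → trans (c≡ i) (^-∣-id y {p} (y^p i) d∣k)) c≉id
    c^ : ∀ x i → c ^ x ⟨$⟩ʳ i ≡ y ^ (x * k) ⟨$⟩ʳ i
    c^ x i = trans (^-cong c (y ^ k) x c≡ i) (^-* y k x i)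
    byBézout : Bézout.Identity 1 k p → y ≼ c
    byBézout (Bézout.+- a b eq) = a , λ i → sym (begin
      c ^ a ⟨$⟩ʳ i                   ≡⟨ c^ a i ⟩
      y ^ (a * k) ⟨$⟩ʳ i             ≡⟨ cong (λ m → y ^ m ⟨$⟩ʳ i) eq ⟨
      y ^ (b * p) ⟨$⟩ʳ (y ⟨$⟩ʳ i)    ≡⟨ ^-∣-id y {p} (y^p _) (n∣m*n b) ⟩
      y ⟨$⟩ʳ i                       ∎)
    -- Here y · cᵃ = 1, so y = y (cᵃ)ᵖ = (cᵃ)ᵖ⁻¹.
    byBézout (Bézout.-+ a b eq) = ≼-trans {σ = z} (pred p , λ i → begin
      y ⟨$⟩ʳ i                         ≡⟨ ^-∣-id c {p} (c^p _) (n∣m*n a) ⟨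
      c ^ (a * p) ⟨$⟩ʳ (y ⟨$⟩ʳ i)      ≡⟨ cong (λ m → c ^ m ⟨$⟩ʳ (y ⟨$⟩ʳ i)) (*-comm a p) ⟩
      c ^ (p * a) ⟨$⟩ʳ (y ⟨$⟩ʳ i)      ≡⟨ ^-* c a p _ ⟨
      z ^ p ⟨$⟩ʳ (y ⟨$⟩ʳ i)            ≡⟨ cong (λ m → z ^ m ⟨$⟩ʳ (y ⟨$⟩ʳ i)) (suc-pred p) ⟨
      z ^ pred p ⟨$⟩ʳ (z ⟨$⟩ʳ (y ⟨$⟩ʳ i)) ≡⟨ cong (z ^ pred p ⟨$⟩ʳ_) (z∘y i) ⟩
      z ^ pred p ⟨$⟩ʳ i                ∎) (power≼ c a)
      where
      z = c ^ a
      c^p : c ^ p Perm.≈ Perm.id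
      c^p i = trans (c^ p i) (^-∣-id y {p} (y^p i) (m∣m*n k))
      z∘y : ∀ i → z ⟨$⟩ʳ (y ⟨$⟩ʳ i) ≡ i
      z∘y i = begin
        c ^ a ⟨$⟩ʳ (y ⟨$⟩ʳ i)          ≡⟨ c^ a _ ⟩
        y ^ suc (a * k) ⟨$⟩ʳ i         ≡⟨ cong (λ m → y ^ m ⟨$⟩ʳ i) eq ⟩
        y ^ (b * p) ⟨$⟩ʳ i             ≡⟨ ^-∣-id y {p} (y^p i) (n∣m*n b) ⟩
        i                              ∎

  comparable⇒∼ : ∀ {c v : Permutation′ n} → IsPCycle p c → ¬ v Perm.≈ Perm.id → c ≼ v ⊎ v ≼ c → c ∼ v
  comparable⇒∼ pc v≉id (inj₁ c≼v) = ≼∧≽⇒∼ c≼v (power-of-pCycle c≼v (proj₁ pc) (proj₂ (root-of-pCycle c≼v pc)))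
  comparable⇒∼ pc v≉id (inj₂ v≼c) = ≼∧≽⇒∼ (power-of-pCycle v≼c v≉id (proj₂ pc)) v≼c

  isPCycle-∼ : ∀ {c v : Permutation′ n} → c ∼ v → IsPCycle p c → IsPCycle p v
  isPCycle-∼ {c} {v} c∼v = root-of-pCycle (∼⇒≼ c v c∼v)

  pCycle-isolated : ∀ (u : Vertex (P₀ (Sym n))) → IsPCycle p (proj₁ u) → Isolated (P̃₀ (Sym n)) u
  pCycle-isolated u@(c , _) pc v@(x , x≉id) u~v = proj₁ u~v (comparable⇒∼ {c} {x} pc x≉id (~⇒comparable {u = u} {v} u~v))

  pCycle-⇝ : ∀ {u v : Vertex (P₀ (Sym n))} → IsPCycle p (proj₁ u) → u ⇝ v → proj₁ u ∼ proj₁ v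
  pCycle-⇝ {u} {v} pc = isolated-connected (P̃₀ (Sym n)) {u} {v} (pCycle-isolated u pc)

  [12]-not-pCycle : ∀ (2≤n : 2 ≤ n) → ¬ proj₁ ([12] 2≤n) ^ p Perm.≈ Perm.id
  [12]-not-pCycle 2≤n e with halve p
  ... | inj₁ (h , p≡2h)   = 2∤p (divides h p≡2h)
  ... | inj₂ (h , p≡1+2h) = proj₂ ([12] 2≤n) λ i → trans (sym (^-∣-id (proj₁ ([12] 2≤n)) {2} ([12]² 2≤n _) (divides h refl)))
        (trans (cong (λ m → proj₁ ([12] 2≤n) ^ m ⟨$⟩ʳ i) (sym p≡1+2h)) (e i))
    where
    [12]² : ∀ {m} (2≤m : 2 ≤ m) → proj₁ ([12] 2≤m) ^ 2 Perm.≈ Perm.id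
    [12]² (s≤s (s≤s _)) = transpose-involutive zero (suc zero)

  [12]⇝⇒nonPCycle : ∀ (2≤n : 2 ≤ n) (u : Vertex (P₀ (Sym n))) → [12] 2≤n ⇝ u → ¬ proj₁ u ^ p Perm.≈ Perm.id
  [12]⇝⇒nonPCycle 2≤n u@(ψ , ψ≉id) t⇝u ψ^p = [12]-not-pCycle 2≤n
    (proj₂ (isPCycle-∼ {ψ} {proj₁ ([12] 2≤n)} (pCycle-⇝ {u} {[12] 2≤n} (ψ≉id , ψ^p) (⇝-sym {u = [12] 2≤n} {u} t⇝u)) (ψ≉id , ψ^p)))

  -- Besides one part `p`, the parts sum to n - p, which is less than `p`; so the only divisor of
  -- `p` left for them is 1.
  onesAndP : ∀ L → sum L ≡ n → p ∈ L → (∀ {m} → m ∈ L → m ∣ p) → L ↭ replicate (n ∸ p) 1 ++ p ∷ []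
  onesAndP L ΣL p∈ divs with ∈-∃++ p∈
  ... | L₁ , L₂ , refl = ↭-trans (shift p L₁ L₂) (↭-trans (∷↭∷ʳ p (L₁ ++ L₂)) (↭.↭-reflexive (cong (_++ p ∷ []) ones)))
    where
    M = L₁ ++ L₂
    ΣM : sum M ≡ n ∸ p
    ΣM = trans (sym (m+n∸m≡n p (sum M))) (cong (_∸ p) (trans (sym (sum-↭ (shift p L₁ L₂))) ΣL))
    n∸p<p : n ∸ p < p
    n∸p<p = ≤-trans (s≤s (≤-trans (∸-monoˡ-≤ p n≤1+p) (≤-reflexive (m+n∸n≡m 1 p)))) (≤-trans (m≤m+n 2 5) 7≤p)
    allOnes : ∀ N → (∀ {m} → m ∈ N → m ∣ p) → sum N < p → N ≡ replicate (sum N) 1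
    allOnes [] _ _ = refl
    allOnes (m ∷ N) d lt with ∣p⇒1⊎p (d (here refl))
    ... | inj₁ refl = cong (1 ∷_) (allOnes N (d ∘ there) (<-trans (n<1+n _) lt))
    ... | inj₂ refl = contradiction lt (≤⇒≯ (m≤m+n p (sum N)))
    ones : M ≡ replicate (n ∸ p) 1
    ones = trans (allOnes M (λ m∈ → divs (∈-resp-↭ (↭-sym (shift p L₁ L₂)) (there m∈))) (subst (_< p) (sym ΣM) n∸p<p))
      (cong (λ c → replicate c 1) ΣM)

  -- All orbit lengths divide `p`, and a moved point supplies a part `p`. The contrapositive brings
  -- the condition `¬ IsCycle p` of the theorem to the test on ψᵖ.
  isPCycle⇒isCycle : ∀ {ψ : Permutation′ n} → IsPCycle p ψ → IsCycle p ψ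
  isPCycle⇒isCycle {ψ} (ψ≉id , ψ^p) with moved (ψ , ψ≉id)
  ... | i , ψi≢i = onesAndP (parts (type ψ)) (sum≡n (type ψ))
    (subst (_∈ parts (type ψ)) (period-p ψ^p ψi≢i (period-orbitSize ψ i)) (size∈ i))
    (λ m∈ → size∣p (∈-resp-↭ (expand-type ψ) (∈-expand⁺ (All.lookup (positive (type ψ)) m∈) m∈)))
    where
    size∈ : ∀ j → orbitSize ψ j ∈ parts (type ψ)
    size∈ j = ∈-expand⁻ (parts (type ψ)) (∈-resp-↭ (↭-sym (expand-type ψ)) (∈-map⁺ (orbitSize ψ) (∈-allFin j)))
    size∣p : ∀ {m} → m ∈ map (orbitSize ψ) (allFin n) → m ∣ p
    size∣p m∈ with ∈-map⁻ (orbitSize ψ) m∈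
    ... | j , _ , refl = Period.minimal (period-orbitSize ψ j) {p} (ψ^p j)

  -- If the order is q p, then ψ^q is a p-cycle and ψ is one of its roots.
  p∣order⇒^p : ∀ {ψ : Permutation′ n} {m} → IsOrder (Sym n) ψ m → p ∣ m → ψ ^ p Perm.≈ Perm.id
  p∣order⇒^p {ψ} (m≢0 , ψ^m , min) (divides q refl) = proj₂ (root-of-pCycle (power≼ ψ q) (ψ^q≉id , λ i →
      trans (^-* ψ q p i) (trans (cong (λ c → ψ ^ c ⟨$⟩ʳ i) (*-comm p q)) (ψ^m i))))
    where
    q≢0 : NonZero q
    q≢0 = ≢-nonZero λ { refl → ≢-nonZero⁻¹ 0 {{m≢0}} refl }
    ψ^q≉id : ¬ ψ ^ q Perm.≈ Perm.id
    ψ^q≉id e = contradiction (min q q≢0 e) (<⇒≱ (m<m*n q p {{q≢0}} (≤-trans (m≤m+n 2 5) 7≤p)))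

-- Permutations of a given type

rotation : ∀ m → Permutation′ (suc m)
rotation m = permutation up down up-down down-up
  where
  up : Fin (suc m) → Fin (suc m)
  up i with Top.view i
  ... | Top.‵fromℕ     = zero
  ... | Top.‵inject₁ j = suc j
  down : Fin (suc m) → Fin (suc m)
  down zero    = fromℕ m
  down (suc j) = inject₁ j
  up-down : ∀ i → up (down i) ≡ i
  up-down zero    rewrite Top.view-fromℕ m  = refl
  up-down (suc j) rewrite Top.view-inject₁ j = refl
  down-up : ∀ i → down (up i) ≡ i
  down-up i with Top.view i
  ... | Top.‵fromℕ     = refl
  ... | Top.‵inject₁ j = refl

rotation-inject₁ : ∀ {m} (j : Fin m) → rotation m ⟨$⟩ʳ inject₁ j ≡ suc j
rotation-inject₁ j rewrite Top.view-inject₁ j = refl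

rotation-fromℕ : ∀ m → rotation m ⟨$⟩ʳ fromℕ m ≡ zero
rotation-fromℕ m rewrite Top.view-fromℕ m = refl

rotation-^ : ∀ {m} (u : Fin (suc m)) → rotation m ^ toℕ u ⟨$⟩ʳ zero ≡ u
rotation-^ {m} u = byValue (toℕ u) u refl
  where
  open ≡-Reasoning
  byValue : ∀ k (u : Fin (suc m)) → toℕ u ≡ k → rotation m ^ k ⟨$⟩ʳ zero ≡ u
  byValue zero    zero    _  = refl
  byValue (suc k) (suc j) eq = begin
    rotation m ^ k ⟨$⟩ʳ (rotation m ⟨$⟩ʳ zero)   ≡⟨ commute-self (rotation m) k zero ⟩
    rotation m ⟨$⟩ʳ (rotation m ^ k ⟨$⟩ʳ zero)   ≡⟨ cong (rotation m ⟨$⟩ʳ_) (byValue k (inject₁ j) (trans (toℕ-inject₁ j) (cong pred eq))) ⟩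
    rotation m ⟨$⟩ʳ inject₁ j                    ≡⟨ rotation-inject₁ j ⟩
    suc j                                        ∎

period-rotation : ∀ {m} (u : Fin (suc m)) → Period (rotation m) u (suc m)
period-rotation {m} u = period-sameOrbit (^⇒sameOrbit (rotation m) (toℕ u) (rotation-^ u))
  (leastReturn⇒period {ψ = rotation m} {zero} {m} returns minimal)
  where
  returns : rotation m ^ suc m ⟨$⟩ʳ zero ≡ zero
  returns = trans (commute-self (rotation m) m zero) (trans
    (cong (rotation m ⟨$⟩ʳ_) (trans (cong (λ k → rotation m ^ k ⟨$⟩ʳ zero) (sym (toℕ-fromℕ m))) (rotation-^ (fromℕ m))))
    (rotation-fromℕ m))
  minimal : ∀ {k} → rotation m ^ suc k ⟨$⟩ʳ zero ≡ zero → m ≤ k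
  minimal {k} e with m ≤? k
  ... | yes m≤k = m≤k
  ... | no m≰k with trans (sym e) (trans (cong (λ c → rotation m ^ suc c ⟨$⟩ʳ zero) (sym (toℕ-fromℕ< (≰⇒> m≰k)))) (rotation-^ (suc (fromℕ< (≰⇒> m≰k)))))
  ...   | ()

infixr 5 _⊕_
_⊕_ : ∀ {m k} → Permutation′ m → Permutation′ k → Permutation′ (m + k)
σ ⊕ τ = ↔-sym +↔⊎ ↔-∘ ((σ ⊎-↔ τ) ↔-∘ +↔⊎)

module _ {m k} (σ : Permutation′ m) (τ : Permutation′ k) where

  ⊕-^ˡ : ∀ e i → (σ ⊕ τ) ^ e ⟨$⟩ʳ (i ↑ˡ k) ≡ (σ ^ e ⟨$⟩ʳ i) ↑ˡ k
  ⊕-^ˡ zero    i = refl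
  ⊕-^ˡ (suc e) i rewrite splitAt-↑ˡ m i k = ⊕-^ˡ e (σ ⟨$⟩ʳ i)

  ⊕-^ʳ : ∀ e i → (σ ⊕ τ) ^ e ⟨$⟩ʳ (m ↑ʳ i) ≡ m ↑ʳ (τ ^ e ⟨$⟩ʳ i)
  ⊕-^ʳ zero    i = refl
  ⊕-^ʳ (suc e) i rewrite splitAt-↑ʳ m k i = ⊕-^ʳ e (τ ⟨$⟩ʳ i)

  period-⊕ˡ : ∀ {i d} → Period σ i d → Period (σ ⊕ τ) (i ↑ˡ k) d
  period-⊕ˡ {i} {d} p = record
    { returns = trans (⊕-^ˡ d i) (cong (_↑ˡ k) (Period.returns p))
    ; minimal = λ {e} r → Period.minimal p {e} (↑ˡ-injective k _ _ (trans (sym (⊕-^ˡ e i)) r))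
    }
    where instance _ = Period.period≢0 p

  period-⊕ʳ : ∀ {i d} → Period τ i d → Period (σ ⊕ τ) (m ↑ʳ i) d
  period-⊕ʳ {i} {d} p = record
    { returns = trans (⊕-^ʳ d i) (cong (m ↑ʳ_) (Period.returns p))
    ; minimal = λ {e} r → Period.minimal p {e} (↑ʳ-injective m _ _ (trans (sym (⊕-^ʳ e i)) r))
    }
    where instance _ = Period.period≢0 p

tabulate-+ : ∀ {A : Set} m {k} (f : Fin (m + k) → A) → tabulate f ≡ tabulate (f ∘ (_↑ˡ k)) ++ tabulate (f ∘ (m ↑ʳ_))
tabulate-+ zero    f = refl
tabulate-+ (suc m) f = cong (f zero ∷_) (tabulate-+ m (f ∘ suc))

tabulate-const : ∀ {A : Set} m {f : Fin m → A} {c} → (∀ i → f i ≡ c) → tabulate f ≡ replicate m c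
tabulate-const zero    h = refl
tabulate-const (suc m) h = cong₂ _∷_ (h zero) (tabulate-const m (h ∘ suc))

-- One rotation per part, on consecutive blocks of points; listed in the order of the points, the
-- sizes agree with the expansion without reordering.
realizeOrbitSizes : ∀ ms → All NonZero ms → ∃[ ψ ] tabulate (orbitSize {sum ms} ψ) ≡ expand ms
realizeOrbitSizes [] [] = Perm.id , refl
realizeOrbitSizes (suc m ∷ ms) (_ ∷ ms≢0) with realizeOrbitSizes ms ms≢0
... | ψ , e = rotation m ⊕ ψ , trans (tabulate-+ (suc m) (orbitSize (rotation m ⊕ ψ)))
  (cong₂ _++_
    (tabulate-const (suc m) λ i → orbitSize≡period (period-⊕ˡ (rotation m) ψ (period-rotation i)))
    (trans (tabulate-cong λ i → orbitSize≡period (period-⊕ʳ (rotation m) ψ (period-orbitSize ψ i))) e))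

-- Every vertex of `P₀𝒯 n` can thus be handled as the type of a permutation, which lets facts about
-- the group settle the graph of partitions.
realize : ∀ {n} (T : Partition n) → ∃[ ψ ] type ψ ≈ᵖ T
realize {n} T = bySum (sum≡n T) (realizeOrbitSizes (parts T) (positive T))
  where
  bySum : ∀ {m} → m ≡ n → ∃[ ψ ] tabulate (orbitSize {m} ψ) ≡ expand (parts T) → ∃[ ψ ] type ψ ≈ᵖ T
  bySum refl (ψ , e) = ψ , type≈ ψ T (↭.↭-reflexive (trans (map-tabulate id (orbitSize ψ)) e))

-- Subgroups of order p

-- A factorial-base code: an element of `Fin (suc m * m !)` is the image of 0 together with the code
-- of the permutation that remains when 0 is removed.
permutationOf : ∀ m → Fin (m !) → Permutation′ m
permutationOf zero    _ = Perm.id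
permutationOf (suc m) i = insert zero (proj₁ (remQuot {suc m} (m !) i)) (permutationOf m (proj₂ (remQuot {suc m} (m !) i)))

insert-zero-cancel : ∀ {m} {j k : Fin (suc m)} {σ τ : Permutation′ m} → insert zero j σ Perm.≈ insert zero k τ →
                     j ≡ k × σ Perm.≈ τ
insert-zero-cancel {j = j} {k} {σ} {τ} e with e zero
... | refl = refl , λ i → punchIn-injective j _ _
  (trans (sym (Perm.insert-punchIn zero j σ i)) (trans (e (suc i)) (Perm.insert-punchIn zero j τ i)))

insert-zero-cong : ∀ {m} (j : Fin (suc m)) (σ τ : Permutation′ m) → σ Perm.≈ τ → insert zero j σ Perm.≈ insert zero j τ
insert-zero-cong j σ τ e zero    = refl
insert-zero-cong j σ τ e (suc i) = trans (Perm.insert-punchIn zero j σ i)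
  (trans (cong (punchIn j) (e i)) (sym (Perm.insert-punchIn zero j τ i)))

permutationOf-injective : ∀ m {i j} → permutationOf m i Perm.≈ permutationOf m j → i ≡ j
permutationOf-injective zero    {zero} {zero} _ = refl
permutationOf-injective (suc m) {i} {j} e = trans (sym (combine-remQuot {suc m} (m !) i)) (trans
  (cong₂ combine (proj₁ cancelled) (permutationOf-injective m (proj₂ cancelled)))
  (combine-remQuot {suc m} (m !) j))
  where
  cancelled = insert-zero-cancel {σ = permutationOf m (proj₂ (remQuot {suc m} (m !) i))}
    {permutationOf m (proj₂ (remQuot {suc m} (m !) j))} e

permutationOf-surjective : ∀ m (π : Permutation′ m) → ∃[ i ] permutationOf m i Perm.≈ π
permutationOf-surjective zero    π = zero , λ ()
permutationOf-surjective (suc m) π with permutationOf-surjective m (remove zero π)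
... | i , e = combine j i , λ u → trans
    (cong (λ (c , d) → insert zero c (permutationOf m d) ⟨$⟩ʳ u) (remQuot-combine {suc m} {m !} j i))
    (trans (insert-zero-cong j (permutationOf m i) (remove zero π) e u) (Perm.insert-remove zero π u))
  where j = π ⟨$⟩ʳ zero

-- One generator for each subgroup generated by a p-cycle, without repetition; so `N` is the number
-- of components apart from the main one in the two power graphs of the group.
record Enumeration (n p N : ℕ) : Set where
  field
    cycle            : Fin N → Permutation′ n
    cycle-isPCycle   : ∀ i → IsPCycle p (cycle i)
    cycle-injective  : ∀ {i j} → cycle i ∼ cycle j → i ≡ j
    cycle-surjective : ∀ ψ → IsPCycle p ψ → ∃[ i ] cycle i ∼ ψ

-- Each subgroup of order p of S_p has a unique generator c with c(0) = 1, and c is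
-- determined by the enumeration k ↦ cᵏ(0) of all points, which starts with 0, 1.
module OnAllPoints (q : ℕ) (pr : Prime (suc (suc q))) (7≤p : 7 ≤ suc (suc q)) where

  private
    p : ℕ
    p = suc (suc q)
    ρ : Permutation′ p
    ρ = rotation (suc q)



  open PCycles {p} pr 7≤p (n≤1+n p)
  open LargePrime pr 7≤p using (∣p⇒1⊎p)

  points : Permutation′ q → Permutation′ p
  points π = lift₀ (lift₀ π)

  -- The cycle that runs through σ(0), σ(1), ..., σ(p - 1) in this order.
  cycleThrough : Permutation′ p → Permutation′ p
  cycleThrough σ = flip σ ∘ₚ ρ ∘ₚ σ

  cycleThrough-^ : ∀ σ k i → cycleThrough σ ^ k ⟨$⟩ʳ (σ ⟨$⟩ʳ i) ≡ σ ⟨$⟩ʳ (ρ ^ k ⟨$⟩ʳ i)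
  cycleThrough-^ σ zero    i = refl
  cycleThrough-^ σ (suc k) i = trans (cong (λ j → cycleThrough σ ^ k ⟨$⟩ʳ (σ ⟨$⟩ʳ (ρ ⟨$⟩ʳ j))) (Perm.inverseˡ σ))
    (cycleThrough-^ σ k (ρ ⟨$⟩ʳ i))

  period-cycleThrough : ∀ σ i → Period (cycleThrough σ) (σ ⟨$⟩ʳ i) p
  period-cycleThrough σ i = record
    { returns = trans (cycleThrough-^ σ p i) (cong (σ ⟨$⟩ʳ_) (Period.returns (period-rotation i)))
    ; minimal = λ {k} e → Period.minimal (period-rotation i) {k} (⟨$⟩ʳ-injective σ (trans (sym (cycleThrough-^ σ k i)) e))
    }

  period-cycleThrough′ : ∀ σ i → Period (cycleThrough σ) i p
  period-cycleThrough′ σ i = subst (λ j → Period (cycleThrough σ) j p) (Perm.inverseʳ σ) (period-cycleThrough σ (σ ⟨$⟩ˡ i))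

  cycleThrough-moves : ∀ σ i → cycleThrough σ ⟨$⟩ʳ i ≢ i
  cycleThrough-moves σ i e with ∣1⇒≡1 (Period.minimal (period-cycleThrough′ σ i) {1} e)
  ... | ()

  cycleThrough-isPCycle : ∀ σ → IsPCycle p (cycleThrough σ)
  cycleThrough-isPCycle σ = (λ e → cycleThrough-moves σ zero (e zero)) , λ i → Period.returns (period-cycleThrough′ σ i)

  -- Being a power of `d`, the permutation `c` commutes with it, so by transitivity of `d` its value
  -- at 0 determines it everywhere.
  sameCycle : ∀ {c d : Permutation′ p} → (∀ i → SameOrbit d zero i) → c ≼ d → c ⟨$⟩ʳ zero ≡ d ⟨$⟩ʳ zero → c Perm.≈ d
  sameCycle {c} {d} transitive (k , c≡) e i with sameOrbit⇒^ d (transitive i)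
  ... | m , refl = begin
    c ⟨$⟩ʳ (d ^ m ⟨$⟩ʳ zero)         ≡⟨ c≡ _ ⟩
    d ^ k ⟨$⟩ʳ (d ^ m ⟨$⟩ʳ zero)     ≡⟨ ^-+ d m k zero ⟨
    d ^ (m + k) ⟨$⟩ʳ zero            ≡⟨ cong (λ c → d ^ c ⟨$⟩ʳ zero) (+-comm m k) ⟩
    d ^ (k + m) ⟨$⟩ʳ zero            ≡⟨ ^-+ d k m zero ⟩
    d ^ m ⟨$⟩ʳ (d ^ k ⟨$⟩ʳ zero)     ≡⟨ cong (d ^ m ⟨$⟩ʳ_) (trans (sym (c≡ zero)) e) ⟩
    d ^ m ⟨$⟩ʳ (d ⟨$⟩ʳ zero)         ≡⟨ commute-self d m zero ⟩
    d ⟨$⟩ʳ (d ^ m ⟨$⟩ʳ zero)         ∎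
    where open ≡-Reasoning

  transitive : ∀ {ψ : Permutation′ p} {i} → Period ψ i p → ∀ j → SameOrbit ψ i j
  transitive {ψ} {i} q j = decidable-stable (sameOrbit? ψ i j) λ i≁j →
    contradiction (unique⇒length≤ {L = j ∷ orbitList ψ i p} (All.tabulate (λ w∈ j≡w → i≁j (subst (SameOrbit ψ i) (sym j≡w) (∈-orbitList⁻ ψ i p w∈))) ∷ orbitList-unique q))
      (<⇒≱ (≤-reflexive (cong suc (sym (length-orbitList ψ i p)))))

  cycleThrough-injective : ∀ {π π′ : Permutation′ q} → cycleThrough (points π) ∼ cycleThrough (points π′) → π Perm.≈ π′
  cycleThrough-injective {π} {π′} c∼d i = suc-injective (suc-injective (begin
    points π ⟨$⟩ʳ suc (suc i)               ≡⟨ cong (points π ⟨$⟩ʳ_) (rotation-^ (suc (suc i))) ⟨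
    points π ⟨$⟩ʳ (ρ ^ k ⟨$⟩ʳ zero)         ≡⟨ cycleThrough-^ (points π) k zero ⟨
    cycleThrough (points π) ^ k ⟨$⟩ʳ zero   ≡⟨ ^-cong (cycleThrough (points π)) (cycleThrough (points π′)) k c≈d zero ⟩
    cycleThrough (points π′) ^ k ⟨$⟩ʳ zero  ≡⟨ cycleThrough-^ (points π′) k zero ⟩
    points π′ ⟨$⟩ʳ (ρ ^ k ⟨$⟩ʳ zero)        ≡⟨ cong (points π′ ⟨$⟩ʳ_) (rotation-^ (suc (suc i))) ⟩
    points π′ ⟨$⟩ʳ suc (suc i)              ∎))
    where
    open ≡-Reasoning
    k : ℕ
    k = suc (suc (toℕ i))
    c≈d : cycleThrough (points π) Perm.≈ cycleThrough (points π′)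
    -- The closing `refl` holds because both cycles send 0 to 1, whatever π and π′ are.
    c≈d = sameCycle {cycleThrough (points π)} (transitive (period-cycleThrough′ (points π′) zero))
      (∼⇒≼ (cycleThrough (points π)) (cycleThrough (points π′)) c∼d) refl

  module _ {φ : Permutation′ p} (per : Period φ zero p) (φ0≡1 : φ ⟨$⟩ʳ zero ≡ suc zero) where

    private
      to : Fin p → Fin p
      to j = φ ^ toℕ j ⟨$⟩ʳ zero

      reach : ∀ i → ∃[ k ] φ ^ k ⟨$⟩ʳ zero ≡ i
      reach i = sameOrbit⇒^ φ (transitive per i)

      from : Fin p → Fin p
      from i = fromℕ< (m%n<n (proj₁ (reach i)) p)

      to-from : ∀ i → to (from i) ≡ i
      to-from i = trans (cong (λ k → φ ^ k ⟨$⟩ʳ zero) (toℕ-fromℕ< (m%n<n (proj₁ (reach i)) p)))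
        (trans (sym (%-fixed φ p (proj₁ (reach i)) (Period.returns per))) (proj₂ (reach i)))

      σ : Permutation′ p
      σ = permutation to from to-from λ j → orbit-injective per (to-from (to j))

      τ : Permutation′ (suc q)
      τ = remove zero σ

      lift-τ : lift₀ τ Perm.≈ σ
      lift-τ = Perm.lift₀-remove σ refl

      τ0≡0 : τ ⟨$⟩ʳ zero ≡ zero
      τ0≡0 = suc-injective (trans (lift-τ (suc zero)) φ0≡1)

      π : Permutation′ q
      π = remove zero τ

      points-π : points π Perm.≈ σ
      points-π i = trans (Perm.lift₀-cong (lift₀ π) τ (Perm.lift₀-remove τ τ0≡0) i) (lift-τ i)

      -- σ lists the points along φ, so a step in the list is an application of φ; from the last
      -- place back to the first it reads φᵖ(0) = 0.
      σ-ρ : ∀ j → σ ⟨$⟩ʳ (ρ ⟨$⟩ʳ j) ≡ φ ⟨$⟩ʳ (σ ⟨$⟩ʳ j)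
      σ-ρ j with Top.view j
      ... | Top.‵fromℕ     = sym (trans (cong (λ k → φ ⟨$⟩ʳ (φ ^ k ⟨$⟩ʳ zero)) (toℕ-fromℕ (suc q)))
                               (trans (sym (commute-self φ (suc q) zero)) (Period.returns per)))
      ... | Top.‵inject₁ j = trans (commute-self φ (toℕ j) zero) (cong (λ k → φ ⟨$⟩ʳ (φ ^ k ⟨$⟩ʳ zero)) (sym (toℕ-inject₁ j)))

    -- Stated for all π′ that agree with π pointwise, because a code of π is found only up to
    -- pointwise equality.
    parametrize : ∃[ π ] ∀ π′ → π′ Perm.≈ π → cycleThrough (points π′) Perm.≈ φ
    parametrize = π , λ π′ e i → byPoint π′ e i (points π′ ⟨$⟩ˡ i) (Perm.inverseʳ (points π′))
      where
      open ≡-Reasoning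
      byPoint : ∀ π′ → π′ Perm.≈ π → ∀ i j → points π′ ⟨$⟩ʳ j ≡ i → cycleThrough (points π′) ⟨$⟩ʳ i ≡ φ ⟨$⟩ʳ i
      byPoint π′ e i j refl = begin
        cycleThrough (points π′) ⟨$⟩ʳ (points π′ ⟨$⟩ʳ j)  ≡⟨ cycleThrough-^ (points π′) 1 j ⟩
        points π′ ⟨$⟩ʳ (ρ ⟨$⟩ʳ j)                         ≡⟨ points≈σ (ρ ⟨$⟩ʳ j) ⟩
        σ ⟨$⟩ʳ (ρ ⟨$⟩ʳ j)                                 ≡⟨ σ-ρ j ⟩
        φ ⟨$⟩ʳ (σ ⟨$⟩ʳ j)                                 ≡⟨ cong (φ ⟨$⟩ʳ_) (points≈σ j) ⟨
        φ ⟨$⟩ʳ (points π′ ⟨$⟩ʳ j)                         ∎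
        where
        points≈σ : points π′ Perm.≈ σ
        points≈σ u = trans (Perm.lift₀-cong (lift₀ π′) (lift₀ π) (Perm.lift₀-cong π′ π e) u) (points-π u)

  module _ {ψ : Permutation′ p} (pc : IsPCycle p ψ) where

    transitive-pCycle : ∀ {i} → ψ ⟨$⟩ʳ i ≢ i → ∀ j → SameOrbit ψ i j
    transitive-pCycle {i} ψi≢i = transitive (subst (Period ψ i) (period-p (proj₂ pc) ψi≢i (period-orbitSize ψ i)) (period-orbitSize ψ i))

    generator : ∃[ i ] ψ ⟨$⟩ʳ i ≢ i → ∃[ k ] ψ ^ k ⟨$⟩ʳ zero ≡ suc zero
    generator (i , ψi≢i) = sameOrbit⇒^ ψ (E.trans (E.sym (transitive-pCycle ψi≢i zero)) (transitive-pCycle ψi≢i (suc zero)))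
      where module E = IsEquivalence (sameOrbit-isEquivalence ψ)

    parametrizePower : ∃[ k ] ψ ^ k ⟨$⟩ʳ zero ≡ suc zero →
                       ∃[ φ ] φ ∼ ψ × ∃[ π ] ∀ π′ → π′ Perm.≈ π → cycleThrough (points π′) Perm.≈ φ
    parametrizePower (k , φ0≡1) = φ , ≼∧≽⇒∼ (power≼ ψ k) (power-of-pCycle (power≼ ψ k) φ≉id (proj₂ pc)) , parametrize per φ0≡1
      where
      φ : Permutation′ p
      φ = ψ ^ k
      φ0≢0 : φ ⟨$⟩ʳ zero ≢ zero
      φ0≢0 e with trans (sym e) φ0≡1
      ... | ()
      φ≉id : ¬ φ Perm.≈ Perm.id
      φ≉id e = φ0≢0 (e zero)
      φ^p : φ ^ p Perm.≈ Perm.id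
      φ^p i = trans (^-* ψ k p i) (^-∣-id ψ {p} (proj₂ pc i) (m∣m*n k))
      per : Period φ zero p
      per = subst (Period φ zero) (period-p φ^p φ0≢0 (period-orbitSize φ zero)) (period-orbitSize φ zero)

    surjective : ∃[ i ] cycleThrough (points (permutationOf q i)) ∼ ψ
    surjective = fromPower (parametrizePower (generator (moved (ψ , proj₁ pc))))
      where
      fromPower : ∃[ φ ] φ ∼ ψ × (∃[ π ] ∀ π′ → π′ Perm.≈ π → cycleThrough (points π′) Perm.≈ φ) →
                  ∃[ i ] cycleThrough (points (permutationOf q i)) ∼ ψ
      fromPower (φ , φ∼ψ , π , param) = fromIndex (permutationOf-surjective q π)
        where
        fromIndex : ∃[ i ] permutationOf q i Perm.≈ π → ∃[ i ] cycleThrough (points (permutationOf q i)) ∼ ψ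
        fromIndex (i , e) = i , ≼∧≽⇒∼ (≼-trans (1 , param (permutationOf q i) e) (∼⇒≼ φ ψ φ∼ψ))
          (≼-trans (∼⇒≼ ψ φ (∼-sym φ ψ φ∼ψ)) (1 , λ u → sym (param (permutationOf q i) e u)))

  enumeration : Enumeration p p (q !)
  enumeration = record
    { cycle            = cycleThrough ∘ points ∘ permutationOf q
    ; cycle-isPCycle   = cycleThrough-isPCycle ∘ points ∘ permutationOf q
    ; cycle-injective  = λ {i} {j} c∼d → permutationOf-injective q {i} {j}
        (cycleThrough-injective {permutationOf q i} {permutationOf q j} c∼d)
    ; cycle-surjective = λ ψ → surjective {ψ}
    }

  cycle-moves : ∀ i u → Enumeration.cycle enumeration i ⟨$⟩ʳ u ≢ u
  cycle-moves i = cycleThrough-moves (points (permutationOf q i))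

-- Adding a fixed point

module _ {m : ℕ} (f : Fin (suc m)) where

  extend : Permutation′ m → Permutation′ (suc m)
  extend = insert f f

  data Position : Fin (suc m) → Set where
    at      : Position f
    outside : ∀ j → Position (punchIn f j)

  position : ∀ u → Position u
  position u with f ≟ᶠ u
  ... | yes refl = at
  ... | no f≢u   = subst Position (punchIn-punchOut f≢u) (outside (punchOut f≢u))

  extend-at : ∀ π → extend π ⟨$⟩ʳ f ≡ f
  extend-at π with f ≟ᶠ f
  ... | yes _  = refl
  ... | no f≢f = contradiction refl f≢f

  extend-outside : ∀ π j → extend π ⟨$⟩ʳ punchIn f j ≡ punchIn f (π ⟨$⟩ʳ j)
  extend-outside π j = Perm.insert-punchIn f f π j

  extend-^-outside : ∀ π k j → extend π ^ k ⟨$⟩ʳ punchIn f j ≡ punchIn f (π ^ k ⟨$⟩ʳ j)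
  extend-^-outside π zero    j = refl
  extend-^-outside π (suc k) j = trans (cong (extend π ^ k ⟨$⟩ʳ_) (extend-outside π j)) (extend-^-outside π k (π ⟨$⟩ʳ j))

  extend-^ : ∀ π k {σ} → σ Perm.≈ π ^ k → extend σ Perm.≈ extend π ^ k
  extend-^ π k {σ} e u with position u
  ... | at        = trans (extend-at σ) (sym (fixed-^ (extend π) k (extend-at π)))
  ... | outside j = trans (extend-outside σ j) (trans (cong (punchIn f) (e j)) (sym (extend-^-outside π k j)))

  extend-^⁻ : ∀ π k {σ} → extend σ Perm.≈ extend π ^ k → σ Perm.≈ π ^ k
  extend-^⁻ π k {σ} e j = punchIn-injective f _ _
    (trans (sym (extend-outside σ j)) (trans (e (punchIn f j)) (extend-^-outside π k j)))

  extend-≼ : ∀ {σ π} → σ ≼ π → extend σ ≼ extend π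
  extend-≼ {σ} {π} (k , e) = k , extend-^ π k {σ} e

  extend-≼⁻ : ∀ {σ π} → extend σ ≼ extend π → σ ≼ π
  extend-≼⁻ {σ} {π} (k , e) = k , extend-^⁻ π k {σ} e

  extend-∼⁻ : ∀ σ π → extend σ ∼ extend π → σ ∼ π
  extend-∼⁻ σ π e = ≼∧≽⇒∼ (extend-≼⁻ (∼⇒≼ (extend σ) (extend π) e))
    (extend-≼⁻ (∼⇒≼ (extend π) (extend σ) (∼-sym (extend σ) (extend π) e)))

  extend-isPCycle : ∀ {p σ} → IsPCycle p σ → IsPCycle p (extend σ)
  extend-isPCycle {p} {σ} (σ≉id , σ^p) =
    (λ e → σ≉id λ j → punchIn-injective f _ _ (trans (sym (extend-outside σ j)) (e (punchIn f j)))) ,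
    λ u → trans (sym (extend-^ σ p {Perm.id} (λ j → sym (σ^p j)) u)) (extend-id u)
    where
    extend-id : extend Perm.id Perm.≈ Perm.id
    extend-id u with position u
    ... | at        = extend-at Perm.id
    ... | outside j = extend-outside Perm.id j

  extend-remove : ∀ (ψ : Permutation′ (suc m)) → ψ ⟨$⟩ʳ f ≡ f → extend (remove f ψ) Perm.≈ ψ
  extend-remove ψ e u = trans (cong (λ j → insert f j (remove f ψ) ⟨$⟩ʳ u) (sym e)) (Perm.insert-remove f ψ u)

  remove-isPCycle : ∀ {p} (ψ : Permutation′ (suc m)) → ψ ⟨$⟩ʳ f ≡ f → IsPCycle p ψ → IsPCycle p (remove f ψ)
  remove-isPCycle {p} ψ e (ψ≉id , ψ^p) =
    (λ π≈id → ψ≉id λ u → trans (sym (extend-remove ψ e u)) (extend-^ (remove f ψ) 0 {remove f ψ} π≈id u)) ,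
    λ j → punchIn-injective f _ _ (begin
      punchIn f (remove f ψ ^ p ⟨$⟩ʳ j)           ≡⟨ extend-^-outside (remove f ψ) p j ⟨
      extend (remove f ψ) ^ p ⟨$⟩ʳ punchIn f j    ≡⟨ ^-cong (extend (remove f ψ)) ψ p (extend-remove ψ e) (punchIn f j) ⟩
      ψ ^ p ⟨$⟩ʳ punchIn f j                      ≡⟨ ψ^p (punchIn f j) ⟩
      punchIn f j                                 ∎)
    where open ≡-Reasoning

  extend-fixed : ∀ σ → (∀ j → σ ⟨$⟩ʳ j ≢ j) → ∀ {u} → extend σ ⟨$⟩ʳ u ≡ u → u ≡ f
  extend-fixed σ moves {u} e with position u
  ... | at        = refl
  ... | outside j = contradiction (punchIn-injective f _ _ (trans (sym (extend-outside σ j)) e)) (moves j)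

-- On p + 1 points a p-cycle fixes exactly one point, so its subgroup amounts to that point and a
-- subgroup on the other p points. By `moves` the added point is the only fixed point of an extended
-- cycle and can be recovered from it.
module WithFixedPoint {p N : ℕ} (pr : Prime p) (7≤p : 7 ≤ p) (enum : Enumeration p p N)
                      (moves : ∀ i u → Enumeration.cycle enum i ⟨$⟩ʳ u ≢ u) where

  open Enumeration enum
  open PCycles {suc p} pr 7≤p ≤-refl

  private
    fixedPoint : Fin (suc p * N) → Fin (suc p)
    fixedPoint i = proj₁ (remQuot {suc p} N i)
    number : Fin (suc p * N) → Fin N
    number i = proj₂ (remQuot {suc p} N i)
    cycle′ : Fin (suc p) → Fin N → Permutation′ (suc p)
    cycle′ f i = extend f (cycle i)

    sameFixedPoint : ∀ f g i j → cycle′ f i ∼ cycle′ g j → f ≡ g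
    sameFixedPoint f g i j c∼d with ∼⇒≼ (cycle′ f i) (cycle′ g j) c∼d
    ... | k , e = sym (extend-fixed f (cycle i) (moves i) (trans (e g) (fixed-^ (cycle′ g j) k (extend-at g (cycle j)))))

    cycle′-injective : ∀ f g i j → cycle′ f i ∼ cycle′ g j → f ≡ g × i ≡ j
    cycle′-injective f g i j c∼d with sameFixedPoint f g i j c∼d
    ... | refl = refl , cycle-injective (extend-∼⁻ f (cycle i) (cycle j) c∼d)

    hasFixedPoint : ∀ (ψ : Permutation′ (suc p)) → IsPCycle p ψ → ∃[ i ] ψ ⟨$⟩ʳ i ≢ i → ∃[ f ] ψ ⟨$⟩ʳ f ≡ f
    hasFixedPoint ψ pc (i , ψi≢i) with fresh (orbitList ψ i p) (s≤s (≤-reflexive (length-orbitList ψ i p)))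
    ... | f , f∉ = f , period-p⇒fixed q (f∉ ∘ ∈-orbitList q)
      where
      q : Period ψ i p
      q = subst (Period ψ i) (period-p (proj₂ pc) ψi≢i (period-orbitSize ψ i)) (period-orbitSize ψ i)

    surjective : ∀ (ψ : Permutation′ (suc p)) → IsPCycle p ψ → ∃[ f ] ψ ⟨$⟩ʳ f ≡ f → ∃[ f ] ∃[ i ] cycle′ f i ∼ ψ
    surjective ψ pc (f , ψf≡f) = extended (cycle-surjective (remove f ψ) (remove-isPCycle f {p} ψ ψf≡f pc))
      where
      extended : ∃[ i ] cycle i ∼ remove f ψ → ∃[ f ] ∃[ i ] cycle′ f i ∼ ψ
      extended (i , c∼π) = f , i , ≼∧≽⇒∼
        (≼-trans (extend-≼ f (∼⇒≼ (cycle i) (remove f ψ) c∼π)) (1 , extend-remove f ψ ψf≡f))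
        (≼-trans {σ = extend f (remove f ψ)} (1 , λ u → sym (extend-remove f ψ ψf≡f u))
          (extend-≼ f (∼⇒≼ (remove f ψ) (cycle i) (∼-sym (cycle i) (remove f ψ) c∼π))))

    atIndex : ∀ ψ → ∃[ f ] ∃[ i ] cycle′ f i ∼ ψ → ∃[ i ] cycle′ (fixedPoint i) (number i) ∼ ψ
    atIndex ψ (f , i , c∼ψ) = combine f i , subst (λ (g , j) → cycle′ g j ∼ ψ) (sym (remQuot-combine {suc p} {N} f i)) c∼ψ

  enumeration : Enumeration (suc p) p (suc p * N)
  enumeration = record
    { cycle            = λ i → cycle′ (fixedPoint i) (number i)
    ; cycle-isPCycle   = λ i → extend-isPCycle (fixedPoint i) {p} {cycle (number i)} (cycle-isPCycle (number i))
    ; cycle-injective  = λ {i} {j} c∼d → recombine i j (cycle′-injective (fixedPoint i) (fixedPoint j) (number i) (number j) c∼d)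
    ; cycle-surjective = λ ψ pc → atIndex ψ (surjective ψ pc (hasFixedPoint ψ pc (moved (ψ , proj₁ pc))))
    }
    where
    recombine : ∀ i j → fixedPoint i ≡ fixedPoint j × number i ≡ number j → i ≡ j
    recombine i j (e , e′) = trans (sym (combine-remQuot {suc p} N i)) (trans (cong₂ combine e e′) (combine-remQuot {suc p} N j))

-- Types and orders along paths

_↭?_ : Decidable (_↭_ {A = ℕ})
[] ↭? []       = yes ↭-refl
[] ↭? (y ∷ ys) = no (¬x∷xs↭[] ∘ ↭-sym)
(x ∷ xs) ↭? ys with _∈?_ _≟ⁿ_ x ys
... | no x∉ = no λ p → x∉ (∈-resp-↭ p (here refl))
... | yes x∈ with ∈-∃++ x∈
...   | ys₁ , ys₂ , refl = map′ (λ p → ↭-trans (↭.prep x p) (↭-sym (shift x ys₁ ys₂)))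
                                (λ p → drop-∷ (↭-trans p (shift x ys₁ ys₂)))
                                (xs ↭? (ys₁ ++ ys₂))

infix 4 _≡ᵗ_
_≡ᵗ_ : Rel (Permutation′ n) 0ℓ
σ ≡ᵗ τ = type σ ≈ᵖ type τ

type-cong : ∀ (σ τ : Permutation′ n) → σ Perm.≈ τ → σ ≡ᵗ τ
type-cong {n} σ τ e = type≈ σ (type τ) (↭-trans (↭.↭-reflexive (map-cong sameSize (allFin n))) (↭-sym (expand-type τ)))
  where
  sameSize : ∀ i → orbitSize σ i ≡ orbitSize τ i
  sameSize i = orbitSize≡period record
    { period≢0 = Period.period≢0 (period-orbitSize τ i)
    ; returns  = trans (^-cong σ τ (orbitSize τ i) e i) (Period.returns (period-orbitSize τ i))
    ; minimal  = λ {k} r → Period.minimal (period-orbitSize τ i) {k} (trans (sym (^-cong σ τ k e i)) r)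
    }

-- A power is the identity exactly when every orbit size divides its exponent, and the type
-- determines which orbit sizes occur. Being the identity, or a p-cycle, is a condition of this
-- kind.
type-exponent : ∀ (σ τ : Permutation′ n) → σ ≡ᵗ τ → ∀ k → τ ^ k Perm.≈ Perm.id → σ ^ k Perm.≈ Perm.id
type-exponent {n} σ τ e k τ^k i = ^-∣-id σ {orbitSize σ i} (Period.returns (period-orbitSize σ i))
  (dividing (∈-resp-↭ sizes (∈-map⁺ (orbitSize σ) (∈-allFin i))))
  where
  sizes : map (orbitSize σ) (allFin n) ↭ map (orbitSize τ) (allFin n)
  sizes = ↭-trans (↭-sym (expand-type σ)) (↭-trans (concatMap-↭ (λ m → replicate m m) e) (expand-type τ))
  dividing : ∀ {m} → m ∈ map (orbitSize τ) (allFin n) → m ∣ k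
  dividing m∈ with ∈-map⁻ (orbitSize τ) m∈
  ... | j , _ , refl = Period.minimal (period-orbitSize τ j) {k} (τ^k j)

type-nonId : ∀ (σ τ : Permutation′ n) → σ ≡ᵗ τ → ¬ σ Perm.≈ Perm.id → ¬ τ Perm.≈ Perm.id
type-nonId σ τ e σ≉id τ≈id = σ≉id (type-exponent σ τ e 1 τ≈id)

type-id : type (Perm.id {n}) ≈ᵖ [1^ n ]
type-id {n} = type≈ Perm.id [1^ n ] (↭.↭-reflexive (trans (map-tabulate id (orbitSize (Perm.id {n})))
  (trans (tabulate-const n λ i → orbitSize≡period (period i)) (sym (expand-ones n)))))
  where
  period : ∀ i → Period (Perm.id {n}) i 1
  period i = record { returns = refl ; minimal = λ {k} _ → 1∣ k }
  expand-ones : ∀ m → expand (replicate m 1) ≡ replicate m 1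
  expand-ones zero    = refl
  expand-ones (suc m) = cong (1 ∷_) (expand-ones m)

≼⇒isPowerOfᵖ : ∀ {σ τ : Permutation′ n} → σ ≼ τ → IsPowerOfᵖ (type σ) (type τ)
≼⇒isPowerOfᵖ {σ = σ} {τ} σ≼τ = fromPositive (≼⇒positivePower σ≼τ)
  where
  fromPositive : IsPositivePowerOf (Sym _) σ τ → IsPowerOfᵖ (type σ) (type τ)
  fromPositive (k , k≢0 , e) = k , k≢0 , ↭-trans (type-cong σ (τ ^ k) e) (type-^ k {{k≢0}} τ)

-- The exponent between the partitions is applied to τ; σ itself may be no power of τ, it only
-- shares its type with one.
isPowerOfᵖ⇒≡ᵗ : ∀ (S T : Partition n) (σ τ : Permutation′ n) → S ≈ᵖ type σ → T ≈ᵖ type τ →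
                IsPowerOfᵖ S T → ∃[ k ] σ ≡ᵗ τ ^ k
isPowerOfᵖ⇒≡ᵗ S T σ τ S≈ T≈ (a , a≢0 , e) = a , ↭-trans (↭-sym S≈) (↭-trans e
  (↭-trans (concatMap-↭ (powerOfPart a {{a≢0}}) T≈) (↭-sym (type-^ a {{a≢0}} τ))))

order-unique : ∀ (ψ : Permutation′ n) {m k} → IsOrder (Sym n) ψ m → IsOrder (Sym n) ψ k → m ≡ k
order-unique ψ {m} {k} om@(_ , ψ^m , _) ok@(_ , ψ^k , _) = ∣-antisym (order-minimal ψ {k = k} om ψ^k) (order-minimal ψ {k = m} ok ψ^m)

order-id : ∀ (ψ : Permutation′ n) {m} → IsOrder (Sym n) ψ m → ψ Perm.≈ Perm.id → m ≡ 1
order-id ψ om e = ∣1⇒≡1 (order-minimal ψ {k = 1} om e)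

order-1 : ∀ (ψ : Permutation′ n) → IsOrder (Sym n) ψ 1 → ψ Perm.≈ Perm.id
order-1 ψ (_ , e , _) = e

orderVertex : Vertex (P₀ (Sym n)) → Vertex (O₀ (Sym n))
orderVertex (ψ , ψ≉id) = proj₁ (order ψ) ,
  (λ e → ψ≉id (order-1 ψ (subst (IsOrder (Sym _) ψ) e (proj₂ (order ψ))))) , ψ , proj₂ (order ψ)

≼-exponent : ∀ {σ τ : Permutation′ n} → σ ≼ τ → ∀ k → τ ^ k Perm.≈ Perm.id → σ ^ k Perm.≈ Perm.id
≼-exponent {σ = σ} {τ} (a , e) k τ^k i = trans (^-cong σ (τ ^ a) k e i) (trans (^-* τ a k i) (^-∣-id τ {k} (τ^k i) (m∣m*n a)))

≼⇒order∣ : ∀ {σ τ : Permutation′ n} {m k} → σ ≼ τ → IsOrder (Sym n) σ m → IsOrder (Sym n) τ k → m ∣ k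
≼⇒order∣ {σ = σ} {k = k} σ≼τ om (_ , τ^k , _) = order-minimal σ {k = k} om (≼-exponent σ≼τ k τ^k)

-- The source of paths in the other three graphs: only `_≼_` has to be respected, as every step in
-- the quotient graph joins comparable permutations.
⇝-map : ∀ (Γ : Graph) (f : Vertex (P₀ (Sym n)) → Vertex Γ) →
  (∀ {u v} → proj₁ u ≼ proj₁ v → Connected Γ (f u) (f v)) → ∀ {u v} → u ⇝ v → Connected Γ (f u) (f v)
⇝-map {n} Γ f h {u} u⇝v = connected-closed (P̃₀ (Sym n)) {P = λ w → Connected Γ (f u) (f w)}
  (λ {w} {v} w∼v p → p ◅◅ h {w} {v} (∼⇒≼ (proj₁ w) (proj₁ v) w∼v))
  (λ {w} {v} w~v p → p ◅◅ [ h {w} {v} , (λ v≼w → connected-sym Γ (h {v} {w} v≼w)) ]′ (~⇒comparable {u = w} {v} w~v)) u⇝v nil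

≼⇒connected-P₀ : ∀ {u v : Vertex (P₀ (Sym n))} → proj₁ u ≼ proj₁ v → Connected (P₀ (Sym n)) u v
≼⇒connected-P₀ {u = u , _} {v , _} u≼v with u ≈? v
... | yes u≈v = inj₁ u≈v ◅ nil
... | no u≉v  = inj₂ (u≉v , inj₁ (≼⇒positivePower u≼v)) ◅ nil

connected-P₀⇒⇝ : ∀ {u v : Vertex (P₀ (Sym n))} → Connected (P₀ (Sym n)) u v → u ⇝ v
connected-P₀⇒⇝ {n} {u} u⇝v = connected-closed (P₀ (Sym n)) {P = u ⇝_}
  (λ {w} {v} w≈v p → p ◅◅ ≼⇒⇝ {u = w} {v} (1 , w≈v))
  (λ { {w} {v} (_ , inj₁ w≼v) p → p ◅◅ ≼⇒⇝ {u = w} {v} (positivePower⇒≼ w≼v)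
     ; {w} {v} (_ , inj₂ v≼w) p → p ◅◅ ⇝-sym {u = v} {w} (≼⇒⇝ {u = v} {w} (positivePower⇒≼ v≼w)) }) u⇝v nil

⇝⇒connected-P₀ : ∀ {u v : Vertex (P₀ (Sym n))} → u ⇝ v → Connected (P₀ (Sym n)) u v
⇝⇒connected-P₀ {n} {u} {v} = ⇝-map (P₀ (Sym n)) id (λ {w} {x} → ≼⇒connected-P₀ {u = w} {x}) {u} {v}

⇝⇒connected-𝒯 : ∀ {u v : Vertex (P₀ (Sym n))} → u ⇝ v → Connected (P₀𝒯 n) (typeVertex u) (typeVertex v)
⇝⇒connected-𝒯 {n} {u} {v} = ⇝-map (P₀𝒯 n) typeVertex (λ {w} {x} → step {w} {x}) {u} {v}
  where
  step : ∀ {u v : Vertex (P₀ (Sym n))} → proj₁ u ≼ proj₁ v → Connected (P₀𝒯 n) (typeVertex u) (typeVertex v)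
  step {u , _} {v , _} u≼v = byEquality (parts (type u) ↭? parts (type v))
    where
    byEquality : Dec (u ≡ᵗ v) → _
    byEquality (yes e) = inj₁ e ◅ nil
    byEquality (no ne) = inj₂ (ne , inj₁ (≼⇒isPowerOfᵖ u≼v)) ◅ nil

⇝⇒connected-O₀ : ∀ {u v : Vertex (P₀ (Sym n))} → u ⇝ v → Connected (O₀ (Sym n)) (orderVertex u) (orderVertex v)
⇝⇒connected-O₀ {n} {u} {v} = ⇝-map (O₀ (Sym n)) orderVertex (λ {w} {x} → step {w} {x}) {u} {v}
  where
  step : ∀ {u v : Vertex (P₀ (Sym n))} → proj₁ u ≼ proj₁ v → Connected (O₀ (Sym n)) (orderVertex u) (orderVertex v)
  step {u , _} {v , _} u≼v = byEquality (proj₁ (order u) ≟ⁿ proj₁ (order v))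
    where
    byEquality : Dec (proj₁ (order u) ≡ proj₁ (order v)) → _
    byEquality (yes e) = inj₁ e ◅ nil
    byEquality (no ne) = inj₂ (ne , inj₁ (≼⇒order∣ u≼v (proj₂ (order u)) (proj₂ (order v)))) ◅ nil

exponents-2-3 : ∀ (ψ : Permutation′ n) → ψ ^ 2 Perm.≈ Perm.id → ψ ^ 3 Perm.≈ Perm.id → ψ Perm.≈ Perm.id
exponents-2-3 ψ ψ² ψ³ i = trans (sym (ψ² (ψ ⟨$⟩ʳ i))) (ψ³ i)

-- The components of the four graphs

-- Covers n = p and n = p + 1 together. The index `i₀` supplies a p-cycle for the exceptional vertex
-- among types and among orders, and `exceptional` is the literal form [p] or [1, p] of its type.
module Components {n p N : ℕ} (8≤n : 8 ≤ n) (pr : Prime p) (7≤p : 7 ≤ p) (n≡ : n ≡ p ⊎ n ≡ suc p) (n≤1+p : n ≤ suc p)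
                  (2≤n : 2 ≤ n) (enum : Enumeration n p N) (i₀ : Fin N)
                  (exceptional : List ℕ) (exceptional≡ : replicate (n ∸ p) 1 ++ p ∷ [] ≡ exceptional) where

  open Enumeration enum
  open LargePrime pr 7≤p
  open NearPrime 8≤n pr 7≤p n≡
  open PCycles {n} pr 7≤p n≤1+p

  private
    S : Group 0ℓ 0ℓ
    S = Sym n

  t₁₂ : Vertex (P₀ S)
  t₁₂ = [12] 2≤n

  Δ̃ : Pred (Vertex (P₀ S)) 0ℓ
  Δ̃ = Connected (P̃₀ S) t₁₂

  nonPCycle⇒Δ̃ : ∀ u → ¬ proj₁ u ^ p Perm.≈ Perm.id → Δ̃ u
  nonPCycle⇒Δ̃ = ⇝[12] 2≤n

  Δ̃⇒nonPCycle : ∀ u → Δ̃ u → ¬ proj₁ u ^ p Perm.≈ Perm.id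
  Δ̃⇒nonPCycle = [12]⇝⇒nonPCycle 2≤n

  nonCycle⇒Δ̃ : ∀ (u : Vertex (P₀ S)) → ¬ IsCycle p (proj₁ u) → Δ̃ u
  nonCycle⇒Δ̃ u@(ψ , ψ≉id) ¬cyc = nonPCycle⇒Δ̃ u λ ψ^p → ¬cyc (isPCycle⇒isCycle {ψ} (ψ≉id , ψ^p))

  cycleVertex : Fin N → Vertex (P₀ S)
  cycleVertex i = cycle i , proj₁ (cycle-isPCycle i)

  Cycles : Fin N → Pred (Vertex (P₀ S)) 0ℓ
  Cycles i v = cycle i ∼ proj₁ v

  Cycles⇒isPCycle : ∀ i {v} → Cycles i v → IsPCycle p (proj₁ v)
  Cycles⇒isPCycle i {v , _} c∼v = isPCycle-∼ {cycle i} {v} c∼v (cycle-isPCycle i)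

  Δ̃⊥Cycles : ∀ i v → Δ̃ v → Cycles i v → ⊥
  Δ̃⊥Cycles i v Δv c∼v = Δ̃⇒nonPCycle v Δv (proj₂ (Cycles⇒isPCycle i {v} c∼v))

  Cycles⊥Cycles : ∀ i j v → i ≢ j → Cycles i v → Cycles j v → ⊥
  Cycles⊥Cycles i j (v , _) i≢j c∼v d∼v = i≢j (cycle-injective (∼-trans (cycle i) v (cycle j) c∼v (∼-sym (cycle j) v d∼v)))

  cover : ∀ v → Δ̃ v ⊎ ∃[ i ] Cycles i v
  cover v@(ψ , ψ≉id) = byPower ((ψ ^ p) ≈? Perm.id)
    where
    byPower : Dec (ψ ^ p Perm.≈ Perm.id) → Δ̃ v ⊎ ∃[ i ] Cycles i v
    byPower (no ψ^p)  = inj₁ (nonPCycle⇒Δ̃ v ψ^p)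
    byPower (yes ψ^p) = inj₂ (cycle-surjective ψ (ψ≉id , ψ^p))

  -- Two vertices of the main component with orders 2 and 3. Neither they, nor their types, nor
  -- their orders are comparable, which refutes completeness in all four graphs.
  record CoprimePair : Set where
    field
      σ τ  : Vertex (P₀ S)
      Δ̃-σ  : Δ̃ σ
      Δ̃-τ  : Δ̃ τ
      σ²   : proj₁ σ ^ 2 Perm.≈ Perm.id
      τ³   : proj₁ τ ^ 3 Perm.≈ Perm.id

    σ³≉id : ¬ proj₁ σ ^ 3 Perm.≈ Perm.id
    σ³≉id σ³ = proj₂ σ (exponents-2-3 (proj₁ σ) σ² σ³)

    τ²≉id : ¬ proj₁ τ ^ 2 Perm.≈ Perm.id
    τ²≉id τ² = proj₂ τ (exponents-2-3 (proj₁ τ) τ² τ³)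

  abstract
    coprimePair : CoprimePair
    coprimePair with fresh {n} [] (≤-trans (m≤m+n 1 7) 8≤n)
    ... | a , _ with fresh (a ∷ []) (≤-trans (m≤m+n 2 6) 8≤n)
    ... | b , b∉ with fresh (a ∷ b ∷ []) (≤-trans (m≤m+n 3 5) 8≤n)
    ... | e , e∉ with fresh (e ∷ a ∷ b ∷ []) (≤-trans (m≤m+n 4 4) 8≤n)
    ... | f , f∉ with fresh (f ∷ e ∷ a ∷ b ∷ []) (≤-trans (m≤m+n 5 3) 8≤n)
    ... | g , g∉ = record
      { σ = σ ; τ = τ ; Δ̃-σ = Δ̃-σ
      ; Δ̃-τ = Δ̃-σ ◅◅ ⇝-sym {u = τ} {σ} (transposition-⇝-cycle₃ a≢b f≢e g≢e g≢f e∉ (f∉ ∘ there) (g∉ ∘ there ∘ there))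
      ; σ² = transpose-involutive a b
      ; τ³ = cycle₃-cubed f≢e g≢e g≢f
      }
      where
      a≢b : a ≢ b
      a≢b = b∉ ∘ here ∘ sym
      f≢e : f ≢ e
      f≢e = f∉ ∘ here
      g≢e : g ≢ e
      g≢e = g∉ ∘ there ∘ here
      g≢f : g ≢ f
      g≢f = g∉ ∘ here
      σ τ : Vertex (P₀ S)
      σ = transposition a≢b
      τ = cycle₃-vertex f≢e g≢e g≢f
      Δ̃-σ : Δ̃ σ
      Δ̃-σ = ⇝-sym {u = σ} {t₁₂} (transposition⇝[12] 2≤n (≤-trans (n≤1+n 7) 8≤n) a≢b)

  open CoprimePair coprimePair

  σ⋠τ : ¬ proj₁ σ ≼ proj₁ τ
  σ⋠τ σ≼τ = σ³≉id (≼-exponent σ≼τ 3 τ³)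

  τ⋠σ : ¬ proj₁ τ ≼ proj₁ σ
  τ⋠σ τ≼σ = τ²≉id (≼-exponent τ≼σ 2 σ²)

  P̃₀-consistsOf : ConsistsOf (P̃₀ S) Δ̃ N (λ D → ∃[ u ] Isolated (P̃₀ S) u × D ≐ Graph._≈_ (P̃₀ S) u)
  P̃₀-consistsOf = record
    { main-isComponent    = t₁₂ , id , id
    ; further             = Cycles
    ; further-isComponent = λ i → isolated-isComponent (P̃₀ S) {cycleVertex i} (isolated i)
    ; further-satisfies   = λ i → cycleVertex i , isolated i , id , id
    ; main⊥further        = λ { i {v} (Δv , c∼v) → Δ̃⊥Cycles i v Δv c∼v }
    ; further⊥further     = λ { i j i≢j {v} (c∼v , d∼v) → Cycles⊥Cycles i j v i≢j c∼v d∼v }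
    ; cover               = cover
    }
    where
    isolated : ∀ i → Isolated (P̃₀ S) (cycleVertex i)
    isolated i = pCycle-isolated (cycleVertex i) (cycle-isPCycle i)

  P̃₀-main-notComplete : ¬ IsComplete (induced (P̃₀ S) Δ̃)
  P̃₀-main-notComplete complete = [ σ⋠τ , τ⋠σ ]′ (~⇒comparable {u = σ} {τ}
    (complete (σ , Δ̃-σ) (τ , Δ̃-τ) λ σ∼τ → σ⋠τ (∼⇒≼ (proj₁ σ) (proj₁ τ) σ∼τ)))

  Cycles-size : ∀ i → HasSize (induced (P₀ S) (Cycles i)) (p ∸ 1)
  Cycles-size i = withMoved (moved (cycleVertex i))
    where
    c : Permutation′ n
    c = cycle i
    c^p : c ^ p Perm.≈ Perm.id
    c^p = proj₂ (cycle-isPCycle i)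
    withMoved : ∃[ j ] c ⟨$⟩ʳ j ≢ j → HasSize (induced (P₀ S) (Cycles i)) (p ∸ 1)
    withMoved (j , cj≢j) = record
      { to        = element
      ; cong      = λ { refl _ → refl }
      ; bijective = injective , λ { ((v , v≉id) , c∼v) → surjective v v≉id (∼⇒≼ v c (∼-sym c v c∼v)) }
      }
      where
      q : Period c j p
      q = subst (Period c j) (period-p c^p cj≢j (period-orbitSize c j)) (period-orbitSize c j)
      1+k<p : ∀ (k : Fin (p ∸ 1)) → suc (toℕ k) < p
      1+k<p k = ≤-trans (s≤s (toℕ<n k)) (≤-reflexive (suc-pred p))
      nonId : ∀ k → ¬ c ^ suc (toℕ k) Perm.≈ Perm.id
      nonId k e = contradiction (∣⇒≤ (Period.minimal q {suc (toℕ k)} (e j))) (<⇒≱ (1+k<p k))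
      -- The exponent is shifted by one, because c⁰ is the identity and not a vertex.
      element : Fin (p ∸ 1) → Vertex (induced (P₀ S) (Cycles i))
      element k = (c ^ suc (toℕ k) , nonId k) ,
        ≼∧≽⇒∼ (power-of-pCycle (power≼ c (suc (toℕ k))) (nonId k) c^p) (power≼ c (suc (toℕ k)))
      injective : ∀ {k l} → c ^ suc (toℕ k) Perm.≈ c ^ suc (toℕ l) → k ≡ l
      injective {k} {l} e = toℕ-injective (cong pred (begin
        suc (toℕ k)                ≡⟨ toℕ-fromℕ< (1+k<p k) ⟨
        toℕ (fromℕ< (1+k<p k))     ≡⟨ cong toℕ (orbit-injective q (trans (exponent k) (trans (e j) (sym (exponent l))))) ⟩
        toℕ (fromℕ< (1+k<p l))     ≡⟨ toℕ-fromℕ< (1+k<p l) ⟩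
        suc (toℕ l)                ∎))
        where
        open ≡-Reasoning
        exponent : ∀ k → c ^ toℕ (fromℕ< (1+k<p k)) ⟨$⟩ʳ j ≡ c ^ suc (toℕ k) ⟨$⟩ʳ j
        exponent k = cong (λ m → c ^ m ⟨$⟩ʳ j) (toℕ-fromℕ< (1+k<p k))
      surjective : ∀ v → ¬ v Perm.≈ Perm.id → v ≼ c →
                   ∃[ k ] (∀ {l} → l ≡ k → c ^ suc (toℕ l) Perm.≈ v)
      surjective v v≉id (m , e) = fromRemainder (m % p) refl
        where
        v≈ : ∀ {r} → m % p ≡ r → v Perm.≈ c ^ r
        v≈ refl u = trans (e u) (%-fixed c p m (c^p u))
        fromRemainder : ∀ r → m % p ≡ r → ∃[ k ] (∀ {l} → l ≡ k → c ^ suc (toℕ l) Perm.≈ v)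
        fromRemainder zero    eq = contradiction (v≈ eq) v≉id
        fromRemainder (suc r) eq = fromℕ< r<p-1 , λ { refl u → trans
            (cong (λ m → c ^ suc m ⟨$⟩ʳ u) (toℕ-fromℕ< r<p-1)) (sym (v≈ eq u)) }
          where
          r<p-1 : r < p ∸ 1
          r<p-1 = ≤-pred (≤-trans (s≤s (≤-reflexive (sym eq))) (≤-trans (m%n<n m p) (≤-reflexive (sym (suc-pred p)))))

  Cycles-complete : ∀ i → IsComplete (induced (P₀ S) (Cycles i))
  Cycles-complete i ((u , _) , c∼u) ((v , _) , c∼v) u≉v = u≉v ,
    inj₁ (≼⇒positivePower (∼⇒≼ u v (∼-trans u (cycle i) v (∼-sym (cycle i) u c∼u) c∼v)))

  P₀-consistsOf : ConsistsOf (P₀ S) Δ̃ N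
    (λ D → (∀ ψ → D ψ → IsCycle p (proj₁ ψ)) × HasSize (induced (P₀ S) D) (p ∸ 1) × IsComplete (induced (P₀ S) D))
  P₀-consistsOf = record
    { main-isComponent    = t₁₂ , (λ {v} → ⇝⇒connected-P₀ {u = t₁₂} {v}) , (λ {v} → connected-P₀⇒⇝ {u = t₁₂} {v})
    ; further             = Cycles
    ; further-isComponent = λ i → cycleVertex i ,
        (λ {v} c∼v → ≼⇒connected-P₀ {u = cycleVertex i} {v} (∼⇒≼ (cycle i) (proj₁ v) c∼v)) ,
        (λ {v} c⇝v → pCycle-⇝ {cycleVertex i} {v} (cycle-isPCycle i) (connected-P₀⇒⇝ {u = cycleVertex i} {v} c⇝v))
    ; further-satisfies   = λ i → (λ v c∼v → isPCycle⇒isCycle {proj₁ v} (Cycles⇒isPCycle i {v} c∼v)) ,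
        Cycles-size i , Cycles-complete i
    ; main⊥further        = λ { i {v} (Δv , c∼v) → Δ̃⊥Cycles i v Δv c∼v }
    ; further⊥further     = λ { i j i≢j {v} (c∼v , d∼v) → Cycles⊥Cycles i j v i≢j c∼v d∼v }
    ; cover               = cover
    }

  P₀-main-notComplete : ¬ IsComplete (induced (P₀ S) Δ̃)
  P₀-main-notComplete complete = [ σ⋠τ ∘ positivePower⇒≼ , τ⋠σ ∘ positivePower⇒≼ ]′
    (proj₂ (complete (σ , Δ̃-σ) (τ , Δ̃-τ) (λ σ≈τ → σ⋠τ (1 , σ≈τ))))

  c₀ : Vertex (P₀ S)
  c₀ = cycleVertex i₀

  pCycle-type : ∀ {σ τ : Permutation′ n} → IsPCycle p σ → IsPCycle p τ → σ ≡ᵗ τ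
  pCycle-type {σ} {τ} pσ pτ = ↭-trans (isPCycle⇒isCycle {σ} pσ) (↭-sym (isPCycle⇒isCycle {τ} pτ))

  type-isPCycle : ∀ {σ τ : Permutation′ n} → σ ≡ᵗ τ → IsPCycle p σ → IsPCycle p τ
  type-isPCycle {σ} {τ} e (σ≉id , σ^p) = type-nonId σ τ e σ≉id , type-exponent τ σ (↭-sym e) p σ^p

  -- Either a power of τ has the type of σ, so that τ is a root of a p-cycle, or τ has the type of a
  -- power of σ. Both make τ a p-cycle, and all p-cycles have the same type.
  types-comparable : ∀ {σ τ : Permutation′ n} → IsPCycle p σ → ¬ τ Perm.≈ Perm.id →
                     IsPowerOfᵖ (type σ) (type τ) ⊎ IsPowerOfᵖ (type τ) (type σ) → σ ≡ᵗ τ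
  types-comparable {σ} {τ} pσ τ≉id (inj₁ pow) = fromPower (isPowerOfᵖ⇒≡ᵗ (type σ) (type τ) σ τ ↭-refl ↭-refl pow)
    where
    fromPower : ∃[ k ] σ ≡ᵗ τ ^ k → σ ≡ᵗ τ
    fromPower (k , e) = pCycle-type {σ} {τ} pσ (root-of-pCycle (power≼ τ k) (type-isPCycle {σ} {τ ^ k} e pσ))
  types-comparable {σ} {τ} pσ τ≉id (inj₂ pow) = fromPower (isPowerOfᵖ⇒≡ᵗ (type τ) (type σ) τ σ ↭-refl ↭-refl pow)
    where
    fromPower : ∃[ k ] τ ≡ᵗ σ ^ k → σ ≡ᵗ τ
    fromPower (k , e) = pCycle-type {σ} {τ} pσ
      (τ≉id , type-exponent τ (σ ^ k) e p (≼-exponent (power≼ σ k) p (proj₂ pσ)))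

  Realized : Vertex (P₀𝒯 n) → Set
  Realized T = Σ[ u ∈ Vertex (P₀ S) ] proj₁ T ≈ᵖ type (proj₁ u)

  realized : ∀ T → Realized T
  realized (T , T≉1) = fromRealization (realize T)
    where
    fromRealization : ∃[ ψ ] type ψ ≈ᵖ T → Realized (T , T≉1)
    fromRealization (ψ , e) = (ψ , λ ψ≈id → T≉1 (↭-trans (↭-sym e) (↭-trans (type-cong ψ Perm.id ψ≈id) type-id))) , ↭-sym e

  Main𝒯 : Pred (Vertex (P₀𝒯 n)) 0ℓ
  Main𝒯 T = ∃[ ψ ] Δ̃ ψ × proj₁ T ≈ᵖ type (proj₁ ψ)

  main⊎exceptional : ∀ T → Main𝒯 T ⊎ type (proj₁ c₀) ≈ᵖ proj₁ T
  main⊎exceptional T = fromVertex (realized T)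
    where
    fromVertex : Realized T → Main𝒯 T ⊎ type (proj₁ c₀) ≈ᵖ proj₁ T
    fromVertex (u@(ψ , ψ≉id) , e) = byPower ((ψ ^ p) ≈? Perm.id)
      where
      byPower : Dec (ψ ^ p Perm.≈ Perm.id) → Main𝒯 T ⊎ type (proj₁ c₀) ≈ᵖ proj₁ T
      byPower (no ψ^p)  = inj₁ (u , nonPCycle⇒Δ̃ u ψ^p , e)
      byPower (yes ψ^p) = inj₂ (↭-trans (pCycle-type {proj₁ c₀} {ψ} (cycle-isPCycle i₀) (ψ≉id , ψ^p)) (↭-sym e))

  Main𝒯⊥exceptional : ∀ T → Main𝒯 T → type (proj₁ c₀) ≈ᵖ proj₁ T → ⊥
  Main𝒯⊥exceptional T (ψ , Δψ , e) e₀ = Δ̃⇒nonPCycle ψ Δψ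
    (proj₂ (type-isPCycle {proj₁ c₀} {proj₁ ψ} (↭-trans e₀ e) (cycle-isPCycle i₀)))

  exceptional-isolated : Isolated (P₀𝒯 n) (typeVertex c₀)
  exceptional-isolated T (c≉T , comparable) = fromVertex (realized T)
    where
    fromVertex : Realized T → ⊥
    fromVertex ((ψ , ψ≉id) , e) = c≉T (↭-trans (types-comparable {proj₁ c₀} {ψ} (cycle-isPCycle i₀) ψ≉id
        ([ (λ (a , a≢0 , f) → inj₁ (a , a≢0 , ↭-trans f (concatMap-↭ (powerOfPart a {{a≢0}}) e)))
         , (λ (a , a≢0 , f) → inj₂ (a , a≢0 , ↭-trans (↭-sym e) f)) ]′ comparable)) (↭-sym e))

  -- A neighbour that left the main set would be the exceptional vertex, which has no neighbours.
  Main𝒯-closed : ∀ {T U} → Graph._~_ (P₀𝒯 n) T U → Main𝒯 T → Main𝒯 U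
  Main𝒯-closed {T} {U} T~U main = [ id , (λ c≈U → contradiction (Graph.~-sym (P₀𝒯 n) {T} {typeVertex c₀}
      (proj₁ (Graph.~-resp-≈ (P₀𝒯 n)) {T} {U} {typeVertex c₀} (↭-sym c≈U) T~U)) (exceptional-isolated T)) ]′ (main⊎exceptional U)

  P₀𝒯-consistsOf : ConsistsOf (P₀𝒯 n) Main𝒯 1
    (λ D → ∃[ T ] parts (proj₁ T) ↭ exceptional × Isolated (P₀𝒯 n) T × D ≐ Graph._≈_ (P₀𝒯 n) T)
  P₀𝒯-consistsOf = record
    { main-isComponent    = typeVertex t₁₂ ,
        (λ { {T} (ψ , Δψ , e) → ⇝⇒connected-𝒯 {u = t₁₂} {ψ} Δψ ◅◅ (inj₁ (↭-sym e) ◅ nil) }) ,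
        (λ {T} t⇝T → connected-closed (P₀𝒯 n) {Main𝒯} (λ { {T} {U} e (ψ , Δψ , f) → ψ , Δψ , ↭-trans (↭-sym e) f })
          (λ {T} {U} → Main𝒯-closed {T} {U}) t⇝T (t₁₂ , nil , ↭-refl))
    ; further             = λ _ → Graph._≈_ (P₀𝒯 n) (typeVertex c₀)
    ; further-isComponent = λ _ → isolated-isComponent (P₀𝒯 n) {typeVertex c₀} exceptional-isolated
    ; further-satisfies   = λ _ → typeVertex c₀ ,
        subst (type (proj₁ c₀) .parts ↭_) exceptional≡ (isPCycle⇒isCycle {proj₁ c₀} (cycle-isPCycle i₀)) ,
        exceptional-isolated , id , id
    ; main⊥further        = λ { _ {T} (main , e) → Main𝒯⊥exceptional T main e }
    ; further⊥further     = λ { zero zero i≢j _ → i≢j refl }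
    ; cover               = λ T → [ inj₁ , (λ e → inj₂ (zero , e)) ]′ (main⊎exceptional T)
    }

  nonCycle⇒Main𝒯 : ∀ (u : Vertex (P₀ S)) → ¬ IsCycle p (proj₁ u) → Main𝒯 (typeVertex u)
  nonCycle⇒Main𝒯 u ¬cyc = u , nonCycle⇒Δ̃ u ¬cyc , ↭-refl

  P₀𝒯-main-notComplete : ¬ IsComplete (induced (P₀𝒯 n) Main𝒯)
  P₀𝒯-main-notComplete complete = [ σ-notPower , τ-notPower ]′
    (proj₂ (complete (typeVertex σ , σ , Δ̃-σ , ↭-refl) (typeVertex τ , τ , Δ̃-τ , ↭-refl)
      (λ e → σ³≉id (type-exponent (proj₁ σ) (proj₁ τ) e 3 τ³))))
    where
    σ-notPower : ¬ IsPowerOfᵖ (type (proj₁ σ)) (type (proj₁ τ))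
    σ-notPower pow = refute (isPowerOfᵖ⇒≡ᵗ (type (proj₁ σ)) (type (proj₁ τ)) (proj₁ σ) (proj₁ τ) ↭-refl ↭-refl pow)
      where
      refute : ¬ (∃[ k ] proj₁ σ ≡ᵗ proj₁ τ ^ k)
      refute (k , e) = σ³≉id (type-exponent (proj₁ σ) (proj₁ τ ^ k) e 3 (≼-exponent (power≼ (proj₁ τ) k) 3 τ³))
    τ-notPower : ¬ IsPowerOfᵖ (type (proj₁ τ)) (type (proj₁ σ))
    τ-notPower pow = refute (isPowerOfᵖ⇒≡ᵗ (type (proj₁ τ)) (type (proj₁ σ)) (proj₁ τ) (proj₁ σ) ↭-refl ↭-refl pow)
      where
      refute : ¬ (∃[ k ] proj₁ τ ≡ᵗ proj₁ σ ^ k)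
      refute (k , e) = τ²≉id (type-exponent (proj₁ τ) (proj₁ σ ^ k) e 2 (≼-exponent (power≼ (proj₁ σ) k) 2 σ²))

  MainO : Pred (Vertex (O₀ S)) 0ℓ
  MainO m = ∃[ ψ ] Δ̃ ψ × IsOrder S (proj₁ ψ) (proj₁ m)

  pCycle-order : ∀ (ψ : Permutation′ n) {m} → IsPCycle p ψ → IsOrder S ψ m → m ≡ p
  pCycle-order ψ (ψ≉id , ψ^p) om with ∣p⇒1⊎p (order-minimal ψ {k = p} om ψ^p)
  ... | inj₁ refl = contradiction (order-1 ψ om) ψ≉id
  ... | inj₂ m≡p  = m≡p

  order≢p⇒MainO : ∀ (ψ : Vertex (P₀ S)) (m : Vertex (O₀ S)) → IsOrder S (proj₁ ψ) (proj₁ m) → proj₁ m ≢ p → MainO m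
  order≢p⇒MainO u@(ψ , ψ≉id) m om m≢p = u , nonPCycle⇒Δ̃ u (λ ψ^p → m≢p (pCycle-order ψ (ψ≉id , ψ^p) om)) , om

  ≢p⇒MainO : ∀ m → proj₁ m ≢ p → MainO m
  ≢p⇒MainO m@(_ , m≢1 , ψ , om) = order≢p⇒MainO (ψ , λ ψ≈id → m≢1 (order-id ψ om ψ≈id)) m om

  p-order : IsOrder S (proj₁ c₀) p
  p-order = subst (IsOrder S (proj₁ c₀)) (pCycle-order (proj₁ c₀) (cycle-isPCycle i₀) (proj₂ (order (proj₁ c₀)))) (proj₂ (order (proj₁ c₀)))

  pVertex : Vertex (O₀ S)
  pVertex = p , p≢1 , proj₁ c₀ , p-order

  p-isolated : Isolated (O₀ S) pVertex
  p-isolated (m , m≢1 , ψ , om) (p≢m , inj₁ p∣m) = p≢m (sym (pCycle-order ψ ((λ e → m≢1 (order-id ψ om e)) , p∣order⇒^p {ψ} om p∣m) om))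
  p-isolated (m , m≢1 , _) (p≢m , inj₂ m∣p) = [ m≢1 , p≢m ∘ sym ]′ (∣p⇒1⊎p m∣p)

  MainO⇒≢p : ∀ m → MainO m → p ≢ proj₁ m
  MainO⇒≢p m (ψ , Δψ , om) refl = Δ̃⇒nonPCycle ψ Δψ (proj₁ (proj₂ om))

  MainO-closed : ∀ {m k} → Graph._~_ (O₀ S) m k → MainO m → MainO k
  MainO-closed {m} {k} m~k _ = ≢p⇒MainO k λ k≡p → p-isolated m
    (subst (_≢ proj₁ m) k≡p (proj₁ m~k ∘ sym) , ⊎-swap (subst (λ j → proj₁ m ∣ j ⊎ j ∣ proj₁ m) k≡p (proj₂ m~k)))

  O₀-consistsOf : ConsistsOf (O₀ S) MainO 1 (λ D → ∃[ m ] proj₁ m ≡ p × Isolated (O₀ S) m × D ≐ Graph._≈_ (O₀ S) m)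
  O₀-consistsOf = record
    { main-isComponent    = orderVertex t₁₂ ,
        (λ {m} main → connected m main) ,
        (λ {m} t⇝m → connected-closed (O₀ S) {MainO}
          (λ { {m} {k} e (ψ , Δψ , om) → ψ , Δψ , subst (IsOrder S (proj₁ ψ)) e om })
          (λ {m} {k} → MainO-closed {m} {k}) t⇝m (t₁₂ , nil , proj₂ (order (proj₁ t₁₂))))
    ; further             = λ _ → Graph._≈_ (O₀ S) pVertex
    ; further-isComponent = λ _ → isolated-isComponent (O₀ S) {pVertex} p-isolated
    ; further-satisfies   = λ _ → pVertex , refl , p-isolated , id , id
    ; main⊥further        = λ { _ {m} (main , e) → MainO⇒≢p m main e }
    ; further⊥further     = λ { zero zero i≢j _ → i≢j refl }
    ; cover               = λ m → byEquality m (proj₁ m ≟ⁿ p)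
    }
    where
    connected : ∀ m → MainO m → Connected (O₀ S) (orderVertex t₁₂) m
    connected m (ψ , Δψ , om) = ⇝⇒connected-O₀ {u = t₁₂} {ψ} Δψ ◅◅ _◅_ {j = m} (inj₁ sameOrder) nil
      where
      sameOrder : proj₁ (order (proj₁ ψ)) ≡ proj₁ m
      sameOrder = order-unique (proj₁ ψ) {proj₁ (order (proj₁ ψ))} {proj₁ m} (proj₂ (order (proj₁ ψ))) om
    byEquality : ∀ m → Dec (proj₁ m ≡ p) → MainO m ⊎ ∃[ i ] p ≡ proj₁ m
    byEquality m (yes m≡p) = inj₂ (zero {0} , sym m≡p)
    byEquality m (no m≢p)  = inj₁ (≢p⇒MainO m m≢p)

  O₀-main-notComplete : ¬ IsComplete (induced (O₀ S) MainO)
  O₀-main-notComplete complete = [ σ∤τ , τ∤σ ]′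
    (proj₂ (complete (orderVertex σ , σ , Δ̃-σ , oσ) (orderVertex τ , τ , Δ̃-τ , oτ) (λ e → σ∤τ (subst (proj₁ (order (proj₁ σ)) ∣_) e ∣-refl))))
    where
    oσ : IsOrder S (proj₁ σ) (proj₁ (order (proj₁ σ)))
    oσ = proj₂ (order (proj₁ σ))
    oτ : IsOrder S (proj₁ τ) (proj₁ (order (proj₁ τ)))
    oτ = proj₂ (order (proj₁ τ))
    σ∤τ : ¬ proj₁ (order (proj₁ σ)) ∣ proj₁ (order (proj₁ τ))
    σ∤τ d = σ³≉id λ i → ^-∣-id (proj₁ σ) {proj₁ (order (proj₁ σ))} (proj₁ (proj₂ oσ) i) (∣-trans d (order-minimal (proj₁ τ) {k = 3} oτ τ³))
    τ∤σ : ¬ proj₁ (order (proj₁ τ)) ∣ proj₁ (order (proj₁ σ))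
    τ∤σ d = τ²≉id λ i → ^-∣-id (proj₁ τ) {proj₁ (order (proj₁ τ))} (proj₁ (proj₂ oτ) i) (∣-trans d (order-minimal (proj₁ σ) {k = 2} oσ σ²))

theoremD :
  ∀ (n p : ℕ) (8≤n : 8 ≤ n) → Prime p → (n≡p⊎n≡1+p : n ≡ p ⊎ n ≡ suc p) →
  let
    S = Sym n

    Δ̃ = Connected (P̃₀ S) ([_] S ([12] (≤-trans (s≤s (s≤s z≤n)) 8≤n)))

    N = [ (λ _ → (n ∸ 2) !) , (λ _ → n * (n ∸ 3) !) ]′ n≡p⊎n≡1+p

    exceptionalParts = [ (λ _ → p ∷ []) , (λ _ → 1 ∷ p ∷ []) ]′ n≡p⊎n≡1+p

    C₂ = λ (ψ : Vertex (P₀ S)) → Δ̃ ([_] S ψ)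

    C₃ = λ (T : Vertex (P₀𝒯 n)) →
           ∃[ ψ ] Δ̃ ([_] S ψ) × proj₁ T ≈ᵖ type (proj₁ ψ)

    C₄ = λ (m : Vertex (O₀ S)) →
           ∃[ ψ ] Δ̃ ([_] S ψ) × IsOrder S (proj₁ ψ) (proj₁ m)
  in
  -- (i)
  ( ConsistsOf (P̃₀ S) Δ̃ N
      (λ D → ∃[ u ] Isolated (P̃₀ S) u × D ≐ Graph._≈_ (P̃₀ S) u)
  × (∀ (ψ : Vertex (P₀ S)) → ¬ IsCycle p (proj₁ ψ) → Δ̃ ([_] S ψ))
  × ¬ IsComplete (induced (P̃₀ S) Δ̃)
  )
  ×
  -- (ii)
  ( ConsistsOf (P₀ S) C₂ N
      (λ D → (∀ ψ → D ψ → IsCycle p (proj₁ ψ))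
           × HasSize (induced (P₀ S) D) (p ∸ 1)
           × IsComplete (induced (P₀ S) D))
  × (∀ (ψ : Vertex (P₀ S)) → ¬ IsCycle p (proj₁ ψ) → C₂ ψ)
  × ¬ IsComplete (induced (P₀ S) C₂)
  )
  ×
  -- (iii)
  ( ConsistsOf (P₀𝒯 n) C₃ 1
      (λ D → ∃[ T ] parts (proj₁ T) ↭ exceptionalParts
           × Isolated (P₀𝒯 n) T × D ≐ Graph._≈_ (P₀𝒯 n) T)
  × (∀ (ψ : Vertex (P₀ S)) → ¬ IsCycle p (proj₁ ψ) → C₃ (typeVertex ψ))
  × ¬ IsComplete (induced (P₀𝒯 n) C₃)
  )
  ×
  -- (iv)
  ( ConsistsOf (O₀ S) C₄ 1
      (λ D → ∃[ m ] proj₁ m ≡ p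
           × Isolated (O₀ S) m × D ≐ Graph._≈_ (O₀ S) m)
  × (∀ (ψ : Vertex (P₀ S)) (m : Vertex (O₀ S)) →
       IsOrder S (proj₁ ψ) (proj₁ m) → proj₁ m ≢ p → C₄ m)
  × ¬ IsComplete (induced (O₀ S) C₄)
  )
-- With p = q + 2, both (n - 2)! for n = p and (n - 3)! for n = p + 1 reduce to `q !`, the number of
-- subgroups counted by `OnAllPoints`.
theoremD _ (suc (suc q)) 8≤n pr (inj₁ refl) =
  (C.P̃₀-consistsOf , C.nonCycle⇒Δ̃ , C.P̃₀-main-notComplete) ,
  (C.P₀-consistsOf , C.nonCycle⇒Δ̃ , C.P₀-main-notComplete) ,
  (C.P₀𝒯-consistsOf , C.nonCycle⇒Main𝒯 , C.P₀𝒯-main-notComplete) ,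
  (C.O₀-consistsOf , C.order≢p⇒MainO , C.O₀-main-notComplete)
  where
  p = suc (suc q)
  7≤p : 7 ≤ p
  7≤p = ≤-trans (n≤1+n 7) 8≤n
  2≤n : 2 ≤ p
  2≤n = ≤-trans (s≤s (s≤s z≤n)) 8≤n
  i₀ : Fin (q !)
  i₀ = fromℕ< (>-nonZero⁻¹ (q !) {{q !≢0}})
  parts≡ : replicate (p ∸ p) 1 ++ p ∷ [] ≡ p ∷ []
  parts≡ = cong (λ k → replicate k 1 ++ p ∷ []) (n∸n≡0 p)
  module C = Components 8≤n pr 7≤p (inj₁ refl) (n≤1+n p) 2≤n (OnAllPoints.enumeration q pr 7≤p) i₀ (p ∷ []) parts≡
theoremD _ (suc (suc q)) 8≤n pr (inj₂ refl) =
  (C.P̃₀-consistsOf , C.nonCycle⇒Δ̃ , C.P̃₀-main-notComplete) ,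
  (C.P₀-consistsOf , C.nonCycle⇒Δ̃ , C.P₀-main-notComplete) ,
  (C.P₀𝒯-consistsOf , C.nonCycle⇒Main𝒯 , C.P₀𝒯-main-notComplete) ,
  (C.O₀-consistsOf , C.order≢p⇒MainO , C.O₀-main-notComplete)
  where
  p = suc (suc q)
  7≤p : 7 ≤ p
  7≤p = ≤-pred 8≤n
  2≤n : 2 ≤ suc p
  2≤n = ≤-trans (s≤s (s≤s z≤n)) 8≤n
  enum : Enumeration (suc p) p (suc p * q !)
  enum = WithFixedPoint.enumeration pr 7≤p (OnAllPoints.enumeration q pr 7≤p) (OnAllPoints.cycle-moves q pr 7≤p)
  i₀ : Fin (suc p * q !)
  i₀ = combine {suc p} zero (fromℕ< (>-nonZero⁻¹ (q !) {{q !≢0}}))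
  parts≡ : replicate (suc p ∸ p) 1 ++ p ∷ [] ≡ 1 ∷ p ∷ []
  parts≡ = cong (λ k → replicate k 1 ++ p ∷ []) (m+n∸n≡m 1 p)
  module C = Components 8≤n pr 7≤p (inj₂ refl) ≤-refl 2≤n enum i₀ (1 ∷ p ∷ []) parts≡
theoremD _ 0 ()             pr (inj₁ refl)
theoremD _ 0 (s≤s ())       pr (inj₂ refl)
theoremD _ 1 (s≤s ())       pr (inj₁ refl)
theoremD _ 1 (s≤s (s≤s ())) pr (inj₂ refl)
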